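{- For a prime power $q$ and a polynomial $P\in\mathbb{F}_q[x,y]$ with $P(0,0)=0$ and $\frac{\partial P}{\partial y}(0,0)\ne0$, of height $h=\deg_x P$ and degree $d=\deg_y P$, let $F=\sum_{n\ge0}a(n)x^n\in\mathbb{F}_q[[x]]$ be the Furstenberg series associated with $P$. Then the size (number of states) of the minimal $q$-automaton generating $a(n)_{n\ge0}$ is in $(1+o(1))\,q^{hd}$ as any one of $q$, $h$, or $d$ tends to infinity and the other two remain constant. That is: if two of the three parameters $q,h,d$ are fixed, there is a function $\varepsilon$ of the remaining parameter, tending to $0$ as that parameter tends to infinity, such that for every such $P$ with these values of $q,h,d$, the size of the minimal $q$-automaton is at most $(1+\varepsilon)\,q^{hd}$.
   Context: Furstenberg series: for $P\in\mathbb{F}_q[x,y]$ with $P(0,0)=0$ and $\frac{\partial P}{\partial y}(0,0)\ne 0$, the Furstenberg series associated with $P$ is the unique $F\in\mathbb{F}_q[[x]]$ with $F(0)=0$ and $P(x,F)=0$. Automata: a $q$-automaton is a deterministic finite automaton with output, with input alphabet $\{0,1,\dots,q-1\}$. It generates $a(n)_{n\ge0}$ if its output is $a(n)$ when fed the standard base-$q$ representation of $n$, starting with the least significant digit. It is not affected by leading $0$s if it also outputs $a(n)$ when fed any base-$q$ representation of $n$ padded with leading $0$s (again least significant digit first). The minimal $q$-automaton of $a(n)_{n\ge 0}$ is the smallest automaton that generates $a(n)_{n\ge0}$ and is not affected by leading $0$s. Equivalently, its states are in bijection with the $q$-kernel $\ker_q(a(n)_{n\ge0})=\{a(q^e n+r)_{n\ge0}: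 e\ge 0,\ 0\le r\le q^e-1\}$, so its size is $|\ker_q(a(n)_{n\ge0})|$. -}

module Defs where

open import Algebra.Bundles using (CommutativeRing; RawSemiring; Semiring)
open import Algebra.Definitions using (Invertible)
import Algebra.Definitions.RawSemiring as RawSemiringOps
open import Data.Digit using (Digit; Expansion; fromDigits)
open import Data.Fin.Base using (Fin; toℕ)
open import Data.Integer.Base using (+_)
open import Data.List.Base using (foldl; last)
open import Data.Maybe.Relation.Unary.All using (All)
open import Data.Nat.Base as ℕ using (ℕ; zero; suc)
open import Data.Nat.Primality using (Prime)
open import Data.Nat.Properties using (≤-trans; n≤1+n)
open import Data.Product.Base using (_×_; _,_; ∃-syntax)
open import Data.Rational.Base using (ℚ; 0ℚ; 1ℚ; _/_; _+_; _*_; _<_; _≤_; ∣_∣)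
open import Function.Bundles using (Inverse)
open import Function.Base using (id)
open import Level using (Level; _⊔_) renaming (suc to lsuc)
open import Relation.Binary.Bundles using (Setoid)
open import Relation.Binary.PropositionalEquality.Core using (_≡_; _≢_)
open import Relation.Binary.PropositionalEquality.Properties as ≡ using ()
open import Relation.Nullary.Negation using (¬_)

------------------------------------------------------------------------
-- Finite fields

IsPrimePower : ℕ → Set
IsPrimePower q = ∃[ p ] ∃[ k ] (Prime p × q ≡ p ℕ.^ suc k)

-- The enumeration makes _≈_ decidable, so no apartness relation is needed
-- to speak of nonzero elements.

record FiniteField (c ℓ : Level) (q : ℕ) : Set (lsuc (c ⊔ ℓ)) where
  field
    commutativeRing : CommutativeRing c ℓ

  open CommutativeRing commutativeRing
    using (Carrier; _≈_; 0#; 1#; setoid) renaming (_*_ to _·_)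

  field
    1≉0        : ¬ (1# ≈ 0#)
    invertible : ∀ (x : Carrier) → ¬ (x ≈ 0#) → Invertible _≈_ 1# _·_ x
    enumerate  : Inverse setoid (≡.setoid (Fin q))

------------------------------------------------------------------------
-- Bivariate polynomials and formal power series

module _ {c ℓ} (R : CommutativeRing c ℓ) where

  open CommutativeRing R
    using (Carrier; _≈_; 0#; 1#; semiring; trans)
    renaming (_+_ to _⊕_; _*_ to _⊗_)
  open Semiring semiring using (rawSemiring)
  open RawSemiringOps rawSemiring using (sum) renaming (_×_ to _⋆_)

  -- coeff i j is the coefficient of xⁱ yʲ.  The field bound is only a
  -- witness of finite support; it carries no degree information.

  record Polynomial₂ : Set (c ⊔ ℓ) where
    field
      coeff     : ℕ → ℕ → Carrier
      bound     : ℕ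
      vanishesˣ : ∀ i j → bound ℕ.≤ i → coeff i j ≈ 0#
      vanishesʸ : ∀ i j → bound ℕ.≤ j → coeff i j ≈ 0#

  open Polynomial₂

  HasDegreeˣ : Polynomial₂ → ℕ → Set ℓ
  HasDegreeˣ P h = (∃[ j ] ¬ (coeff P h j ≈ 0#))
                 × (∀ i j → h ℕ.< i → coeff P i j ≈ 0#)

  HasDegreeʸ : Polynomial₂ → ℕ → Set ℓ
  HasDegreeʸ P d = (∃[ i ] ¬ (coeff P i d ≈ 0#))
                 × (∀ i j → d ℕ.< j → coeff P i j ≈ 0#)

  -- P(s, t) in a semiring S, with coefficients transported along ι.

  evalIn : ∀ {a m} (S : RawSemiring a m) → (Carrier → RawSemiring.Carrier S) →
           Polynomial₂ → (s t : RawSemiring.Carrier S) → RawSemiring.Carrier S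
  evalIn S ι P s t =
    S.sum {bound P} λ i → S.sum {bound P} λ j →
      ι (coeff P (toℕ i) (toℕ j)) S.* (s S.^ toℕ i) S.* (t S.^ toℕ j)
    where
    module S where
      open RawSemiring S public
      open RawSemiringOps S public

  eval : Polynomial₂ → Carrier → Carrier → Carrier
  eval = evalIn rawSemiring id

  ∂ʸ : Polynomial₂ → Polynomial₂
  ∂ʸ P = record
    { coeff     = λ i j → suc j ⋆ coeff P i (suc j)
    ; bound     = bound P
    ; vanishesˣ = λ i j b≤i → multiple-zero (suc j) (vanishesˣ P i (suc j) b≤i)
    ; vanishesʸ = λ i j b≤j → multiple-zero (suc j)
                    (vanishesʸ P i (suc j) (≤-trans b≤j (n≤1+n j)))
    }
    where
    open CommutativeRing R using (+-cong; +-identityˡ; refl)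

    multiple-zero : ∀ n {x} → x ≈ 0# → n ⋆ x ≈ 0#
    multiple-zero zero    x≈0 = refl
    multiple-zero (suc n) x≈0 =
      trans (+-cong x≈0 (multiple-zero n x≈0)) (+-identityˡ 0#)

  PowerSeries : Set c
  PowerSeries = ℕ → Carrier

  constant : Carrier → PowerSeries
  constant a zero    = a
  constant a (suc _) = 0#

  X : PowerSeries
  X zero          = 0#
  X (suc zero)    = 1#
  X (suc (suc _)) = 0#

  powerSeriesRawSemiring : RawSemiring c ℓ
  powerSeriesRawSemiring = record
    { Carrier = PowerSeries
    ; _≈_     = λ f g → ∀ n → f n ≈ g n
    ; _+_     = λ f g n → f n ⊕ g n
    ; _*_     = λ f g n → sum {suc n} λ i → f (toℕ i) ⊗ g (n ℕ.∸ toℕ i)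
    ; 0#      = constant 0#
    ; 1#      = constant 1#
    }

  open RawSemiring powerSeriesRawSemiring using () renaming (_≈_ to _≋_; 0# to 0ˢ)

  evalSeries : Polynomial₂ → PowerSeries → PowerSeries → PowerSeries
  evalSeries = evalIn powerSeriesRawSemiring constant

  -- Under the two conditions on P, exactly one F satisfies IsFurstenbergSeries P F.

  FurstenbergCondition : Polynomial₂ → Set ℓ
  FurstenbergCondition P = eval P 0# 0# ≈ 0# × ¬ (eval (∂ʸ P) 0# 0# ≈ 0#)

  IsFurstenbergSeries : Polynomial₂ → PowerSeries → Set ℓ
  IsFurstenbergSeries P F = F 0 ≈ 0# × evalSeries P X F ≋ 0ˢ

------------------------------------------------------------------------
-- Automata with output, reading the least significant digit first

record Automaton {o} (q : ℕ) (Output : Set o) : Set o where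
  field
    size    : ℕ
    initial : Fin size
    step    : Fin size → Digit q → Fin size
    output  : Fin size → Output

  run : Expansion q → Output
  run ds = output (foldl step initial ds)

open Automaton using (size; run)

-- A standard representation has no superfluous zero digit at its most
-- significant end, which is the end of the list; 0 is represented by [].

IsStandard : ∀ {q} → Expansion q → Set
IsStandard ds = All (λ d → toℕ d ≢ 0) (last ds)

module _ {o ℓ} (O : Setoid o ℓ) {q : ℕ} where

  open Setoid O using (_≈_) renaming (Carrier to Output)

  Generates : Automaton q Output → (ℕ → Output) → Set ℓ
  Generates M a = ∀ n ds → fromDigits ds ≡ n → IsStandard ds → run M ds ≈ a n

  UnaffectedByLeadingZeros : Automaton q Output → (ℕ → Output) → Set ℓ
  UnaffectedByLeadingZeros M a = ∀ n ds → fromDigits ds ≡ n → run M ds ≈ a n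

  IsMinimalAutomaton : Automaton q Output → (ℕ → Output) → Set (o ⊔ ℓ)
  IsMinimalAutomaton M a =
    Generates M a × UnaffectedByLeadingZeros M a ×
    (∀ M′ → Generates M′ a → UnaffectedByLeadingZeros M′ a → size M ℕ.≤ size M′)

------------------------------------------------------------------------
-- Asymptotics

TendsToZero : (ℕ → ℚ) → Set
TendsToZero ε = ∀ δ → 0ℚ < δ → ∃[ N ] ∀ n → N ℕ.≤ n → ∣ ε n ∣ < δ

-- The minimal automaton of every Furstenberg series over K with parameters
-- h, d exists and has at most (1 + e) q^(hd) states.

module _ {c ℓ q} (K : FiniteField c ℓ q) where

  open FiniteField K using () renaming (commutativeRing to R)
  open CommutativeRing R using (setoid)

  MinimalSizesBoundedOver : (h d : ℕ) → ℚ → Set (c ⊔ ℓ)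
  MinimalSizesBoundedOver h d e =
    (P : Polynomial₂ R) → FurstenbergCondition R P →
    HasDegreeˣ R P h → HasDegreeʸ R P d →
    (F : PowerSeries R) → IsFurstenbergSeries R P F →
    ∃[ M ] (IsMinimalAutomaton setoid {q} M F
           × + size M / 1 ≤ (1ℚ + e) * (+ (q ℕ.^ (h ℕ.* d)) / 1))

MinimalSizesBounded : (c ℓ : Level) (q h d : ℕ) → ℚ → Set (lsuc (c ⊔ ℓ))
MinimalSizesBounded c ℓ q h d e =
  (K : FiniteField c ℓ q) → MinimalSizesBoundedOver K h d e

{-# OPTIONS --safe #-}

-- Write q for the order of the field K and Λ_r for the r-th section
-- Σ a(n) xⁿ ↦ Σ a(qn + r) xⁿ.  The states are the polynomials S with deg_x S ≤ h
-- and deg_y S < d; the state S stands for the series S(x, F) / ∂P/∂y(x, F), the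
-- residue of S/P at y = F.  Since S/P = S P^(q-1) / P^q, the operator Λ_r acts
-- on states by S ↦ (the coefficients of x^(qi+r) y^(qj+q-1) in S P^(q-1)).  For
-- r > 0 the image has deg_x < h, a condition preserved by Λ_0 and satisfied by
-- q^(hd) polynomials only, so the only other states are the iterates of the
-- initial state under Λ_0.  On the extreme coefficients of S (those of x^0, of x^h,
-- or of y^(d-1)) Λ_0 acts by f ↦ Λ(f A^(q-1)) with A in one variable.  If A
-- divides a power of y^(q^m) - y, the iterates are eventually m-periodic, and
-- m can be taken to be the product of the distinct degrees of the irreducible
-- factors of A, which is subexponential in deg A.  The iterates under Λ_0 are thus
-- few: at most about m times the number of choices of the other coefficients.

module Submission where

open import Defs
open import Algebra.Bundles using (CommutativeMonoid; CommutativeRing; RawSemiring)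
import Algebra.Properties.AbelianGroup as AbelianGroupProperties
import Algebra.Properties.CommutativeMonoid.Sum as CommutativeMonoidSum
import Algebra.Properties.CommutativeSemigroup as CommutativeSemigroupProperties
import Algebra.Properties.CommutativeSemiring.Binomial as BinomialTheorem
import Algebra.Properties.CommutativeSemiring.Exp as Exponentiation
import Algebra.Properties.Group as GroupProperties
import Algebra.Properties.Ring as RingProperties
import Algebra.Properties.Semiring.Divisibility as Divisibility
import Algebra.Properties.Semiring.Mult as Multiples
import Algebra.Properties.Semiring.Sum as SemiringSum
import Algebra.Solver.Ring.NaturalCoefficients.Default as RingSolver
open import Algebra.Structures using (IsCommutativeRing)
open import Data.Digit using (Expansion; fromDigits)
open import Data.Fin.Base as Fin using (Fin; zero; suc; toℕ; fromℕ; fromℕ<; inject₁; combine; join; splitAt; funToFin; finToFun)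
open import Data.Fin.Permutation using (Permutation′; permutation; _⟨$⟩ʳ_)
import Data.Fin.Properties as Finₚ
open import Data.Integer.Base as ℤ using (+≤+; +<+)
import Data.Integer.Properties as ℤₚ
open import Data.List.Base using (List; []; _∷_; foldl; length; lookup; filter; _++_; _∷ʳ_)
open import Data.List.Membership.Propositional.Properties using (∈-lookup)
open import Data.List.Properties using (filter-accept; filter-reject; foldl-∷ʳ; foldl-++)
open import Data.List.Relation.Unary.All as All using (All; []; _∷_)
open import Data.List.Relation.Unary.All.Properties using (all-filter; ¬Any⇒All¬)
open import Data.List.Relation.Unary.AllPairs using ([]; _∷_)
open import Data.List.Relation.Unary.Unique.Propositional using (Unique)
open import Data.List.Relation.Unary.Unique.Propositional.Properties using (filter⁺)
open import Data.Nat.Base as ℕ using (ℕ; zero; suc; pred; _!; _≤_; _<_; s≤s; z≤n)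
open import Data.Nat.Combinatorics using (nCn≡1; nCk≡nC[n∸k]; nCk≡n!/k![n-k]!; k![n∸k]!∣n!) renaming (_C_ to _choose_)
open import Data.Nat.DivMod using (_/_; _%_; m/n*n≡m; m≡m%n+[m/n]*n; m%n<n)
open import Data.Nat.Divisibility using (divides; ∣⇒≤; ∣1⇒≡1; m∣m*n) renaming (_∣_ to _∣ℕ_; _∤_ to _∤ℕ_)
open import Data.Nat.Induction using (<-rec)
import Data.Nat.ListAction as ListAction
open import Data.Nat.ListAction.Properties using (∈⇒∣product)
open import Data.Nat.Primality using (Prime; euclidsLemma; prime⇒nonZero; ¬prime[1])
import Data.Nat.Properties as ℕₚ
open import Data.Nat.Solver using (module +-*-Solver)
open import Data.List.Membership.DecPropositional ℕₚ._≟_ using (_∈?_)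
open import Data.Product.Base using (_,_; _×_; ∃-syntax; proj₁; proj₂)
open import Data.Rational.Base as ℚ using (ℚ; mkℚ; 0ℚ; 1ℚ; toℚᵘ)
import Data.Rational.Properties as ℚₚ
open import Data.Rational.Unnormalised.Base as ℚᵘ using (mkℚᵘ; *≤*; *<*)
import Data.Rational.Unnormalised.Properties as ℚᵘₚ
open import Data.Sum.Base using (inj₁; inj₂; _⊎_)
open import Data.Sum.Properties using (inj₁-injective; inj₂-injective)
open import Function.Bundles using (Inverse)
open import Level using (Level; _⊔_)
open import Relation.Binary.Bundles using (Setoid)
open import Relation.Binary.PropositionalEquality as ≡ using (_≡_)
import Relation.Binary.Reasoning.Setoid as SetoidReasoning
open import Relation.Nullary.Decidable using (Dec; yes; no; map′; _×-dec_; toWitness; decidable-stable; ¬¬-excluded-middle)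
open import Relation.Nullary.Negation using (¬_; contradiction; ¬¬-map)

-- With both extreme columns periodic, the excess is about `m₀ * m₁` times `q^(d(h-1))`: small
-- against `q^(hd)` when `q` or `d` grows, but not when `h` does. With the row of `y^(d-1)` periodic
-- it is about `m` times `q^((d-1)(h+1))`, which is small when `h` grows. The bound on a period must
-- therefore be free of `q` and stay below the geometric growth that it competes with. The estimate
-- `m² ≤ C (3/2)^n` is enough and elementary: it concerns the square because two periods get
-- multiplied, and 3/2 lies far enough below 2 ≤ `q` to spare a factor `n + 1`, so that every error
-- term has the form `c/(n+1)`. Irreducible factors are shown to exist only under double negation.
-- The minimal automaton is therefore constructed without them, by exploring finitely many codes of
-- states; the factorisation enters only into an inequality of natural numbers, which is decidable
-- and hence stable.

module SeriesRing {c ℓ} (R : CommutativeRing c ℓ) where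

  open CommutativeRing R hiding (zero)
  open SetoidReasoning setoid
  open CommutativeSemigroupProperties (CommutativeMonoid.commutativeSemigroup +-commutativeMonoid) using (interchange)
  open RawSemiring (powerSeriesRawSemiring R) public
    using ()
    renaming (_≈_ to _≋_; _+_ to infixl 6 _⊞_; 0# to 0ˢ; 1# to 1ˢ)

  Series : Set c
  Series = PowerSeries R

  tail : Series → Series
  tail f n = f (suc n)

  shift : Series → Series
  shift f zero    = 0#
  shift f (suc n) = f n

  _·_ : Carrier → Series → Series
  (a · f) n = a * f n

  ⊟_ : Series → Series
  (⊟ f) n = - f n

  -- Opaque, since unfolding the convolution sum defeats unification.
  opaque
    _⊛_ : Series → Series → Series
    _⊛_ = RawSemiring._*_ (powerSeriesRawSemiring R)

    ⊛-head : ∀ f g → (f ⊛ g) 0 ≈ f 0 * g 0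
    ⊛-head f g = +-identityʳ _

    ⊛-tail : ∀ f g n → (f ⊛ g) (suc n) ≈ f 0 * g (suc n) + (tail f ⊛ g) n
    ⊛-tail f g n = refl

  infixl 7 _·_ _⊛_
  infix 8 ⊟_

  0ˢ≈0 : ∀ n → 0ˢ n ≈ 0#
  0ˢ≈0 zero    = refl
  0ˢ≈0 (suc n) = refl

  constant-cong : ∀ {a b} → a ≈ b → constant R a ≋ constant R b
  constant-cong p zero    = p
  constant-cong p (suc n) = refl

  shift-cong : ∀ {f g} → f ≋ g → shift f ≋ shift g
  shift-cong p zero    = refl
  shift-cong p (suc n) = p n

  ⊛-cong : ∀ {f f′ g g′} → f ≋ f′ → g ≋ g′ → (f ⊛ g) ≋ (f′ ⊛ g′)
  ⊛-cong {f} {f′} {g} {g′} p q zero = begin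
    (f ⊛ g) 0 ≈⟨ ⊛-head f g ⟩
    f 0 * g 0 ≈⟨ *-cong (p 0) (q 0) ⟩
    f′ 0 * g′ 0 ≈⟨ ⊛-head f′ g′ ⟨
    (f′ ⊛ g′) 0 ∎
  ⊛-cong {f} {f′} {g} {g′} p q (suc n) = begin
    (f ⊛ g) (suc n) ≈⟨ ⊛-tail f g n ⟩
    f 0 * g (suc n) + (tail f ⊛ g) n ≈⟨ +-cong (*-cong (p 0) (q (suc n))) (⊛-cong (λ k → p (suc k)) q n) ⟩
    f′ 0 * g′ (suc n) + (tail f′ ⊛ g′) n ≈⟨ ⊛-tail f′ g′ n ⟨
    (f′ ⊛ g′) (suc n) ∎

  ⊛-congˡ : ∀ {f g g′} → g ≋ g′ → (f ⊛ g) ≋ (f ⊛ g′)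
  ⊛-congˡ q = ⊛-cong (λ _ → refl) q

  ⊛-congʳ : ∀ {f f′ g} → f ≋ f′ → (f ⊛ g) ≋ (f′ ⊛ g)
  ⊛-congʳ p = ⊛-cong p (λ _ → refl)

  -- The mirror image of `⊛-tail`, peeling the right factor. Comparing the two decompositions gives
  -- commutativity, and `section-⊛-^` needs this one.
  ⊛-tailʳ : ∀ f g n → (f ⊛ g) (suc n) ≈ (f ⊛ tail g) n + f (suc n) * g 0
  ⊛-tailʳ f g zero = begin
    (f ⊛ g) 1 ≈⟨ ⊛-tail f g 0 ⟩
    f 0 * g 1 + (tail f ⊛ g) 0 ≈⟨ +-cong (sym (⊛-head f (tail g))) (⊛-head (tail f) g) ⟩
    (f ⊛ tail g) 0 + f 1 * g 0 ∎
  ⊛-tailʳ f g (suc n) = begin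
    (f ⊛ g) (suc (suc n)) ≈⟨ ⊛-tail f g (suc n) ⟩
    f 0 * g (suc (suc n)) + (tail f ⊛ g) (suc n) ≈⟨ +-congˡ (⊛-tailʳ (tail f) g n) ⟩
    f 0 * g (suc (suc n)) + ((tail f ⊛ tail g) n + f (suc (suc n)) * g 0)
                                                      ≈⟨ +-assoc _ _ _ ⟨
    f 0 * g (suc (suc n)) + (tail f ⊛ tail g) n + f (suc (suc n)) * g 0
                                                      ≈⟨ +-congʳ (⊛-tail f (tail g) n) ⟨
    (f ⊛ tail g) (suc n) + f (suc (suc n)) * g 0 ∎

  ⊛-comm : ∀ f g → (f ⊛ g) ≋ (g ⊛ f)
  ⊛-comm f g zero = begin
    (f ⊛ g) 0 ≈⟨ ⊛-head f g ⟩
    f 0 * g 0 ≈⟨ *-comm _ _ ⟩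
    g 0 * f 0 ≈⟨ ⊛-head g f ⟨
    (g ⊛ f) 0 ∎
  ⊛-comm f g (suc n) = begin
    (f ⊛ g) (suc n) ≈⟨ ⊛-tail f g n ⟩
    f 0 * g (suc n) + (tail f ⊛ g) n ≈⟨ +-cong (*-comm _ _) (⊛-comm (tail f) g n) ⟩
    g (suc n) * f 0 + (g ⊛ tail f) n ≈⟨ +-comm _ _ ⟩
    (g ⊛ tail f) n + g (suc n) * f 0 ≈⟨ ⊛-tailʳ g f n ⟨
    (g ⊛ f) (suc n) ∎

  ⊛-distribʳ : ∀ f g h → ((g ⊞ h) ⊛ f) ≋ ((g ⊛ f) ⊞ (h ⊛ f))
  ⊛-distribʳ f g h zero = begin
    ((g ⊞ h) ⊛ f) 0 ≈⟨ ⊛-head (g ⊞ h) f ⟩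
    (g 0 + h 0) * f 0 ≈⟨ distribʳ _ _ _ ⟩
    g 0 * f 0 + h 0 * f 0 ≈⟨ +-cong (⊛-head g f) (⊛-head h f) ⟨
    (g ⊛ f) 0 + (h ⊛ f) 0 ∎
  ⊛-distribʳ f g h (suc n) = begin
    ((g ⊞ h) ⊛ f) (suc n)
      ≈⟨ ⊛-tail (g ⊞ h) f n ⟩
    (g 0 + h 0) * f (suc n) + ((tail g ⊞ tail h) ⊛ f) n
      ≈⟨ +-cong (distribʳ _ _ _) (⊛-distribʳ f (tail g) (tail h) n) ⟩
    g 0 * f (suc n) + h 0 * f (suc n) + ((tail g ⊛ f) n + (tail h ⊛ f) n)
      ≈⟨ interchange _ _ _ _ ⟩
    g 0 * f (suc n) + (tail g ⊛ f) n + (h 0 * f (suc n) + (tail h ⊛ f) n)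
      ≈⟨ +-cong (⊛-tail g f n) (⊛-tail h f n) ⟨
    (g ⊛ f) (suc n) + (h ⊛ f) (suc n) ∎

  ⊛-distribˡ : ∀ f g h → (f ⊛ (g ⊞ h)) ≋ ((f ⊛ g) ⊞ (f ⊛ h))
  ⊛-distribˡ f g h n = begin
    (f ⊛ (g ⊞ h)) n ≈⟨ ⊛-comm f (g ⊞ h) n ⟩
    ((g ⊞ h) ⊛ f) n ≈⟨ ⊛-distribʳ f g h n ⟩
    (g ⊛ f) n + (h ⊛ f) n ≈⟨ +-cong (⊛-comm g f n) (⊛-comm h f n) ⟩
    (f ⊛ g) n + (f ⊛ h) n ∎

  ⊛-vanish : ∀ f g → (∀ n → f n ≈ 0#) → ∀ n → (f ⊛ g) n ≈ 0#
  ⊛-vanish f g p zero    = trans (⊛-head f g) (trans (*-congʳ (p 0)) (zeroˡ _))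
  ⊛-vanish f g p (suc n) = begin
    (f ⊛ g) (suc n) ≈⟨ ⊛-tail f g n ⟩
    f 0 * g (suc n) + (tail f ⊛ g) n
      ≈⟨ +-cong (trans (*-congʳ (p 0)) (zeroˡ _)) (⊛-vanish (tail f) g (λ k → p (suc k)) n) ⟩
    0# + 0# ≈⟨ +-identityˡ _ ⟩
    0# ∎

  constant-⊛ : ∀ a f → (constant R a ⊛ f) ≋ (a · f)
  constant-⊛ a f zero    = ⊛-head _ f
  constant-⊛ a f (suc n) = trans (⊛-tail _ f n)
    (trans (+-congˡ (⊛-vanish (tail (constant R a)) f (λ _ → refl) n)) (+-identityʳ _))

  shift-⊛ : ∀ f g → (shift f ⊛ g) ≋ shift (f ⊛ g)
  shift-⊛ f g zero    = trans (⊛-head _ g) (zeroˡ _)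
  shift-⊛ f g (suc n) = trans (⊛-tail _ g n) (trans (+-congʳ (zeroˡ _)) (+-identityˡ _))

  ·-⊛ : ∀ a f g → ((a · f) ⊛ g) ≋ (a · (f ⊛ g))
  ·-⊛ a f g zero = begin
    ((a · f) ⊛ g) 0 ≈⟨ ⊛-head (a · f) g ⟩
    a * f 0 * g 0 ≈⟨ *-assoc _ _ _ ⟩
    a * (f 0 * g 0) ≈⟨ *-congˡ (⊛-head f g) ⟨
    a * (f ⊛ g) 0 ∎
  ·-⊛ a f g (suc n) = begin
    ((a · f) ⊛ g) (suc n)
      ≈⟨ ⊛-tail (a · f) g n ⟩
    a * f 0 * g (suc n) + ((a · tail f) ⊛ g) n
      ≈⟨ +-cong (*-assoc _ _ _) (·-⊛ a (tail f) g n) ⟩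
    a * (f 0 * g (suc n)) + a * (tail f ⊛ g) n
      ≈⟨ distribˡ _ _ _ ⟨
    a * (f 0 * g (suc n) + (tail f ⊛ g) n)
      ≈⟨ *-congˡ (⊛-tail f g n) ⟨
    a * (f ⊛ g) (suc n) ∎

  ⊛-assoc : ∀ f g h → ((f ⊛ g) ⊛ h) ≋ (f ⊛ (g ⊛ h))
  ⊛-assoc f g h zero = begin
    ((f ⊛ g) ⊛ h) 0 ≈⟨ ⊛-head (f ⊛ g) h ⟩
    (f ⊛ g) 0 * h 0 ≈⟨ *-congʳ (⊛-head f g) ⟩
    f 0 * g 0 * h 0 ≈⟨ *-assoc _ _ _ ⟩
    f 0 * (g 0 * h 0) ≈⟨ *-congˡ (⊛-head g h) ⟨
    f 0 * (g ⊛ h) 0 ≈⟨ ⊛-head f (g ⊛ h) ⟨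
    (f ⊛ (g ⊛ h)) 0 ∎
  ⊛-assoc f g h (suc n) = begin
    ((f ⊛ g) ⊛ h) (suc n)
      ≈⟨ ⊛-tail (f ⊛ g) h n ⟩
    (f ⊛ g) 0 * h (suc n) + (tail (f ⊛ g) ⊛ h) n
      ≈⟨ +-cong (*-congʳ (⊛-head f g)) (⊛-congʳ (⊛-tail f g) n) ⟩
    f 0 * g 0 * h (suc n) + (((f 0 · tail g) ⊞ (tail f ⊛ g)) ⊛ h) n
      ≈⟨ +-congˡ (⊛-distribʳ h (f 0 · tail g) (tail f ⊛ g) n) ⟩
    f 0 * g 0 * h (suc n) + (((f 0 · tail g) ⊛ h) n + ((tail f ⊛ g) ⊛ h) n)
      ≈⟨ +-cong (*-assoc _ _ _) (+-cong (·-⊛ (f 0) (tail g) h n) (⊛-assoc (tail f) g h n)) ⟩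
    f 0 * (g 0 * h (suc n)) + (f 0 * (tail g ⊛ h) n + (tail f ⊛ (g ⊛ h)) n)
      ≈⟨ +-assoc _ _ _ ⟨
    f 0 * (g 0 * h (suc n)) + f 0 * (tail g ⊛ h) n + (tail f ⊛ (g ⊛ h)) n
      ≈⟨ +-congʳ (distribˡ _ _ _) ⟨
    f 0 * (g 0 * h (suc n) + (tail g ⊛ h) n) + (tail f ⊛ (g ⊛ h)) n
      ≈⟨ +-congʳ (*-congˡ (⊛-tail g h n)) ⟨
    f 0 * (g ⊛ h) (suc n) + (tail f ⊛ (g ⊛ h)) n
      ≈⟨ ⊛-tail f (g ⊛ h) n ⟨
    (f ⊛ (g ⊛ h)) (suc n) ∎

  ⊛-identityˡ : ∀ f → (1ˢ ⊛ f) ≋ f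
  ⊛-identityˡ f n = trans (constant-⊛ 1# f n) (*-identityˡ _)

  seriesRing : CommutativeRing c ℓ
  seriesRing = record
    { Carrier = Series ; _≈_ = _≋_ ; _+_ = _⊞_ ; _*_ = _⊛_ ; -_ = ⊟_ ; 0# = 0ˢ ; 1# = 1ˢ
    ; isCommutativeRing = record
      { isRing = record
        { +-isAbelianGroup = record
          { isGroup = record
            { isMonoid = record
              { isSemigroup = record
                { isMagma = record
                  { isEquivalence = record
                    { refl  = λ n → refl
                    ; sym   = λ p n → sym (p n)
                    ; trans = λ p q n → trans (p n) (q n) }
                  ; ∙-cong = λ p q n → +-cong (p n) (q n) }
                ; assoc = λ f g h n → +-assoc _ _ _ }
              ; identity = (λ f n → trans (+-congʳ (0ˢ≈0 n)) (+-identityˡ _))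
                         , (λ f n → trans (+-congˡ (0ˢ≈0 n)) (+-identityʳ _)) }
            ; inverse = (λ f n → trans (-‿inverseˡ _) (sym (0ˢ≈0 n)))
                      , (λ f n → trans (-‿inverseʳ _) (sym (0ˢ≈0 n)))
            ; ⁻¹-cong = λ p n → -‿cong (p n) }
          ; comm = λ f g n → +-comm _ _ }
        ; *-cong = ⊛-cong
        ; *-assoc = ⊛-assoc
        ; *-identity = ⊛-identityˡ , λ f n → trans (⊛-comm f 1ˢ n) (⊛-identityˡ f n)
        ; distrib = ⊛-distribˡ , ⊛-distribʳ }
      ; *-comm = ⊛-comm } }

-- Binomial coefficients and the Frobenius endomorphism

prime∤factorial : ∀ {p} → Prime p → ∀ k → k < p → p ∤ℕ k !
prime∤factorial pr zero    k<p p∣1 = ¬prime[1] (≡.subst Prime (∣1⇒≡1 p∣1) pr)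
prime∤factorial pr (suc k) k<p p∣k! with euclidsLemma (suc k) (k !) pr p∣k!
... | inj₁ p∣k  = ℕₚ.<⇒≱ k<p (∣⇒≤ p∣k)
... | inj₂ p∣k! = prime∤factorial pr k (ℕₚ.<-trans (ℕₚ.n<1+n k) k<p) p∣k!

-- The prime divides `p !`, the product of the binomial coefficient with `k !` and `(p ∸ k) !`, but
-- neither of these factorials of smaller numbers.
prime∣binomial : ∀ {p} → Prime p → ∀ k → 0 < k → k < p → p ∣ℕ (p choose k)
prime∣binomial {p} pr k 0<k k<p with euclidsLemma (p choose k) (k ! ℕ.* (p ℕ.∸ k) !) pr p∣product
  where
  instance
    nonZero = k ℕₚ.!* (p ℕ.∸ k) !≢0
    p≢0 = prime⇒nonZero pr
  product≡p! : (p choose k) ℕ.* (k ! ℕ.* (p ℕ.∸ k) !) ≡ p !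
  product≡p! = ≡.trans (≡.cong (ℕ._* (k ! ℕ.* (p ℕ.∸ k) !)) (nCk≡n!/k![n-k]! (ℕₚ.<⇒≤ k<p)))
                       (m/n*n≡m (k![n∸k]!∣n! (ℕₚ.<⇒≤ k<p)))
  p∣n! : ∀ n .{{_ : ℕ.NonZero n}} → n ∣ℕ n !
  p∣n! (suc n) = m∣m*n (n !)
  p∣product : p ∣ℕ (p choose k) ℕ.* (k ! ℕ.* (p ℕ.∸ k) !)
  p∣product = ≡.subst (p ∣ℕ_) (≡.sym product≡p!) (p∣n! p)
... | inj₁ p∣C = p∣C
... | inj₂ p∣rest with euclidsLemma (k !) ((p ℕ.∸ k) !) pr p∣rest
...   | inj₁ p∣k!   = contradiction p∣k! (prime∤factorial pr k k<p)
...   | inj₂ p∣p-k! = contradiction p∣p-k!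
  (prime∤factorial pr (p ℕ.∸ k) (ℕₚ.∸-monoʳ-< 0<k (ℕₚ.<⇒≤ k<p)))

module Frobenius {c ℓ} (R : CommutativeRing c ℓ) {p} (pr : Prime p) where

  open CommutativeRing R hiding (zero)
  open Exponentiation commutativeSemiring
  open Multiples semiring renaming (_×_ to _⋆_)
  open CommutativeMonoidSum +-commutativeMonoid
  open BinomialTheorem commutativeSemiring using (theorem; binomialTerm)
  open SetoidReasoning setoid

  module _ (p⋆1≈0 : p ⋆ 1# ≈ 0#) where

    multiple-vanishes : ∀ {n} x → p ∣ℕ n → n ⋆ x ≈ 0#
    multiple-vanishes x (divides m ≡.refl) = begin
      (m ℕ.* p) ⋆ x ≈⟨ ×-assocˡ x m p ⟨
      m ⋆ (p ⋆ x) ≈⟨ ×-congʳ m (begin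
        p ⋆ x ≈⟨ ×-congʳ p (*-identityˡ x) ⟨
        p ⋆ (1# * x) ≈⟨ ×-assoc-* p 1# x ⟨
        (p ⋆ 1#) * x ≈⟨ *-congʳ p⋆1≈0 ⟩
        0# * x ≈⟨ zeroˡ x ⟩
        0# ∎) ⟩
      m ⋆ 0# ≈⟨ ×-congʳ m (zeroˡ 0#) ⟨
      m ⋆ (0# * 0#) ≈⟨ ×-comm-* m 0# 0# ⟨
      0# * (m ⋆ 0#) ≈⟨ zeroˡ _ ⟩
      0# ∎

    ^p-distrib-+ : ∀ x y → (x + y) ^ p ≈ x ^ p + y ^ p
    ^p-distrib-+ x y = expand p ≡.refl (prime⇒nonZero pr)
      where
      -- The exponent is generalised from `p` to an equal `n`, so that it can be matched as a
      -- successor and the two extreme binomial terms split off.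
      expand : ∀ n → n ≡ p → ℕ.NonZero n → (x + y) ^ n ≈ x ^ n + y ^ n
      expand n@(suc n-1) n≡p _ = begin
        (x + y) ^ n ≈⟨ theorem n x y ⟩
        sum (binomialTerm x y n) ≈⟨ sum-init-last (binomialTerm x y n) ⟩
        (binomialTerm x y n zero + sum {n-1} middle) + binomialTerm x y n (fromℕ n)
          ≈⟨ +-cong (+-cong lowest (trans (sum-cong-≋ middle≈0) (sum-replicate-zero n-1))) highest ⟩
        (y ^ n + 0#) + x ^ n ≈⟨ +-congʳ (+-identityʳ _) ⟩
        y ^ n + x ^ n ≈⟨ +-comm _ _ ⟩
        x ^ n + y ^ n ∎
        where
        middle : Fin n-1 → Carrier
        middle i = binomialTerm x y n (suc (inject₁ i))
        lowest : binomialTerm x y n zero ≈ y ^ n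
        lowest = begin
          (n choose 0) ⋆ (1# * y ^ n) ≡⟨ ≡.cong (_⋆ (1# * y ^ n)) (≡.trans (nCk≡nC[n∸k] {0} {n} z≤n) (nCn≡1 n)) ⟩
          1 ⋆ (1# * y ^ n) ≈⟨ ×-homo-1 _ ⟩
          1# * y ^ n ≈⟨ *-identityˡ _ ⟩
          y ^ n ∎
        highest : binomialTerm x y n (fromℕ n) ≈ x ^ n
        highest rewrite Finₚ.toℕ-fromℕ n-1 = begin
          (n choose n) ⋆ (x ^ n * y ^ (n-1 ℕ.∸ n-1))
            ≡⟨ ≡.cong₂ (λ i j → i ⋆ (x ^ n * y ^ j)) (nCn≡1 n) (ℕₚ.n∸n≡0 n-1) ⟩
          1 ⋆ (x ^ n * 1#) ≈⟨ ×-homo-1 _ ⟩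
          x ^ n * 1# ≈⟨ *-identityʳ _ ⟩
          x ^ n ∎
        middle≈0 : ∀ i → middle i ≈ 0#
        middle≈0 i = multiple-vanishes _
          (≡.subst (λ m → m ∣ℕ (n choose suc (toℕ (inject₁ i)))) n≡p
            (prime∣binomial (≡.subst Prime (≡.sym n≡p) pr) _ (s≤s z≤n)
              (s≤s (≡.subst (_< n-1) (≡.sym (Finₚ.toℕ-inject₁ i)) (Finₚ.toℕ<n i)))))

    ^p^k-distrib-+ : ∀ k x y → (x + y) ^ (p ℕ.^ k) ≈ x ^ (p ℕ.^ k) + y ^ (p ℕ.^ k)
    ^p^k-distrib-+ zero x y =
      trans (*-identityʳ _) (sym (+-cong (*-identityʳ _) (*-identityʳ _)))
    ^p^k-distrib-+ (suc k) x y = begin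
      (x + y) ^ (p ℕ.* p ℕ.^ k) ≈⟨ ^-assocʳ (x + y) p (p ℕ.^ k) ⟨
      ((x + y) ^ p) ^ (p ℕ.^ k) ≈⟨ ^-congˡ (p ℕ.^ k) (^p-distrib-+ x y) ⟩
      (x ^ p + y ^ p) ^ (p ℕ.^ k) ≈⟨ ^p^k-distrib-+ k _ _ ⟩
      (x ^ p) ^ (p ℕ.^ k) + (y ^ p) ^ (p ℕ.^ k)
        ≈⟨ +-cong (^-assocʳ x p (p ℕ.^ k)) (^-assocʳ y p (p ℕ.^ k)) ⟩
      x ^ (p ℕ.* p ℕ.^ k) + y ^ (p ℕ.* p ℕ.^ k) ∎

-- Finite fields

module FiniteFieldProperties {c ℓ q} (K : FiniteField c ℓ q) where

  open FiniteField K
  open CommutativeRing commutativeRing hiding (zero)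
  open Exponentiation commutativeSemiring
  open Multiples semiring renaming (_×_ to _⋆_)
  open SetoidReasoning setoid
  open Inverse enumerate using (to; from; to-cong; from-cong; strictlyInverseˡ; strictlyInverseʳ) public

  infix 4 _≈?_

  _≈?_ : ∀ x y → Dec (x ≈ y)
  x ≈? y = map′ (λ eq → trans (sym (strictlyInverseʳ x)) (trans (reflexive (≡.cong from eq)) (strictlyInverseʳ y)))
                to-cong (to x Finₚ.≟ to y)

  _⁻¹ : ∀ {x} → ¬ x ≈ 0# → Carrier
  x≉0 ⁻¹ = proj₁ (invertible _ x≉0)

  ⁻¹-inverseˡ : ∀ {x} (x≉0 : ¬ x ≈ 0#) → x≉0 ⁻¹ * x ≈ 1#
  ⁻¹-inverseˡ x≉0 = proj₁ (proj₂ (invertible _ x≉0))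

  *-cancel-0 : ∀ {x y} → ¬ x ≈ 0# → x * y ≈ 0# → y ≈ 0#
  *-cancel-0 {x} {y} x≉0 xy≈0 = begin
    y ≈⟨ *-identityˡ y ⟨
    1# * y ≈⟨ *-congʳ (⁻¹-inverseˡ x≉0) ⟨
    x≉0 ⁻¹ * x * y ≈⟨ *-assoc _ _ _ ⟩
    x≉0 ⁻¹ * (x * y) ≈⟨ *-congˡ xy≈0 ⟩
    x≉0 ⁻¹ * 0# ≈⟨ zeroʳ _ ⟩
    0# ∎

  ^-nonzero : ∀ {x} n → ¬ x ≈ 0# → ¬ x ^ n ≈ 0#
  ^-nonzero zero    x≉0 eq = 1≉0 eq
  ^-nonzero (suc n) x≉0 eq = ^-nonzero n x≉0 (*-cancel-0 x≉0 eq)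

  -- Both results below compare a sum (product) over the whole field with its
  -- image under a translation (homothety).

  module _ (f g : Carrier → Carrier) (f-cong : ∀ {x y} → x ≈ y → f x ≈ f y)
           (g-cong : ∀ {x y} → x ≈ y → g x ≈ g y)
           (fg : ∀ x → f (g x) ≈ x) (gf : ∀ x → g (f x) ≈ x) where

    bijection⇒permutation : Permutation′ q
    bijection⇒permutation = permutation (λ i → to (f (from i))) (λ i → to (g (from i)))
      (λ i → ≡.trans (to-cong (trans (f-cong (strictlyInverseʳ _)) (fg _))) (strictlyInverseˡ i))
      (λ i → ≡.trans (to-cong (trans (g-cong (strictlyInverseʳ _)) (gf _))) (strictlyInverseˡ i))

  q⋆1≈0 : q ⋆ 1# ≈ 0#
  q⋆1≈0 = begin
    q ⋆ 1# ≈⟨ +-identityˡ _ ⟨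
    0# + q ⋆ 1# ≈⟨ +-congʳ (-‿inverseˡ total) ⟨
    (- total + total) + q ⋆ 1# ≈⟨ +-assoc _ _ _ ⟩
    - total + (total + q ⋆ 1#) ≈⟨ +-congˡ shifted ⟨
    - total + total ≈⟨ -‿inverseˡ total ⟩
    0# ∎
    where
    open CommutativeMonoidSum +-commutativeMonoid
    total : Carrier
    total = sum from
    cancelʳ : ∀ x a b → a + b ≈ 0# → (x + a) + b ≈ x
    cancelʳ x a b eq = trans (+-assoc _ _ _) (trans (+-congˡ eq) (+-identityʳ x))
    π = bijection⇒permutation (_+ 1#) (_+ - 1#) +-congʳ +-congʳ
          (λ x → cancelʳ x _ _ (-‿inverseˡ 1#)) (λ x → cancelʳ x _ _ (-‿inverseʳ 1#))
    shifted : total ≈ total + q ⋆ 1#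
    shifted = begin
      sum from ≈⟨ sum-permute from π ⟩
      sum {q} (λ i → from (π ⟨$⟩ʳ i)) ≈⟨ sum-cong-≋ (λ i → strictlyInverseʳ (from i + 1#)) ⟩
      sum {q} (λ i → from i + 1#) ≈⟨ ∑-distrib-+ from (λ _ → 1#) ⟩
      sum from + sum {q} (λ _ → 1#) ≈⟨ +-congˡ (sum-replicate q) ⟩
      total + q ⋆ 1# ∎

  2≤q : 2 ≤ q
  2≤q = two q to to-separates
    where
    to-separates : ¬ to 1# ≡ to 0#
    to-separates eq = 1≉0 (trans (sym (strictlyInverseʳ 1#)) (trans (from-cong eq) (strictlyInverseʳ 0#)))
    two : ∀ n (f : Carrier → Fin n) → ¬ f 1# ≡ f 0# → 2 ≤ n
    two zero          f ne with f 1#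
    ... | ()
    two (suc zero)    f ne with f 1# | f 0#
    ... | zero | zero = contradiction ≡.refl ne
    two (suc (suc n)) f ne = s≤s (s≤s z≤n)

  fermat : ∀ x → x ^ q ≈ x
  fermat x with x ≈? 0#
  ... | yes x≈0 = begin
    x ^ q ≈⟨ ^-congˡ q x≈0 ⟩
    0# ^ q ≈⟨ zero-power q (ℕₚ.<⇒≤ 2≤q) ⟩
    0# ≈⟨ x≈0 ⟨
    x ∎
    where
    zero-power : ∀ n → 1 ≤ n → 0# ^ n ≈ 0#
    zero-power (suc n) _ = zeroˡ _
  ... | no x≉0 = from-nonempty q ≡.refl (to 0#)
    where
    open CommutativeMonoidSum *-commutativeMonoid renaming (sum to product)
    -- The element 0 would annihilate the product, so it is replaced by 1. Multiplication by `x`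
    -- changes the replaced value by `x` at nonzero elements and not at all at 0; `factor` records
    -- this.
    unzero : Carrier → Carrier
    unzero y with y ≈? 0#
    ... | yes _ = 1#
    ... | no  _ = y
    factor : Carrier → Carrier
    factor y with y ≈? 0#
    ... | yes _ = 1#
    ... | no  _ = x
    unzero-cong : ∀ {y z} → y ≈ z → unzero y ≈ unzero z
    unzero-cong {y} {z} y≈z with y ≈? 0# | z ≈? 0#
    ... | yes _   | yes _   = refl
    ... | yes y≈0 | no z≉0  = contradiction (trans (sym y≈z) y≈0) z≉0
    ... | no y≉0  | yes z≈0 = contradiction (trans y≈z z≈0) y≉0
    ... | no _    | no _    = y≈z
    unzero-* : ∀ y → unzero (x * y) ≈ unzero y * factor y
    unzero-* y with x * y ≈? 0# | y ≈? 0#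
    ... | yes _    | yes _   = sym (*-identityˡ _)
    ... | yes xy≈0 | no y≉0  = contradiction (*-cancel-0 x≉0 xy≈0) y≉0
    ... | no xy≉0  | yes y≈0 = contradiction (trans (*-congˡ y≈0) (zeroʳ x)) xy≉0
    ... | no _     | no _    = *-comm x y
    unzero-nonzero : ∀ y → ¬ unzero y ≈ 0#
    unzero-nonzero y with y ≈? 0#
    ... | yes _  = 1≉0
    ... | no y≉0 = y≉0
    product-nonzero : ∀ n (f : Fin n → Carrier) → (∀ i → ¬ f i ≈ 0#) → ¬ product f ≈ 0#
    product-nonzero zero    f ne eq = 1≉0 eq
    product-nonzero (suc n) f ne eq =
      product-nonzero n (λ i → f (suc i)) (λ i → ne (suc i)) (*-cancel-0 (ne zero) eq)
    total : Carrier
    total = product (λ i → unzero (from i))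
    factors : Carrier
    factors = product (λ i → factor (from i))
    cancelˡ : ∀ a b y → a * b ≈ 1# → a * (b * y) ≈ y
    cancelˡ a b y eq = trans (sym (*-assoc _ _ _)) (trans (*-congʳ eq) (*-identityˡ y))
    π = bijection⇒permutation (x *_) (x≉0 ⁻¹ *_) *-congˡ *-congˡ
          (λ y → cancelˡ _ _ y (trans (*-comm _ _) (⁻¹-inverseˡ x≉0))) (λ y → cancelˡ _ _ y (⁻¹-inverseˡ x≉0))
    scaled : total ≈ total * factors
    scaled = begin
      total ≈⟨ sum-permute (λ i → unzero (from i)) π ⟩
      product {q} (λ i → unzero (from (π ⟨$⟩ʳ i))) ≈⟨ sum-cong-≋ (λ i → unzero-cong (strictlyInverseʳ (x * from i))) ⟩
      product {q} (λ i → unzero (x * from i)) ≈⟨ sum-cong-≋ (λ i → unzero-* (from i)) ⟩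
      product {q} (λ i → unzero (from i) * factor (from i)) ≈⟨ ∑-distrib-+ (λ i → unzero (from i)) (λ i → factor (from i)) ⟩
      total * factors ∎
    open RingProperties ring using (x[y-z]≈xy-xz)
    open GroupProperties +-group using (x∙y⁻¹≈ε⇒x≈y)
    factors≈1 : factors ≈ 1#
    factors≈1 = x∙y⁻¹≈ε⇒x≈y factors 1# (*-cancel-0 (product-nonzero q _ (λ i → unzero-nonzero (from i))) (begin
      total * (factors - 1#) ≈⟨ x[y-z]≈xy-xz _ _ _ ⟩
      total * factors - total * 1# ≈⟨ +-cong (sym scaled) (-‿cong (*-identityʳ _)) ⟩
      total - total ≈⟨ -‿inverseʳ total ⟩
      0# ∎))
    factor-zero : ∀ {y} → y ≈ 0# → factor y ≈ 1#
    factor-zero {y} y≈0 with y ≈? 0#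
    ... | yes _  = refl
    ... | no y≉0 = contradiction y≈0 y≉0
    factor-nonzero : ∀ {y} → ¬ y ≈ 0# → factor y ≈ x
    factor-nonzero {y} y≉0 with y ≈? 0#
    ... | yes y≈0 = contradiction y≈0 y≉0
    ... | no _    = refl
    from-injective : ∀ {i j} → from i ≈ from j → i ≡ j
    from-injective {i} {j} eq = ≡.trans (≡.sym (strictlyInverseˡ i)) (≡.trans (to-cong eq) (strictlyInverseˡ j))
    -- With the index of 0 removed, `factors` is the power of `x` with exponent `q - 1`, and it
    -- equals 1. The argument in `Fin q` rules out `q` = 0.
    from-nonempty : ∀ n → n ≡ q → Fin q → x ^ n ≈ x
    from-nonempty (suc n) ≡.refl i₀ = begin
      x * x ^ n ≈⟨ *-congˡ (sum-replicate n) ⟨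
      x * product {n} (λ _ → x) ≈⟨ *-congˡ (sum-cong-≋ (λ j → factor-nonzero (others j))) ⟨
      x * product {n} (λ j → factor (from (Fin.punchIn z j))) ≈⟨ *-congˡ (*-identityˡ _) ⟨
      x * (1# * product {n} (λ j → factor (from (Fin.punchIn z j)))) ≈⟨ *-congˡ (*-congʳ (factor-zero (strictlyInverseʳ 0#))) ⟨
      x * (factor (from z) * product {n} (λ j → factor (from (Fin.punchIn z j)))) ≈⟨ *-congˡ (sum-remove {i = z} (λ i → factor (from i))) ⟨
      x * factors ≈⟨ *-congˡ factors≈1 ⟩
      x * 1# ≈⟨ *-identityʳ x ⟩
      x ∎
      where
      z = to 0#
      others : ∀ j → ¬ from (Fin.punchIn z j) ≈ 0#
      others j eq = Finₚ.punchInᵢ≢i z j (from-injective (trans eq (sym (strictlyInverseʳ 0#))))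
    from-nonempty zero ≡.refl ()

  -- The `k`-th power of `p ⋆ 1#` is `q ⋆ 1#`, hence zero, and a field has no nonzero nilpotents.
  characteristic : ∀ {p k} → q ≡ p ℕ.^ k → p ⋆ 1# ≈ 0#
  characteristic {p} {k} q≡p^k with p ⋆ 1# ≈? 0#
  ... | yes eq = eq
  ... | no ne  = contradiction (begin
    (p ⋆ 1#) ^ k ≈⟨ power k ⟨
    (p ℕ.^ k) ⋆ 1# ≡⟨ ≡.cong (_⋆ 1#) q≡p^k ⟨
    q ⋆ 1# ≈⟨ q⋆1≈0 ⟩
    0# ∎) (^-nonzero k ne)
    where
    power : ∀ k → (p ℕ.^ k) ⋆ 1# ≈ (p ⋆ 1#) ^ k
    power zero    = ×-homo-1 1#
    power (suc k) = trans (×1-homo-* p (p ℕ.^ k)) (*-congˡ (power k))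

nested-index : ∀ M N r s n → r ℕ.+ (s ℕ.+ n ℕ.* N) ℕ.* M ≡ r ℕ.+ s ℕ.* M ℕ.+ n ℕ.* (N ℕ.* M)
nested-index M N r s n = begin
  r ℕ.+ (s ℕ.+ n ℕ.* N) ℕ.* M ≡⟨ ≡.cong (r ℕ.+_) (ℕₚ.*-distribʳ-+ M s (n ℕ.* N)) ⟩
  r ℕ.+ (s ℕ.* M ℕ.+ n ℕ.* N ℕ.* M) ≡⟨ ℕₚ.+-assoc r (s ℕ.* M) _ ⟨
  r ℕ.+ s ℕ.* M ℕ.+ n ℕ.* N ℕ.* M ≡⟨ ≡.cong (r ℕ.+ s ℕ.* M ℕ.+_) (ℕₚ.*-assoc n N M) ⟩
  r ℕ.+ s ℕ.* M ℕ.+ n ℕ.* (N ℕ.* M) ∎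
  where open ≡.≡-Reasoning

-- Degrees

module Degree {c ℓ} (R : CommutativeRing c ℓ) where

  open CommutativeRing R hiding (zero)
  open SetoidReasoning setoid
  open SeriesRing R public
  open Exponentiation (CommutativeRing.commutativeSemiring seriesRing) public
    using ()
    renaming (_^_ to _^ˢ_; ^-congˡ to ^ˢ-congˡ)
  open Exponentiation commutativeSemiring

  module Sˢ = CommutativeRing seriesRing

  Deg< : ℕ → Series → Set ℓ
  Deg< b f = ∀ n → b ≤ n → f n ≈ 0#

  deg-cong : ∀ {b f g} → f ≋ g → Deg< b f → Deg< b g
  deg-cong f≋g d n b≤n = trans (sym (f≋g n)) (d n b≤n)

  deg-mono : ∀ {a b f} → a ≤ b → Deg< a f → Deg< b f
  deg-mono a≤b d n b≤n = d n (ℕₚ.≤-trans a≤b b≤n)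

  deg-0 : ∀ {b} → Deg< b 0ˢ
  deg-0 n _ = 0ˢ≈0 n

  deg-+ : ∀ {b f g} → Deg< b f → Deg< b g → Deg< b (f ⊞ g)
  deg-+ df dg n b≤n = trans (+-cong (df n b≤n) (dg n b≤n)) (+-identityˡ 0#)

  deg-neg : ∀ {b f} → Deg< b f → Deg< b (⊟ f)
  deg-neg {f = f} df n b≤n = trans (-‿cong (df n b≤n)) (GroupProperties.ε⁻¹≈ε +-group)

  deg-constant : ∀ a → Deg< 1 (constant R a)
  deg-constant a (suc n) _ = refl

  deg-tail : ∀ {b f} → Deg< (suc b) f → Deg< b (tail f)
  deg-tail d n b≤n = d (suc n) (s≤s b≤n)

  deg-shift : ∀ {b f} → Deg< b f → Deg< (suc b) (shift f)
  deg-shift d (suc n) (s≤s b≤n) = d n b≤n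

  deg-⊛ : ∀ a {b f g} → Deg< (suc a) f → Deg< b g → Deg< (a ℕ.+ b) (f ⊛ g)
  deg-⊛ zero {b} {f} {g} df dg zero b≤n =
    trans (⊛-head f g) (trans (*-congˡ (dg 0 b≤n)) (zeroʳ _))
  deg-⊛ zero {b} {f} {g} df dg (suc n) b≤n = begin
    (f ⊛ g) (suc n) ≈⟨ ⊛-tail f g n ⟩
    f 0 * g (suc n) + (tail f ⊛ g) n
      ≈⟨ +-cong (trans (*-congˡ (dg (suc n) b≤n)) (zeroʳ _)) (⊛-vanish (tail f) g (λ k → df (suc k) (s≤s z≤n)) n) ⟩
    0# + 0# ≈⟨ +-identityˡ 0# ⟩
    0# ∎
  deg-⊛ (suc a) {b} {f} {g} df dg (suc n) (s≤s a+b≤n) = begin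
    (f ⊛ g) (suc n) ≈⟨ ⊛-tail f g n ⟩
    f 0 * g (suc n) + (tail f ⊛ g) n
      ≈⟨ +-cong (trans (*-congˡ (dg (suc n) (ℕₚ.≤-trans (ℕₚ.m≤n+m b a) (ℕₚ.m≤n⇒m≤1+n a+b≤n)))) (zeroʳ _))
                (deg-⊛ a (deg-tail {f = f} df) dg n a+b≤n) ⟩
    0# + 0# ≈⟨ +-identityˡ 0# ⟩
    0# ∎

  ⊛-top : ∀ a {b f g} → Deg< (suc a) f → Deg< (suc b) g → (f ⊛ g) (a ℕ.+ b) ≈ f a * g b
  ⊛-top zero {zero} {f} {g} df dg = ⊛-head f g
  ⊛-top zero {suc b} {f} {g} df dg = trans (⊛-tail f g b) (trans
    (+-congˡ (⊛-vanish (tail f) g (λ k → df (suc k) (s≤s z≤n)) b)) (+-identityʳ _))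
  ⊛-top (suc a) {b} {f} {g} df dg = begin
    (f ⊛ g) (suc (a ℕ.+ b)) ≈⟨ ⊛-tail f g (a ℕ.+ b) ⟩
    f 0 * g (suc (a ℕ.+ b)) + (tail f ⊛ g) (a ℕ.+ b)
      ≈⟨ +-cong (trans (*-congˡ (dg _ (s≤s (ℕₚ.m≤n+m b a)))) (zeroʳ _)) (⊛-top a (deg-tail {f = f} df) dg) ⟩
    0# + f (suc a) * g b ≈⟨ +-identityˡ _ ⟩
    f (suc a) * g b ∎

  deg-^ : ∀ n {a f} → Deg< (suc a) f → Deg< (suc (n ℕ.* a)) (f ^ˢ n)
  deg-^ zero        df = deg-constant 1#
  deg-^ (suc n) {a} {f} df = ≡.subst (λ b → Deg< b (f ^ˢ suc n)) (ℕₚ.+-suc a (n ℕ.* a)) (deg-⊛ a df (deg-^ n df))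

  ^-top : ∀ n {a f} → Deg< (suc a) f → (f ^ˢ n) (n ℕ.* a) ≈ f a ^ n
  ^-top zero        df = refl
  ^-top (suc n) {a} df = trans (⊛-top a df (deg-^ n df)) (*-congˡ (^-top n df))

  -- Descent on the surplus `k`: in the highest degree not yet excluded, the coefficient of the
  -- product is that of `f` times `g b`, and it vanishes. Regularity of `g b` replaces division, so
  -- the coefficient ring may be arbitrary.
  deg-cancel : ∀ {b g} → Deg< (suc b) g → (∀ x → x * g b ≈ 0# → x ≈ 0#) →
               ∀ k n {f} → Deg< (k ℕ.+ n) f → Deg< (n ℕ.+ b) (f ⊛ g) → Deg< n f
  deg-cancel dg reg zero n df dfg = df
  deg-cancel {b} {g} dg reg (suc k) n {f} df dfg = deg-cancel dg reg k n lower dfg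
    where
    lower : Deg< (k ℕ.+ n) f
    lower m k+n≤m with ℕₚ.m≤n⇒m<n∨m≡n k+n≤m
    ... | inj₁ k+n<m = df m k+n<m
    ... | inj₂ ≡.refl = reg (f m) (trans (sym (⊛-top m df dg)) (dfg _ (ℕₚ.+-monoˡ-≤ b (ℕₚ.m≤n+m n k))))

  constant-^ : ∀ a n → (constant R a ^ˢ n) ≋ constant R (a ^ n)
  constant-^ a zero    m = refl
  constant-^ a (suc n) zero = trans (⊛-head _ _) (*-congˡ (constant-^ a n 0))
  constant-^ a (suc n) (suc m) =
    trans (constant-⊛ a (constant R a ^ˢ n) (suc m)) (trans (*-congˡ (constant-^ a n (suc m))) (zeroʳ a))

  X-⊛ : ∀ f → (X R ⊛ f) ≋ shift f
  X-⊛ f n = begin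
    (X R ⊛ f) n ≈⟨ ⊛-cong X≋shift1 (λ _ → refl) n ⟩
    (shift 1ˢ ⊛ f) n ≈⟨ shift-⊛ 1ˢ f n ⟩
    shift (1ˢ ⊛ f) n ≈⟨ shift-cong (⊛-identityˡ f) n ⟩
    shift f n ∎
    where
    X≋shift1 : X R ≋ shift 1ˢ
    X≋shift1 zero          = refl
    X≋shift1 (suc zero)    = refl
    X≋shift1 (suc (suc n)) = refl

  deg-X : Deg< 2 (X R)
  deg-X (suc zero)    (s≤s ())
  deg-X (suc (suc n)) _ = refl

  shiftBy : ℕ → Series → Series
  shiftBy zero    f = f
  shiftBy (suc k) f = shift (shiftBy k f)

  shiftBy-+ : ∀ k f n → shiftBy k f (k ℕ.+ n) ≡ f n
  shiftBy-+ zero    f n = ≡.refl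
  shiftBy-+ (suc k) f n = shiftBy-+ k f n

  shiftBy-< : ∀ k f n → n < k → shiftBy k f n ≈ 0#
  shiftBy-< (suc k) f zero    _           = refl
  shiftBy-< (suc k) f (suc n) (s≤s n<k) = shiftBy-< k f n n<k

  ⊛-shiftBy : ∀ k f g → (f ⊛ shiftBy k g) ≋ shiftBy k (f ⊛ g)
  ⊛-shiftBy zero    f g n = refl
  ⊛-shiftBy (suc k) f g n = begin
    (f ⊛ shift (shiftBy k g)) n ≈⟨ ⊛-comm f _ n ⟩
    (shift (shiftBy k g) ⊛ f) n ≈⟨ shift-⊛ (shiftBy k g) f n ⟩
    shift (shiftBy k g ⊛ f) n ≈⟨ shift-cong (λ m → trans (⊛-comm _ f m) (⊛-shiftBy k f g m)) n ⟩
    shift (shiftBy k (f ⊛ g)) n ∎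

  shift-^ : ∀ n f → (shift f ^ˢ n) ≋ shiftBy n (f ^ˢ n)
  shift-^ zero    f m = refl
  shift-^ (suc n) f m = begin
    (shift f ⊛ (shift f ^ˢ n)) m ≈⟨ shift-⊛ f _ m ⟩
    shift (f ⊛ (shift f ^ˢ n)) m ≈⟨ shift-cong (⊛-congˡ (shift-^ n f)) m ⟩
    shift (f ⊛ shiftBy n (f ^ˢ n)) m ≈⟨ shift-cong (⊛-shiftBy n f (f ^ˢ n)) m ⟩
    shift (shiftBy n (f ⊛ (f ^ˢ n))) m ∎

  split : ∀ f → f ≋ (constant R (f 0) ⊞ shift (tail f))
  split f zero    = sym (+-identityʳ _)
  split f (suc n) = sym (+-identityˡ _)

  -- Cartier operators

  section : ℕ → ℕ → Series → Series
  section M r f n = f (r ℕ.+ n ℕ.* M)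

  section-cong : ∀ M r {f g} → f ≋ g → section M r f ≋ section M r g
  section-cong M r p n = p _

  section-section : ∀ M N r s f → section N s (section M r f) ≋ section (N ℕ.* M) (r ℕ.+ s ℕ.* M) f
  section-section M N r s f n = reflexive (≡.cong f (nested-index M N r s n))

  module _ (M : ℕ) (^-fixes : ∀ a → a ^ M ≈ a)
           (^-distrib-⊞ : ∀ f g → ((f ⊞ g) ^ˢ M) ≋ ((f ^ˢ M) ⊞ (g ^ˢ M))) where

    -- Write `g` as `g 0` plus `x` times its tail. Frobenius splits the power, and `a ^ M ≈ a`
    -- returns the constant `g 0` unchanged.
    ⊛-^-split : ∀ f g n → (f ⊛ (g ^ˢ M)) n ≈ f n * g 0 + shiftBy M (f ⊛ (tail g ^ˢ M)) n
    ⊛-^-split f g n = begin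
      (f ⊛ (g ^ˢ M)) n
        ≈⟨ ⊛-congˡ (λ k → trans (^ˢ-congˡ M (split g) k) (^-distrib-⊞ _ _ k)) n ⟩
      (f ⊛ ((constant R (g 0) ^ˢ M) ⊞ (shift (tail g) ^ˢ M))) n
        ≈⟨ ⊛-distribˡ f _ _ n ⟩
      (f ⊛ (constant R (g 0) ^ˢ M)) n + (f ⊛ (shift (tail g) ^ˢ M)) n
        ≈⟨ +-cong (⊛-congˡ (λ k → trans (constant-^ (g 0) M k) (constant-cong (^-fixes (g 0)) k)) n)
                  (trans (⊛-congˡ (shift-^ M (tail g)) n) (⊛-shiftBy M f _ n)) ⟩
      (f ⊛ constant R (g 0)) n + shiftBy M (f ⊛ (tail g ^ˢ M)) n
        ≈⟨ +-congʳ (trans (⊛-comm f _ n) (trans (constant-⊛ (g 0) f n) (*-comm _ _))) ⟩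
      f n * g 0 + shiftBy M (f ⊛ (tail g ^ˢ M)) n ∎

    -- The projection formula of the Cartier operators: here `g(x)^M` is `g(x^M)`, which leaves the
    -- section with `x^M` replaced by `x`. The induction peels one coefficient of `g` per index.
    section-⊛-^ : ∀ r → r < M → ∀ f g → section M r (f ⊛ (g ^ˢ M)) ≋ (section M r f ⊛ g)
    section-⊛-^ r r<M f g zero = begin
      (f ⊛ (g ^ˢ M)) (r ℕ.+ 0) ≈⟨ ⊛-^-split f g (r ℕ.+ 0) ⟩
      f (r ℕ.+ 0) * g 0 + shiftBy M (f ⊛ (tail g ^ˢ M)) (r ℕ.+ 0)
        ≈⟨ +-congˡ (shiftBy-< M _ _ (≡.subst (_< M) (≡.sym (ℕₚ.+-identityʳ r)) r<M)) ⟩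
      f (r ℕ.+ 0) * g 0 + 0# ≈⟨ +-identityʳ _ ⟩
      f (r ℕ.+ 0) * g 0 ≈⟨ ⊛-head (section M r f) g ⟨
      (section M r f ⊛ g) 0 ∎
    section-⊛-^ r r<M f g (suc n) = begin
      (f ⊛ (g ^ˢ M)) (r ℕ.+ (M ℕ.+ n ℕ.* M)) ≈⟨ ⊛-^-split f g _ ⟩
      f (r ℕ.+ suc n ℕ.* M) * g 0 + shiftBy M (f ⊛ (tail g ^ˢ M)) (r ℕ.+ (M ℕ.+ n ℕ.* M))
        ≡⟨ ≡.cong (λ k → f (r ℕ.+ suc n ℕ.* M) * g 0 + k)
             (≡.trans (≡.cong (shiftBy M (f ⊛ (tail g ^ˢ M))) (swap M r (n ℕ.* M))) (shiftBy-+ M _ _)) ⟩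
      f (r ℕ.+ suc n ℕ.* M) * g 0 + (f ⊛ (tail g ^ˢ M)) (r ℕ.+ n ℕ.* M)
        ≈⟨ +-congˡ (section-⊛-^ r r<M f (tail g) n) ⟩
      f (r ℕ.+ suc n ℕ.* M) * g 0 + (section M r f ⊛ tail g) n
        ≈⟨ +-comm _ _ ⟩
      (section M r f ⊛ tail g) n + section M r f (suc n) * g 0
        ≈⟨ ⊛-tailʳ (section M r f) g n ⟨
      (section M r f ⊛ g) (suc n) ∎
      where
      swap : ∀ M r k → r ℕ.+ (M ℕ.+ k) ≡ M ℕ.+ (r ℕ.+ k)
      swap M r k = ≡.trans (≡.sym (ℕₚ.+-assoc r M k)) (≡.trans (≡.cong (ℕ._+ k) (ℕₚ.+-comm r M)) (ℕₚ.+-assoc M r k))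

  -- Evaluation of polynomials

  -- Horner's scheme, cut off at `b` so that it is defined for every series; by `ev-degree` the
  -- place of the cut is immaterial above the degree.
  ev : ℕ → Series → Carrier → Carrier
  ev zero    f x = 0#
  ev (suc b) f x = f 0 + x * ev b (tail f) x

  ev-cong : ∀ b {f g} x → f ≋ g → ev b f x ≈ ev b g x
  ev-cong zero    x p = refl
  ev-cong (suc b) x p = +-cong (p 0) (*-congˡ (ev-cong b x (λ n → p (suc n))))

  ev-vanish : ∀ b {f} x → (∀ n → f n ≈ 0#) → ev b f x ≈ 0#
  ev-vanish zero    x p = refl
  ev-vanish (suc b) x p =
    trans (+-cong (p 0) (trans (*-congˡ (ev-vanish b x (λ n → p (suc n)))) (zeroʳ x))) (+-identityˡ 0#)

  ev-stable : ∀ b k {f} x → Deg< b f → ev (b ℕ.+ k) f x ≈ ev b f x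
  ev-stable zero    k     x d = ev-vanish k x (λ n → d n z≤n)
  ev-stable (suc b) k {f} x d = +-congˡ (*-congˡ (ev-stable b k x (deg-tail {f = f} d)))

  ev-degree : ∀ a b {f} x → Deg< a f → Deg< b f → ev a f x ≈ ev b f x
  ev-degree a b {f} x da db = begin
    ev a f x ≈⟨ ev-stable a b x da ⟨
    ev (a ℕ.+ b) f x ≡⟨ ≡.cong (λ k → ev k f x) (ℕₚ.+-comm a b) ⟩
    ev (b ℕ.+ a) f x ≈⟨ ev-stable b a x db ⟩
    ev b f x ∎

  ev-+ : ∀ b f g x → ev b (f ⊞ g) x ≈ ev b f x + ev b g x
  ev-+ zero    f g x = sym (+-identityˡ 0#)
  ev-+ (suc b) f g x = begin
    f 0 + g 0 + x * ev b (tail f ⊞ tail g) x ≈⟨ +-congˡ (*-congˡ (ev-+ b (tail f) (tail g) x)) ⟩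
    f 0 + g 0 + x * (ev b (tail f) x + ev b (tail g) x) ≈⟨ +-congˡ (distribˡ _ _ _) ⟩
    f 0 + g 0 + (x * ev b (tail f) x + x * ev b (tail g) x) ≈⟨ interchange _ _ _ _ ⟩
    f 0 + x * ev b (tail f) x + (g 0 + x * ev b (tail g) x) ∎
    where open CommutativeSemigroupProperties (CommutativeMonoid.commutativeSemigroup +-commutativeMonoid) using (interchange)

  ev-· : ∀ b a f x → ev b (a · f) x ≈ a * ev b f x
  ev-· zero    a f x = sym (zeroʳ a)
  ev-· (suc b) a f x = begin
    a * f 0 + x * ev b (a · tail f) x ≈⟨ +-congˡ (*-congˡ (ev-· b a (tail f) x)) ⟩
    a * f 0 + x * (a * ev b (tail f) x) ≈⟨ +-congˡ (trans (sym (*-assoc _ _ _)) (trans (*-congʳ (*-comm x a)) (*-assoc _ _ _))) ⟩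
    a * f 0 + a * (x * ev b (tail f) x) ≈⟨ distribˡ _ _ _ ⟨
    a * (f 0 + x * ev b (tail f) x) ∎

  ev-shift : ∀ b f x → ev (suc b) (shift f) x ≈ x * ev b f x
  ev-shift b f x = +-identityˡ _

-- Polynomial rings, as subrings of power series rings

module PolynomialRing {c ℓ} (R : CommutativeRing c ℓ) where

  open CommutativeRing R hiding (zero)
  open Degree R public

  -- The bound is arbitrary and equality ignores it. No coefficient has to be tested for zero, so
  -- the power series ring can serve as the coefficient ring.
  record Poly : Set (c ⊔ ℓ) where
    constructor poly
    field
      {coef}  : Series
      {bound} : ℕ
      degree  : Deg< bound coef

  open Poly public

  record _≈ᴾ_ (f g : Poly) : Set ℓ where
    constructor coefs
    field coef-≈ : coef f ≋ coef g

  open _≈ᴾ_ public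

  0ᴾ 1ᴾ : Poly
  0ᴾ = poly {bound = 0} deg-0
  1ᴾ = poly (deg-constant 1#)

  infixl 6 _+ᴾ_
  infixl 7 _*ᴾ_

  opaque
    _+ᴾ_ _*ᴾ_ : Poly → Poly → Poly
    f +ᴾ g = poly {bound = bound f ℕ.+ bound g}
      (deg-+ (deg-mono {f = coef f} (ℕₚ.m≤m+n _ _) (degree f)) (deg-mono {f = coef g} (ℕₚ.m≤n+m _ _) (degree g)))
    f *ᴾ g = poly {bound = bound f ℕ.+ bound g}
      (deg-⊛ (bound f) (deg-mono {f = coef f} (ℕₚ.n≤1+n _) (degree f)) (degree g))

    -ᴾ_ : Poly → Poly
    -ᴾ f = poly {bound = bound f} (deg-neg {f = coef f} (degree f))

    coef-+ : ∀ f g → coef (f +ᴾ g) ≡ coef f ⊞ coef g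
    coef-+ f g = ≡.refl

    coef-* : ∀ f g → coef (f *ᴾ g) ≡ coef f ⊛ coef g
    coef-* f g = ≡.refl

    coef-neg : ∀ f → coef (-ᴾ f) ≡ ⊟ coef f
    coef-neg f = ≡.refl

    isCommutativeRingᴾ : IsCommutativeRing _≈ᴾ_ _+ᴾ_ _*ᴾ_ -ᴾ_ 0ᴾ 1ᴾ
    isCommutativeRingᴾ = record
      { isRing = record
        { +-isAbelianGroup = record
          { isGroup = record
            { isMonoid = record
              { isSemigroup = record
                { isMagma = record
                  { isEquivalence = record
                    { refl  = coefs λ n → refl
                    ; sym   = λ p → coefs λ n → sym (coef-≈ p n)
                    ; trans = λ p q → coefs λ n → trans (coef-≈ p n) (coef-≈ q n) }
                  ; ∙-cong = λ p q → coefs λ n → +-cong (coef-≈ p n) (coef-≈ q n) }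
                ; assoc = λ f g h → coefs λ n → +-assoc _ _ _ }
              ; identity = (λ f → coefs (Sˢ.+-identityˡ (coef f))) , (λ f → coefs (Sˢ.+-identityʳ (coef f))) }
            ; inverse = (λ f → coefs (Sˢ.-‿inverseˡ (coef f))) , (λ f → coefs (Sˢ.-‿inverseʳ (coef f)))
            ; ⁻¹-cong = λ p → coefs λ n → -‿cong (coef-≈ p n) }
          ; comm = λ f g → coefs λ n → +-comm _ _ }
        ; *-cong = λ p q → coefs (⊛-cong (coef-≈ p) (coef-≈ q))
        ; *-assoc = λ f g h → coefs (⊛-assoc (coef f) (coef g) (coef h))
        ; *-identity = (λ f → coefs (Sˢ.*-identityˡ (coef f))) , (λ f → coefs (Sˢ.*-identityʳ (coef f)))
        ; distrib = (λ f g h → coefs (⊛-distribˡ (coef f) (coef g) (coef h))) , (λ f g h → coefs (⊛-distribʳ (coef f) (coef g) (coef h))) }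
      ; *-comm = λ f g → coefs (⊛-comm (coef f) (coef g)) }

  polyRing : CommutativeRing (c ⊔ ℓ) ℓ
  polyRing = record { isCommutativeRing = isCommutativeRingᴾ }

  module 𝒫 where
    open CommutativeRing polyRing public hiding (zero)
    open Exponentiation (CommutativeRing.commutativeSemiring polyRing) public

  C : Carrier → Poly
  C a = poly (deg-constant a)

  Y : Poly
  Y = poly deg-X

  coef-^ : ∀ f n → coef (f 𝒫.^ n) ≡ coef f ^ˢ n
  coef-^ f zero    = ≡.refl
  coef-^ f (suc n) = ≡.trans (coef-* f _) (≡.cong (coef f ⊛_) (coef-^ f n))

  tailᴾ : Poly → Poly
  tailᴾ f = poly {tail (coef f)} {bound f} (λ n b≤n → degree f (suc n) (ℕₚ.m≤n⇒m≤1+n b≤n))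

  opaque
    unfolding _+ᴾ_

    splitᴾ : ∀ f → f 𝒫.≈ C (coef f 0) 𝒫.+ Y 𝒫.* tailᴾ f
    splitᴾ f = coefs λ n → trans (split (coef f) n) (+-congˡ (sym (X-⊛ (tail (coef f)) n)))

-- Passage of the characteristic to series and polynomials

module Characteristic {c ℓ} (R : CommutativeRing c ℓ) where

  open CommutativeRing R hiding (zero)
  open PolynomialRing R
  open Multiples semiring renaming (_×_ to _⋆_)
  open Multiples Sˢ.semiring using () renaming (_×_ to _⋆ˢ_)
  open Multiples 𝒫.semiring using () renaming (_×_ to _⋆ᴾ_)

  ⋆ˢ-coef : ∀ n f i → (n ⋆ˢ f) i ≈ n ⋆ f i
  ⋆ˢ-coef zero    f i = 0ˢ≈0 i
  ⋆ˢ-coef (suc n) f i = +-congˡ (⋆ˢ-coef n f i)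

  ⋆ᴾ-coef : ∀ n f i → coef (n ⋆ᴾ f) i ≈ n ⋆ coef f i
  ⋆ᴾ-coef zero    f i = 0ˢ≈0 i
  ⋆ᴾ-coef (suc n) f i = trans (reflexive (≡.cong (λ g → g i) (coef-+ f (n ⋆ᴾ f)))) (+-congˡ (⋆ᴾ-coef n f i))

  ⋆-0 : ∀ n → n ⋆ 0# ≈ 0#
  ⋆-0 zero    = refl
  ⋆-0 (suc n) = trans (+-identityˡ _) (⋆-0 n)

  ⋆-1ˢ : ∀ {p} → p ⋆ 1# ≈ 0# → ∀ i → p ⋆ 1ˢ i ≈ 0ˢ i
  ⋆-1ˢ eq zero    = eq
  ⋆-1ˢ {p} eq (suc i) = ⋆-0 p

  characteristicˢ : ∀ {p} → p ⋆ 1# ≈ 0# → (p ⋆ˢ 1ˢ) ≋ 0ˢ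
  characteristicˢ {p} eq i = trans (⋆ˢ-coef p 1ˢ i) (⋆-1ˢ {p} eq i)

  characteristicᴾ : ∀ {p} → p ⋆ 1# ≈ 0# → (p ⋆ᴾ 𝒫.1#) 𝒫.≈ 𝒫.0#
  characteristicᴾ {p} eq = coefs λ i → trans (⋆ᴾ-coef p 𝒫.1# i) (⋆-1ˢ {p} eq i)

-- Evaluation, division by a linear factor, and residues

module Evaluation {c ℓ} (R : CommutativeRing c ℓ) where

  open CommutativeRing R hiding (zero)
  open PolynomialRing R
  open SetoidReasoning setoid

  infix 9 _⟨_⟩

  opaque
    unfolding _+ᴾ_

    _⟨_⟩ : Poly → Carrier → Carrier
    f ⟨ x ⟩ = ev (bound f) (coef f) x

    ⟨⟩-bound : ∀ b f x → Deg< b (coef f) → f ⟨ x ⟩ ≈ ev b (coef f) x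
    ⟨⟩-bound b f x d = ev-degree (bound f) b x (degree f) d

    ⟨⟩-cong : ∀ {f g} x → f 𝒫.≈ g → f ⟨ x ⟩ ≈ g ⟨ x ⟩
    ⟨⟩-cong {f} {g} x f≈g = trans (ev-cong (bound f) x (coef-≈ f≈g))
      (sym (⟨⟩-bound (bound f) g x (deg-cong (coef-≈ f≈g) (degree f))))

    ⟨⟩-+ : ∀ f g x → (f 𝒫.+ g) ⟨ x ⟩ ≈ f ⟨ x ⟩ + g ⟨ x ⟩
    ⟨⟩-+ f g x = trans (ev-+ (bound f ℕ.+ bound g) (coef f) (coef g) x) (+-cong
      (sym (⟨⟩-bound _ f x (deg-mono {f = coef f} (ℕₚ.m≤m+n _ _) (degree f))))
      (sym (⟨⟩-bound _ g x (deg-mono {f = coef g} (ℕₚ.m≤n+m _ (bound f)) (degree g)))))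

    ⟨⟩-scale : ∀ a f x → (C a 𝒫.* f) ⟨ x ⟩ ≈ a * f ⟨ x ⟩
    ⟨⟩-scale a f x = begin
      (C a 𝒫.* f) ⟨ x ⟩ ≈⟨ ev-cong b x (constant-⊛ a (coef f)) ⟩
      ev b (a · coef f) x ≈⟨ ev-· b a (coef f) x ⟩
      a * ev b (coef f) x ≈⟨ *-congˡ (⟨⟩-bound b f x (deg-mono {f = coef f} (ℕₚ.m≤n+m (bound f) 1) (degree f))) ⟨
      a * f ⟨ x ⟩ ∎
      where
      b : ℕ
      b = 1 ℕ.+ bound f

    ⟨⟩-Y : ∀ f x → (Y 𝒫.* f) ⟨ x ⟩ ≈ x * f ⟨ x ⟩
    ⟨⟩-Y f x = begin
      (Y 𝒫.* f) ⟨ x ⟩ ≈⟨ ev-cong (2 ℕ.+ bound f) x (X-⊛ (coef f)) ⟩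
      ev (2 ℕ.+ bound f) (shift (coef f)) x ≈⟨ ev-shift (1 ℕ.+ bound f) (coef f) x ⟩
      x * ev (1 ℕ.+ bound f) (coef f) x ≈⟨ *-congˡ (⟨⟩-bound _ f x (deg-mono {f = coef f} (ℕₚ.m≤n+m (bound f) 1) (degree f))) ⟨
      x * f ⟨ x ⟩ ∎

    ⟨⟩-1 : ∀ x → 𝒫.1# ⟨ x ⟩ ≈ 1#
    ⟨⟩-1 x = trans (+-congˡ (zeroʳ x)) (+-identityʳ 1#)

  sectionᴾ : ∀ M .{{_ : ℕ.NonZero M}} → ℕ → Poly → Poly
  sectionᴾ M r f = poly {section M r (coef f)} {bound f} λ n b≤n →
    degree f _ (ℕₚ.≤-trans b≤n (ℕₚ.≤-trans (ℕₚ.m≤m*n n M) (ℕₚ.m≤n+m (n ℕ.* M) r)))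

  -- Synthetic division of P by Y − x.

  quotient : Poly → Carrier → Poly
  quotient P x = poly {λ j → ev (bound P) (λ n → coef P (suc j ℕ.+ n)) x} {bound P} λ j b≤j →
    ev-vanish (bound P) x (λ n → degree P _ (ℕₚ.≤-trans b≤j (ℕₚ.m≤n⇒m≤1+n (ℕₚ.m≤m+n j n))))

  Y-_ : Carrier → Poly
  Y- x = Y 𝒫.- C x

  opaque
    unfolding _+ᴾ_

    Y-⊛ : ∀ x f → coef ((Y- x) 𝒫.* f) ≋ (shift (coef f) ⊞ ⊟ (x · coef f))
    Y-⊛ x f n = trans (coef-≈ (𝒫.distribʳ f Y (𝒫.- C x)) n) (+-cong (X-⊛ (coef f) n)
      (trans (coef-≈ (𝒫.sym (-‿distribˡ-* (C x) f)) n) (-‿cong (constant-⊛ x (coef f) n))))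
      where open RingProperties 𝒫.ring using (-‿distribˡ-*)

  opaque
    unfolding _⟨_⟩

    division : ∀ P x → P ⟨ x ⟩ ≈ 0# → P 𝒫.≈ (Y- x) 𝒫.* quotient P x
    division P x P⟨x⟩≈0 = coefs λ n → trans (coefficient n) (sym (Y-⊛ x (quotient P x) n))
      where
      b : ℕ
      b = bound P
      Q : Series
      Q = coef (quotient P x)
      next : ∀ j → coef P j + x * Q j ≈ ev b (λ n → coef P (j ℕ.+ n)) x
      next j = begin
        coef P j + x * ev b (λ n → coef P (suc j ℕ.+ n)) x
          ≈⟨ +-cong (reflexive (≡.cong (coef P) (≡.sym (ℕₚ.+-identityʳ j))))
               (*-congˡ (ev-cong b x (λ n → reflexive (≡.cong (coef P) (≡.sym (ℕₚ.+-suc j n)))))) ⟩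
        ev (suc b) (λ n → coef P (j ℕ.+ n)) x
          ≡⟨ ≡.cong (λ k → ev k (λ n → coef P (j ℕ.+ n)) x) (ℕₚ.+-comm 1 b) ⟩
        ev (b ℕ.+ 1) (λ n → coef P (j ℕ.+ n)) x
          ≈⟨ ev-stable b 1 x (λ n b≤n → degree P _ (ℕₚ.≤-trans b≤n (ℕₚ.m≤n+m n j))) ⟩
        ev b (λ n → coef P (j ℕ.+ n)) x ∎
      open GroupProperties +-group using (inverseˡ-unique)
      coefficient : ∀ n → coef P n ≈ shift Q n + - (x * Q n)
      coefficient zero    = trans (inverseˡ-unique _ _ (trans (next 0) P⟨x⟩≈0)) (sym (+-identityˡ _))
      coefficient (suc j) = begin
        coef P (suc j) ≈⟨ +-identityʳ _ ⟨
        coef P (suc j) + 0# ≈⟨ +-congˡ (-‿inverseʳ _) ⟨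
        coef P (suc j) + (x * Q (suc j) - x * Q (suc j)) ≈⟨ +-assoc _ _ _ ⟨
        coef P (suc j) + x * Q (suc j) - x * Q (suc j) ≈⟨ +-congʳ (next (suc j)) ⟩
        Q j - x * Q (suc j) ∎

  -- The Euler derivation y ∂/∂y.

  open Multiples semiring renaming (_×_ to _⋆_)

  θ : Series → Series
  θ f j = j ⋆ f j

  deg-θ : ∀ {b f} → Deg< b f → Deg< b (θ f)
  deg-θ d n b≤n = trans (×-congʳ n (d n b≤n)) (Characteristic.⋆-0 R n)

  θᴾ : Poly → Poly
  θᴾ f = poly (deg-θ (degree f))

  -- Leibniz' rule for `P = (Y − x) H` gives `θ P = Y H + (Y − x) θ H`, whose last term vanishes at
  -- `x`. As `H(x)` is the derivative of `P` at its root, `x` times that derivative becomes the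
  -- value of a polynomial.
  ⟨⟩-θ : ∀ P x → P ⟨ x ⟩ ≈ 0# → θᴾ P ⟨ x ⟩ ≈ x * quotient P x ⟨ x ⟩
  ⟨⟩-θ P x P⟨x⟩≈0 = begin
    θᴾ P ⟨ x ⟩ ≈⟨ +-identityʳ _ ⟨
    θᴾ P ⟨ x ⟩ + 0# ≈⟨ +-congˡ (-‿inverseʳ (x * θᴾ H ⟨ x ⟩)) ⟨
    θᴾ P ⟨ x ⟩ + (x * θᴾ H ⟨ x ⟩ - x * θᴾ H ⟨ x ⟩) ≈⟨ +-assoc _ _ _ ⟨
    θᴾ P ⟨ x ⟩ + x * θᴾ H ⟨ x ⟩ - x * θᴾ H ⟨ x ⟩ ≈⟨ +-congʳ (+-congˡ (⟨⟩-scale x (θᴾ H) x)) ⟨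
    θᴾ P ⟨ x ⟩ + (C x 𝒫.* θᴾ H) ⟨ x ⟩ - x * θᴾ H ⟨ x ⟩ ≈⟨ +-congʳ (⟨⟩-+ (θᴾ P) (C x 𝒫.* θᴾ H) x) ⟨
    (θᴾ P 𝒫.+ C x 𝒫.* θᴾ H) ⟨ x ⟩ - x * θᴾ H ⟨ x ⟩ ≈⟨ +-congʳ (⟨⟩-cong x derivation) ⟩
    (Y 𝒫.* (H 𝒫.+ θᴾ H)) ⟨ x ⟩ - x * θᴾ H ⟨ x ⟩ ≈⟨ +-congʳ (⟨⟩-Y (H 𝒫.+ θᴾ H) x) ⟩
    x * (H 𝒫.+ θᴾ H) ⟨ x ⟩ - x * θᴾ H ⟨ x ⟩ ≈⟨ +-congʳ (*-congˡ (⟨⟩-+ H (θᴾ H) x)) ⟩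
    x * (H ⟨ x ⟩ + θᴾ H ⟨ x ⟩) - x * θᴾ H ⟨ x ⟩ ≈⟨ +-congʳ (distribˡ _ _ _) ⟩
    x * H ⟨ x ⟩ + x * θᴾ H ⟨ x ⟩ - x * θᴾ H ⟨ x ⟩ ≈⟨ +-assoc _ _ _ ⟩
    x * H ⟨ x ⟩ + (x * θᴾ H ⟨ x ⟩ - x * θᴾ H ⟨ x ⟩) ≈⟨ +-congˡ (-‿inverseʳ _) ⟩
    x * H ⟨ x ⟩ + 0# ≈⟨ +-identityʳ _ ⟩
    x * H ⟨ x ⟩ ∎
    where
    H = quotient P x
    h = coef H
    θ-shift : ∀ n → θ (shift h) n ≈ shift (h ⊞ θ h) n
    θ-shift zero    = refl
    θ-shift (suc n) = refl
    split-P : ∀ n → coef P n + x * h n ≈ shift h n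
    split-P n = begin
      coef P n + x * h n ≈⟨ +-congʳ (trans (coef-≈ (division P x P⟨x⟩≈0) n) (Y-⊛ x H n)) ⟩
      shift h n + - (x * h n) + x * h n ≈⟨ +-assoc _ _ _ ⟩
      shift h n + (- (x * h n) + x * h n) ≈⟨ +-congˡ (-‿inverseˡ _) ⟩
      shift h n + 0# ≈⟨ +-identityʳ _ ⟩
      shift h n ∎
    ×-distrib : ∀ n a b → n ⋆ (a + b) ≈ n ⋆ a + n ⋆ b
    ×-distrib zero    a b = sym (+-identityˡ 0#)
    ×-distrib (suc n) a b = trans (+-congˡ (×-distrib n a b)) (interchange _ _ _ _)
      where open CommutativeSemigroupProperties (CommutativeMonoid.commutativeSemigroup +-commutativeMonoid) using (interchange)
    derivation : (θᴾ P 𝒫.+ C x 𝒫.* θᴾ H) 𝒫.≈ Y 𝒫.* (H 𝒫.+ θᴾ H)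
    derivation = coefs λ n → begin
      coef (θᴾ P 𝒫.+ C x 𝒫.* θᴾ H) n ≡⟨ ≡.cong (λ f → f n) (≡.trans (coef-+ _ _) (≡.cong (θ (coef P) ⊞_) (coef-* (C x) (θᴾ H)))) ⟩
      n ⋆ coef P n + (constant R x ⊛ θ h) n ≈⟨ +-congˡ (constant-⊛ x (θ h) n) ⟩
      n ⋆ coef P n + x * (n ⋆ h n) ≈⟨ +-congˡ (×-comm-* n x (h n)) ⟩
      n ⋆ coef P n + n ⋆ (x * h n) ≈⟨ ×-distrib n _ _ ⟨
      n ⋆ (coef P n + x * h n) ≈⟨ ×-congʳ n (split-P n) ⟩
      n ⋆ shift h n ≈⟨ θ-shift n ⟩
      shift (h ⊞ θ h) n ≈⟨ X-⊛ (h ⊞ θ h) n ⟨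
      (X R ⊛ (h ⊞ θ h)) n ≡⟨ ≡.cong (λ f → f n) (≡.trans (coef-* Y _) (≡.cong (X R ⊛_) (coef-+ H (θᴾ H)))) ⟨
      coef (Y 𝒫.* (H 𝒫.+ θᴾ H)) n ∎

  -- With D = (Y − x)^(q−1), the functional N ↦ (section N)(x^q) maps Y·R·D to
  -- x times the image of R·D, because it kills R·(Y − x)^q = R·(Y^q − x^q).

  module _ (n : ℕ) (^-distrib-+ : ∀ f g → (f 𝒫.+ g) 𝒫.^ suc n 𝒫.≈ f 𝒫.^ suc n 𝒫.+ g 𝒫.^ suc n)
           (x : Carrier) where

    open Exponentiation commutativeSemiring using (_^_)

    private
      q = suc n
      D = (Y- x) 𝒫.^ n

    opaque
      unfolding _+ᴾ_

      residue : Poly → Carrier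
      residue N = sectionᴾ q n N ⟨ x ^ q ⟩

      residue-cong : ∀ {f g} → f 𝒫.≈ g → residue f ≈ residue g
      residue-cong f≈g = ⟨⟩-cong (x ^ q) (coefs λ i → coef-≈ f≈g _)

      residue-+ : ∀ f g → residue (f 𝒫.+ g) ≈ residue f + residue g
      residue-+ f g = trans (⟨⟩-cong {sectionᴾ q n (f 𝒫.+ g)} {sectionᴾ q n f 𝒫.+ sectionᴾ q n g} (x ^ q) (coefs λ i → refl))
                            (⟨⟩-+ (sectionᴾ q n f) (sectionᴾ q n g) (x ^ q))

      residue-scale : ∀ a f → residue (C a 𝒫.* f) ≈ a * residue f
      residue-scale a f = trans
        (⟨⟩-cong {sectionᴾ q n (C a 𝒫.* f)} {C a 𝒫.* sectionᴾ q n f} (x ^ q) (coefs λ i → trans (constant-⊛ a (coef f) _) (sym (constant-⊛ a _ i))))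
        (⟨⟩-scale a (sectionᴾ q n f) (x ^ q))

      Y^-coef : ∀ f → coef (Y 𝒫.^ q 𝒫.* f) ≋ shiftBy q (coef f)
      Y^-coef f = λ i → begin
        (coef (Y 𝒫.^ q) ⊛ coef f) i ≈⟨ ⊛-congʳ (λ k → trans (reflexive (≡.cong (λ g → g k) (coef-^ Y q))) (X^ k)) i ⟩
        (shiftBy q 1ˢ ⊛ coef f) i ≈⟨ ⊛-comm _ (coef f) i ⟩
        (coef f ⊛ shiftBy q 1ˢ) i ≈⟨ ⊛-shiftBy q (coef f) 1ˢ i ⟩
        shiftBy q (coef f ⊛ 1ˢ) i ≈⟨ shiftBy-cong q (Sˢ.*-identityʳ (coef f)) i ⟩
        shiftBy q (coef f) i ∎
        where
        shiftBy-cong : ∀ k {f g} → f ≋ g → shiftBy k f ≋ shiftBy k g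
        shiftBy-cong zero    p = p
        shiftBy-cong (suc k) p = shift-cong (shiftBy-cong k p)
        1^ : ∀ k → (1ˢ ^ˢ k) ≋ 1ˢ
        1^ zero    = λ _ → refl
        1^ (suc k) = λ i → trans (Sˢ.*-identityˡ _ i) (1^ k i)
        X^ : (X R ^ˢ q) ≋ shiftBy q 1ˢ
        X^ i = trans (^ˢ-congˡ q (λ k → trans (sym (Sˢ.*-identityʳ (X R) k)) (X-⊛ 1ˢ k)) i)
                 (trans (shift-^ q 1ˢ i) (shiftBy-cong q (1^ q) i))

      residue-Y^ : ∀ f → residue (Y 𝒫.^ q 𝒫.* f) ≈ x ^ q * residue f
      residue-Y^ f = trans
        (⟨⟩-cong {sectionᴾ q n (Y 𝒫.^ q 𝒫.* f)} {Y 𝒫.* sectionᴾ q n f} (x ^ q) (coefs λ i → trans (Y^-coef f _) (trans (index i) (sym (X-⊛ _ i)))))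
        (⟨⟩-Y (sectionᴾ q n f) (x ^ q))
        where
        index : ∀ i → shiftBy q (coef f) (n ℕ.+ i ℕ.* q) ≈ shift (section q n (coef f)) i
        index zero    = shiftBy-< q (coef f) (n ℕ.+ 0) (s≤s (ℕₚ.≤-reflexive (ℕₚ.+-identityʳ n)))
        index (suc i) = reflexive (≡.trans (≡.cong (shiftBy q (coef f)) (swap i)) (shiftBy-+ q (coef f) (n ℕ.+ i ℕ.* q)))
          where
          swap : ∀ i → n ℕ.+ (q ℕ.+ i ℕ.* q) ≡ q ℕ.+ (n ℕ.+ i ℕ.* q)
          swap i = ≡.trans (≡.sym (ℕₚ.+-assoc n q _)) (≡.trans (≡.cong (ℕ._+ i ℕ.* q) (ℕₚ.+-comm n q)) (ℕₚ.+-assoc q n _))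

    C-^ : C x 𝒫.^ q 𝒫.≈ C (x ^ q)
    C-^ = coefs λ i → trans (reflexive (≡.cong (λ g → g i) (coef-^ (C x) q))) (constant-^ x q i)

    residue-[Y-x]^q : ∀ f → residue ((Y- x) 𝒫.^ q 𝒫.* f) ≈ 0#
    residue-[Y-x]^q f = identityʳ-unique _ _ (begin
      x ^ q * residue f + residue ((Y- x) 𝒫.^ q 𝒫.* f) ≈⟨ +-congʳ (residue-scale (x ^ q) f) ⟨
      residue (C (x ^ q) 𝒫.* f) + residue ((Y- x) 𝒫.^ q 𝒫.* f) ≈⟨ residue-+ _ _ ⟨
      residue (C (x ^ q) 𝒫.* f 𝒫.+ (Y- x) 𝒫.^ q 𝒫.* f) ≈⟨ residue-cong sum≈ ⟩
      residue (Y 𝒫.^ q 𝒫.* f) ≈⟨ residue-Y^ f ⟩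
      x ^ q * residue f ∎)
      where
      open GroupProperties +-group using (identityʳ-unique)
      Y≈ : C x 𝒫.+ (Y- x) 𝒫.≈ Y
      Y≈ = xyx⁻¹≈y (C x) Y
        where
        open AbelianGroupProperties 𝒫.+-abelianGroup using () renaming (xyx⁻¹≈y to xyx⁻¹)
        xyx⁻¹≈y : ∀ a b → a 𝒫.+ (b 𝒫.- a) 𝒫.≈ b
        xyx⁻¹≈y a b = 𝒫.trans (𝒫.sym (𝒫.+-assoc a b (𝒫.- a))) (xyx⁻¹ a b)
      sum≈ : C (x ^ q) 𝒫.* f 𝒫.+ (Y- x) 𝒫.^ q 𝒫.* f 𝒫.≈ Y 𝒫.^ q 𝒫.* f
      sum≈ = 𝒫.trans (𝒫.sym (𝒫.distribʳ f _ _)) (𝒫.*-congʳ (𝒫.trans (𝒫.+-congʳ (𝒫.sym C-^))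
        (𝒫.trans (𝒫.sym (^-distrib-+ (C x) (Y- x))) (𝒫.^-congˡ q Y≈))))

    residue-Y : ∀ f → residue (Y 𝒫.* (f 𝒫.* D)) ≈ x * residue (f 𝒫.* D)
    residue-Y f = begin
      residue (Y 𝒫.* (f 𝒫.* D))
        ≈⟨ residue-cong rearranged ⟩
      residue ((Y- x) 𝒫.^ q 𝒫.* f 𝒫.+ C x 𝒫.* (f 𝒫.* D))
        ≈⟨ residue-+ _ _ ⟩
      residue ((Y- x) 𝒫.^ q 𝒫.* f) + residue (C x 𝒫.* (f 𝒫.* D))
        ≈⟨ +-cong (residue-[Y-x]^q f) (residue-scale x _) ⟩
      0# + x * residue (f 𝒫.* D)
        ≈⟨ +-identityˡ _ ⟩
      x * residue (f 𝒫.* D) ∎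
      where
      Y≈ : Y 𝒫.≈ (Y- x) 𝒫.+ C x
      Y≈ = 𝒫.sym (𝒫.trans (𝒫.+-assoc Y _ _) (𝒫.trans (𝒫.+-congˡ (𝒫.-‿inverseˡ (C x))) (𝒫.+-identityʳ Y)))
      rearranged : Y 𝒫.* (f 𝒫.* D) 𝒫.≈ (Y- x) 𝒫.^ q 𝒫.* f 𝒫.+ C x 𝒫.* (f 𝒫.* D)
      rearranged = 𝒫.trans (𝒫.*-congʳ Y≈) (𝒫.trans (𝒫.distribʳ _ _ _) (𝒫.+-congʳ
        (𝒫.trans (𝒫.*-congˡ (𝒫.*-comm f D)) (𝒫.sym (𝒫.*-assoc _ D f)))))

    opaque
      unfolding _+ᴾ_ residue

      -- `D` is monic of degree `n`, so its only coefficient in the residue class of `n` modulo `q`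
      -- is the leading one.
      residue-D : residue D ≈ 1#
      residue-D = trans (⟨⟩-cong {sectionᴾ q n D} {𝒫.1#} (x ^ q) (coefs coefficient)) (⟨⟩-1 (x ^ q))
        where
        open GroupProperties +-group using (ε⁻¹≈ε)
        linear : Deg< 2 (coef (Y- x))
        linear = deg-+ deg-X (deg-neg {f = constant R x} (deg-mono {f = constant R x} (s≤s z≤n) (deg-constant x)))
        monic : coef (Y- x) 1 ≈ 1#
        monic = trans (+-congˡ ε⁻¹≈ε) (+-identityʳ 1#)
        1^ : ∀ k → 1# ^ k ≈ 1#
        1^ zero    = refl
        1^ (suc k) = trans (*-identityˡ _) (1^ k)
        open Exponentiation commutativeSemiring using (^-congˡ)
        coefficient : ∀ i → coef D (n ℕ.+ i ℕ.* q) ≈ 1ˢ i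
        coefficient zero = begin
          coef D (n ℕ.+ 0) ≡⟨ ≡.cong (coef D) (≡.trans (ℕₚ.+-identityʳ n) (≡.sym (ℕₚ.*-identityʳ n))) ⟩
          coef D (n ℕ.* 1) ≡⟨ ≡.cong (λ g → g (n ℕ.* 1)) (coef-^ (Y- x) n) ⟩
          (coef (Y- x) ^ˢ n) (n ℕ.* 1) ≈⟨ ^-top n linear ⟩
          coef (Y- x) 1 ^ n ≈⟨ ^-congˡ n monic ⟩
          1# ^ n ≈⟨ 1^ n ⟩
          1# ∎
        coefficient (suc i) = trans (reflexive (≡.cong (λ g → g (n ℕ.+ suc i ℕ.* q)) (coef-^ (Y- x) n)))
          (deg-^ n linear _ (ℕₚ.≤-trans (s≤s (ℕₚ.≤-reflexive (ℕₚ.*-identityʳ n)))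
            (ℕₚ.≤-trans (ℕₚ.m≤m+n q (i ℕ.* q)) (ℕₚ.m≤n+m _ n))))

    -- Horner's scheme in `S`: by `residue-Y`, multiplying a multiple of `D` by `Y` multiplies its
    -- residue by `x`, so `S` acts as `S ⟨ x ⟩`.
    residue-eval : ∀ S U → residue (S 𝒫.* (U 𝒫.* D)) ≈ S ⟨ x ⟩ * residue (U 𝒫.* D)
    residue-eval S U = trans (go (bound S) S (degree S)) (*-congʳ (sym (⟨⟩-bound (bound S) S x (degree S))))
      where
      V = U 𝒫.* D
      go : ∀ b S → Deg< b (coef S) → residue (S 𝒫.* V) ≈ ev b (coef S) x * residue V
      go zero S d = begin
        residue (S 𝒫.* V) ≈⟨ residue-cong {S 𝒫.* V} {C 0# 𝒫.* V} (𝒫.*-congʳ (coefs λ i → trans (d i z≤n) (sym (0ˢ≈0 i)))) ⟩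
        residue (C 0# 𝒫.* V) ≈⟨ residue-scale 0# V ⟩
        0# * residue V ∎
      go (suc b) S d = begin
        residue (S 𝒫.* V)
          ≈⟨ residue-cong (𝒫.trans (𝒫.*-congʳ (splitᴾ S)) (𝒫.trans (𝒫.distribʳ V _ _) (𝒫.+-congˡ
               (𝒫.trans (𝒫.*-assoc Y S′ V) (𝒫.*-congˡ (𝒫.sym (𝒫.*-assoc S′ U D))))))) ⟩
        residue (C s 𝒫.* V 𝒫.+ Y 𝒫.* (S′ 𝒫.* U 𝒫.* D))
          ≈⟨ residue-+ _ _ ⟩
        residue (C s 𝒫.* V) + residue (Y 𝒫.* (S′ 𝒫.* U 𝒫.* D))
          ≈⟨ +-cong (residue-scale s V) (residue-Y (S′ 𝒫.* U)) ⟩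
        s * residue V + x * residue (S′ 𝒫.* U 𝒫.* D)
          ≈⟨ +-congˡ (*-congˡ (trans (residue-cong (𝒫.*-assoc S′ U D)) (go b S′ (deg-tail {f = coef S} d)))) ⟩
        s * residue V + x * (ev b (coef S′) x * residue V)
          ≈⟨ +-congˡ (*-assoc _ _ _) ⟨
        s * residue V + x * ev b (coef S′) x * residue V
          ≈⟨ distribʳ _ _ _ ⟨
        (s + x * ev b (coef S′) x) * residue V ∎
        where
        s = coef S 0
        S′ = tailᴾ S

    -- Since P = (Y − x) H and P^(q−1) = H^(q−1) D; this is Cartier's operator on
    -- the residue of S/P at Y = x, and H(x) = ∂P/∂y(x).

    residue-power : ∀ P → P ⟨ x ⟩ ≈ 0# → ∀ S →
                    residue (S 𝒫.* P 𝒫.^ n) ≈ S ⟨ x ⟩ * quotient P x ⟨ x ⟩ ^ n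
    residue-power P P⟨x⟩≈0 S = begin
      residue (S 𝒫.* P 𝒫.^ n) ≈⟨ residue-cong (𝒫.*-congˡ (𝒫.trans (𝒫.^-congˡ n (division P x P⟨x⟩≈0))
                                                 (𝒫.trans (𝒫.^-distrib-* (Y- x) H n) (𝒫.*-comm D (H 𝒫.^ n))))) ⟩
      residue (S 𝒫.* (H 𝒫.^ n 𝒫.* D)) ≈⟨ residue-eval S (H 𝒫.^ n) ⟩
      S ⟨ x ⟩ * residue (H 𝒫.^ n 𝒫.* D) ≈⟨ *-congˡ (powers n) ⟩
      S ⟨ x ⟩ * H ⟨ x ⟩ ^ n ∎
      where
      H = quotient P x
      powers : ∀ k → residue (H 𝒫.^ k 𝒫.* D) ≈ H ⟨ x ⟩ ^ k
      powers zero    = trans (residue-cong (𝒫.*-identityˡ D)) residue-D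
      powers (suc k) = trans (residue-cong (𝒫.*-assoc H _ D))
        (trans (residue-eval H (H 𝒫.^ k)) (*-congˡ (powers k)))

funToFin-cong : ∀ {m n} {f g : Fin m → Fin n} → (∀ i → f i ≡ g i) → funToFin f ≡ funToFin g
funToFin-cong {zero}  p = ≡.refl
funToFin-cong {suc m} p = ≡.cong₂ Fin.combine (p zero) (funToFin-cong (λ i → p (suc i)))

funToFin-injective : ∀ {m n} (f g : Fin m → Fin n) → funToFin f ≡ funToFin g → ∀ i → f i ≡ g i
funToFin-injective {m} {n} f g eq i = ≡.trans (≡.sym (Finₚ.finToFun-funToFin f i))
  (≡.trans (≡.cong (λ z → finToFun {n} {m} z i) eq) (Finₚ.finToFun-funToFin g i))

-- Polynomials over a finite field: degrees and division with remainder

module FieldPolynomials {c ℓ q} (K : FiniteField c ℓ q) where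

  open FiniteField K using (commutativeRing; 1≉0)
  open CommutativeRing commutativeRing hiding (zero)
  open FiniteFieldProperties K
  open PolynomialRing commutativeRing
  open RingSolver 𝒫.commutativeSemiring using (solve; _:=_; _:+_; _:*_)
  open SetoidReasoning 𝒫.setoid
  open Divisibility 𝒫.semiring using (_∣_; _,_; x∣ʳy⇒x∣ʳzy; ∣ʳ-trans; ∣ʳ-refl; ∣ʳ-respʳ-≈) public

  HasDegree : ℕ → Poly → Set ℓ
  HasDegree n f = Deg< (suc n) (coef f) × ¬ coef f n ≈ 0#

  degree? : ∀ f → f 𝒫.≈ 𝒫.0# ⊎ ∃[ n ] HasDegree n f
  degree? f = search (bound f) (degree f)
    where
    search : ∀ b → Deg< b (coef f) → f 𝒫.≈ 𝒫.0# ⊎ ∃[ n ] HasDegree n f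
    search zero    d = inj₁ (coefs λ n → trans (d n z≤n) (sym (0ˢ≈0 n)))
    search (suc b) d with coef f b ≈? 0#
    ... | no fb≉0  = inj₂ (b , d , fb≉0)
    ... | yes fb≈0 = search b λ n b≤n → lower n (ℕₚ.m≤n⇒m<n∨m≡n b≤n)
      where
      lower : ∀ n → b < n ⊎ b ≡ n → coef f n ≈ 0#
      lower n (inj₁ b<n)    = d n b<n
      lower n (inj₂ ≡.refl) = fb≈0

  degree-< : ∀ {m n f} → HasDegree m f → Deg< n (coef f) → m < n
  degree-< {m} {n} (_ , ne) d with n ℕₚ.≤? m
  ... | yes n≤m = contradiction (d m n≤m) ne
  ... | no n≰m  = ℕₚ.≰⇒> n≰m

  degree-cong : ∀ {n f g} → f 𝒫.≈ g → HasDegree n f → HasDegree n g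
  degree-cong f≈g (d , ne) = deg-cong (coef-≈ f≈g) d , λ gn≈0 → ne (trans (coef-≈ f≈g _) gn≈0)

  degree-* : ∀ {m n f g} → HasDegree m f → HasDegree n g → HasDegree (m ℕ.+ n) (f 𝒫.* g)
  degree-* {m} {n} {f} {g} (df , fm≉0) (dg , gn≉0) =
      ≡.subst₂ (λ b h → Deg< b h) (ℕₚ.+-suc m n) (≡.sym (coef-* f g)) (deg-⊛ m df dg)
    , λ eq → gn≉0 (*-cancel-0 fm≉0 (trans (sym (⊛-top m df dg))
        (trans (reflexive (≡.cong (λ h → h (m ℕ.+ n)) (≡.sym (coef-* f g)))) eq)))

  deg-divisor : ∀ {b B} → HasDegree b B → ∀ n G → Deg< (n ℕ.+ b) (coef (G 𝒫.* B)) → Deg< n (coef G)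
  deg-divisor {b} {B} (dB , Bb≉0) n G d = deg-cancel dB (λ x xB≈0 → *-cancel-0 Bb≉0 (trans (*-comm _ x) xB≈0))
    (bound G) n (deg-mono {f = coef G} (ℕₚ.m≤m+n (bound G) n) (degree G)) (≡.subst (Deg< (n ℕ.+ b)) (coef-* G B) d)

  Deg<0⇒≈0 : ∀ {f} → Deg< 0 (coef f) → f 𝒫.≈ 𝒫.0#
  Deg<0⇒≈0 d = coefs λ n → trans (d n z≤n) (sym (0ˢ≈0 n))

  *-cancelʳ-0 : ∀ {b B} → HasDegree b B → ∀ G → G 𝒫.* B 𝒫.≈ 𝒫.0# → G 𝒫.≈ 𝒫.0#
  *-cancelʳ-0 hB G GB≈0 = Deg<0⇒≈0 (deg-divisor hB 0 G (λ n _ → trans (coef-≈ GB≈0 n) (0ˢ≈0 n)))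

  *-cancelʳ : ∀ {b B} → HasDegree b B → ∀ G H → G 𝒫.* B 𝒫.≈ H 𝒫.* B → G 𝒫.≈ H
  *-cancelʳ {B = B} hB G H GB≈HB = x∙y⁻¹≈ε⇒x≈y G H (*-cancelʳ-0 hB (G 𝒫.- H) (begin
    (G 𝒫.- H) 𝒫.* B ≈⟨ 𝒫.distribʳ B G (𝒫.- H) ⟩
    G 𝒫.* B 𝒫.+ 𝒫.- H 𝒫.* B ≈⟨ 𝒫.+-cong GB≈HB (𝒫.sym (-‿distribˡ-* H B)) ⟩
    H 𝒫.* B 𝒫.- H 𝒫.* B ≈⟨ 𝒫.-‿inverseʳ _ ⟩
    𝒫.0# ∎))
    where open RingProperties 𝒫.ring using (-‿distribˡ-*)
          open GroupProperties 𝒫.+-group using (x∙y⁻¹≈ε⇒x≈y)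

  record DivMod (f B : Poly) (b : ℕ) : Set (c ⊔ ℓ) where
    constructor divMod
    field
      quotient  : Poly
      remainder : Poly
      property  : f 𝒫.≈ quotient 𝒫.* B 𝒫.+ remainder
      small     : Deg< b (coef remainder)

  -- Recursion on the bound. If `r` is the remainder of the tail, then `f 0 + Y r` has degree at
  -- most `b`, and subtracting a scalar multiple of `B` brings it below `b`.
  divide : ∀ {b B} → HasDegree b B → ∀ f → DivMod f B b
  divide {b} {B} (dB , Bb≉0) f = go (bound f) f (degree f)
    where
    go : ∀ n f → Deg< n (coef f) → DivMod f B b
    go zero f d = divMod 𝒫.0# 𝒫.0#
      (𝒫.trans (Deg<0⇒≈0 d) (𝒫.sym (𝒫.trans (𝒫.+-identityʳ _) (𝒫.zeroˡ B)))) deg-0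
    go (suc n) f d with go n (tailᴾ f) (deg-tail {f = coef f} d)
    ... | divMod Q r eq small = divMod (Y 𝒫.* Q 𝒫.+ C a) (s 𝒫.- C a 𝒫.* B) eq′ small′
      where
      s : Poly
      s = C (coef f 0) 𝒫.+ Y 𝒫.* r
      a : Carrier
      a = coef s b * (Bb≉0 ⁻¹)
      eq′ : f 𝒫.≈ (Y 𝒫.* Q 𝒫.+ C a) 𝒫.* B 𝒫.+ (s 𝒫.- C a 𝒫.* B)
      eq′ = begin
        f ≈⟨ splitᴾ f ⟩
        C (coef f 0) 𝒫.+ Y 𝒫.* tailᴾ f ≈⟨ 𝒫.+-congˡ (𝒫.*-congˡ eq) ⟩
        C (coef f 0) 𝒫.+ Y 𝒫.* (Q 𝒫.* B 𝒫.+ r)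
          ≈⟨ solve 5 (λ c y q b r → c :+ y :* (q :* b :+ r) := y :* q :* b :+ (c :+ y :* r)) 𝒫.refl _ Y Q B r ⟩
        Y 𝒫.* Q 𝒫.* B 𝒫.+ s ≈⟨ 𝒫.+-congˡ (𝒫.trans (𝒫.sym (𝒫.+-identityˡ s)) (𝒫.+-congʳ (𝒫.sym (𝒫.-‿inverseʳ (C a 𝒫.* B))))) ⟩
        Y 𝒫.* Q 𝒫.* B 𝒫.+ (C a 𝒫.* B 𝒫.- C a 𝒫.* B 𝒫.+ s)
          ≈⟨ solve 6 (λ y q b a m s → y :* q :* b :+ (a :* b :+ m :+ s) := (y :* q :+ a) :* b :+ (s :+ m)) 𝒫.refl Y Q B (C a) (𝒫.- (C a 𝒫.* B)) s ⟩
        (Y 𝒫.* Q 𝒫.+ C a) 𝒫.* B 𝒫.+ (s 𝒫.- C a 𝒫.* B) ∎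
      coefficient : ∀ n → coef (s 𝒫.- C a 𝒫.* B) n ≈ coef s n - a * coef B n
      coefficient n = trans (reflexive (≡.cong (λ h → h n) (≡.trans (coef-+ s _) (≡.cong (coef s ⊞_) (≡.trans (coef-neg (C a 𝒫.* B)) (≡.cong ⊟_ (coef-* (C a) B)))))))
                            (+-congˡ (-‿cong (constant-⊛ a (coef B) n)))
      ds : Deg< (suc b) (coef s)
      ds (suc n) (s≤s b≤n) = trans (reflexive (≡.cong (λ h → h (suc n)) (≡.trans (coef-+ (C (coef f 0)) (Y 𝒫.* r)) (≡.cong (constant _ (coef f 0) ⊞_) (coef-* Y r)))))
        (trans (+-identityˡ _) (trans (X-⊛ (coef r) (suc n)) (small n b≤n)))
      open GroupProperties +-group using (x≈y⇒x∙y⁻¹≈ε)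
      small′ : Deg< b (coef (s 𝒫.- C a 𝒫.* B))
      small′ n b≤n with ℕₚ.m≤n⇒m<n∨m≡n b≤n
      ... | inj₁ b<n = trans (coefficient n) (x≈y⇒x∙y⁻¹≈ε (trans (ds n b<n) (sym (trans (*-congˡ (dB n b<n)) (zeroʳ a)))))
      ... | inj₂ ≡.refl = trans (coefficient n) (x≈y⇒x∙y⁻¹≈ε (sym
        (trans (*-assoc _ _ _) (trans (*-congˡ (⁻¹-inverseˡ Bb≉0)) (*-identityʳ _)))))

  -- Residue fields

  record Congruent (B f g : Poly) : Set (c ⊔ ℓ) where
    constructor congruent
    field
      multiple : Poly
      equality : f 𝒫.≈ g 𝒫.+ multiple 𝒫.* B

  congruent-≈ : ∀ {B f g} → f 𝒫.≈ g → Congruent B f g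
  congruent-≈ {B} f≈g = congruent 𝒫.0# (𝒫.trans f≈g (𝒫.sym (𝒫.trans (𝒫.+-congˡ (𝒫.zeroˡ B)) (𝒫.+-identityʳ _))))

  module _ (B : Poly) where

    private
      _~_ = Congruent B

    ~-sym : ∀ {f g} → f ~ g → g ~ f
    ~-sym {f} {g} (congruent Q eq) = congruent (𝒫.- Q) (begin
      g ≈⟨ 𝒫.+-identityʳ g ⟨
      g 𝒫.+ 𝒫.0# ≈⟨ 𝒫.+-congˡ (𝒫.trans (𝒫.*-congʳ (𝒫.-‿inverseʳ Q)) (𝒫.zeroˡ B)) ⟨
      g 𝒫.+ (Q 𝒫.- Q) 𝒫.* B ≈⟨ solve 4 (λ g Q m B → g :+ (Q :+ m) :* B := g :+ Q :* B :+ m :* B) 𝒫.refl g Q (𝒫.- Q) B ⟩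
      g 𝒫.+ Q 𝒫.* B 𝒫.+ 𝒫.- Q 𝒫.* B ≈⟨ 𝒫.+-congʳ eq ⟨
      f 𝒫.+ 𝒫.- Q 𝒫.* B ∎)

    ~-trans : ∀ {f g h} → f ~ g → g ~ h → f ~ h
    ~-trans {f} {g} {h} (congruent Q eq) (congruent Q′ eq′) = congruent (Q′ 𝒫.+ Q)
      (𝒫.trans eq (𝒫.trans (𝒫.+-congʳ eq′) (solve 4 (λ h Q Q′ B → h :+ Q′ :* B :+ Q :* B := h :+ (Q′ :+ Q) :* B) 𝒫.refl h Q Q′ B)))

    ~-+ : ∀ {f g f′ g′} → f ~ g → f′ ~ g′ → (f 𝒫.+ f′) ~ (g 𝒫.+ g′)
    ~-+ {f} {g} {f′} {g′} (congruent Q eq) (congruent Q′ eq′) = congruent (Q 𝒫.+ Q′)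
      (𝒫.trans (𝒫.+-cong eq eq′) (solve 5 (λ g g′ Q Q′ B → g :+ Q :* B :+ (g′ :+ Q′ :* B) := g :+ g′ :+ (Q :+ Q′) :* B) 𝒫.refl g g′ Q Q′ B))

    ~-* : ∀ {f g f′ g′} → f ~ g → f′ ~ g′ → (f 𝒫.* f′) ~ (g 𝒫.* g′)
    ~-* {f} {g} {f′} {g′} (congruent Q eq) (congruent Q′ eq′) = congruent (g 𝒫.* Q′ 𝒫.+ Q 𝒫.* g′ 𝒫.+ Q 𝒫.* B 𝒫.* Q′)
      (𝒫.trans (𝒫.*-cong eq eq′) (solve 5 (λ g g′ Q Q′ B → (g :+ Q :* B) :* (g′ :+ Q′ :* B) := g :* g′ :+ (g :* Q′ :+ Q :* g′ :+ Q :* B :* Q′) :* B) 𝒫.refl g g′ Q Q′ B))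

    ~-neg : ∀ {f g} → f ~ g → (𝒫.- f) ~ (𝒫.- g)
    ~-neg {f} {g} (congruent Q eq) = congruent (𝒫.- Q) (𝒫.trans (𝒫.-‿cong eq)
      (𝒫.trans (𝒫.sym (-‿+-comm g (Q 𝒫.* B))) (𝒫.+-congˡ (-‿distribˡ-* Q B))))
      where open RingProperties 𝒫.ring using (-‿distribˡ-*; -‿+-comm)

    quotientRing : CommutativeRing (c ⊔ ℓ) (c ⊔ ℓ)
    quotientRing = record
      { Carrier = Poly ; _≈_ = _~_ ; _+_ = 𝒫._+_ ; _*_ = 𝒫._*_ ; -_ = 𝒫.-_ ; 0# = 𝒫.0# ; 1# = 𝒫.1#
      ; isCommutativeRing = record
        { isRing = record
          { +-isAbelianGroup = record
            { isGroup = record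
              { isMonoid = record
                { isSemigroup = record
                  { isMagma = record
                    { isEquivalence = record { refl = congruent-≈ 𝒫.refl ; sym = ~-sym ; trans = ~-trans }
                    ; ∙-cong = ~-+ }
                  ; assoc = λ f g h → congruent-≈ (𝒫.+-assoc f g h) }
                ; identity = (λ f → congruent-≈ (𝒫.+-identityˡ f)) , (λ f → congruent-≈ (𝒫.+-identityʳ f)) }
              ; inverse = (λ f → congruent-≈ (𝒫.-‿inverseˡ f)) , (λ f → congruent-≈ (𝒫.-‿inverseʳ f))
              ; ⁻¹-cong = ~-neg }
            ; comm = λ f g → congruent-≈ (𝒫.+-comm f g) }
          ; *-cong = ~-*
          ; *-assoc = λ f g h → congruent-≈ (𝒫.*-assoc f g h)
          ; *-identity = (λ f → congruent-≈ (𝒫.*-identityˡ f)) , (λ f → congruent-≈ (𝒫.*-identityʳ f))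
          ; distrib = (λ f g h → congruent-≈ (𝒫.distribˡ f g h)) , (λ f g h → congruent-≈ (𝒫.distribʳ f g h)) }
        ; *-comm = λ f g → congruent-≈ (𝒫.*-comm f g) } }

  -- Irreducibility through the degrees of divisors: this is what Euclid's algorithm asks for when a
  -- remainder is zero, and what a divisor of least positive degree satisfies.
  record Irreducible (b : ℕ) (B : Poly) : Set (c ⊔ ℓ) where
    field
      hasDegree : HasDegree b B
      positive  : 0 < b
      minimal   : ∀ f → f ∣ B → ∀ n → HasDegree n f → n < b → n ≡ 0

  module _ {b B} (irr : Irreducible b B) where

    open Irreducible irr

    private
      _~_ = Congruent B

    small-unique : ∀ {f g} → f ~ g → Deg< b (coef f) → Deg< b (coef g) → f 𝒫.≈ g
    small-unique {f} {g} (congruent Q eq) df dg = 𝒫.trans eq (𝒫.trans (𝒫.+-congˡ (𝒫.trans (𝒫.*-congʳ Q≈0) (𝒫.zeroˡ B))) (𝒫.+-identityʳ g))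
      where
      QB : ∀ n → coef f n - coef g n ≈ coef (Q 𝒫.* B) n
      QB n = trans (+-congʳ (trans (coef-≈ eq n) (reflexive (≡.cong (λ h → h n) (coef-+ g _))))) (xyx⁻¹≈y _ _)
        where open AbelianGroupProperties +-abelianGroup using (xyx⁻¹≈y)
      Q≈0 : Q 𝒫.≈ 𝒫.0#
      Q≈0 = Deg<0⇒≈0 (deg-divisor hasDegree 0 Q (deg-cong QB (deg-+ df (deg-neg {f = coef g} dg))))

    -- Induction on the degree with `B = Q f + r`. If `r` is zero, `f` divides `B` and is a
    -- constant. Otherwise an inverse `u` of `r` modulo `B` yields the inverse `− u Q` of `f`,
    -- because `u Q f + u r` is a multiple of `B`.
    inverse-small : ∀ n f → HasDegree n f → n < b → ∃[ u ] (u 𝒫.* f) ~ 𝒫.1#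
    inverse-small = <-rec _ step
      where
      step : ∀ n → (∀ {m} → m < n → ∀ f → HasDegree m f → m < b → ∃[ u ] (u 𝒫.* f) ~ 𝒫.1#) →
             ∀ f → HasDegree n f → n < b → ∃[ u ] (u 𝒫.* f) ~ 𝒫.1#
      step n rec f hf n<b with divide hf B
      ... | divMod Q r B≈Qf+r small with degree? r
      ... | inj₁ r≈0 = C (proj₂ hf₀ ⁻¹) , congruent-≈ (coefs constant≈1)
        where
        n≡0 : n ≡ 0
        n≡0 = minimal f (Q , 𝒫.sym (𝒫.trans B≈Qf+r (𝒫.trans (𝒫.+-congˡ r≈0) (𝒫.+-identityʳ _)))) n hf n<b
        hf₀ : HasDegree 0 f
        hf₀ = ≡.subst (λ k → HasDegree k f) n≡0 hf
        constant≈1 : ∀ i → coef (C (proj₂ hf₀ ⁻¹) 𝒫.* f) i ≈ 1ˢ i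
        constant≈1 i = trans (reflexive (≡.cong (λ h → h i) (coef-* (C _) f))) (trans (constant-⊛ _ (coef f) i) (at i))
          where
          at : ∀ i → (proj₂ hf₀ ⁻¹) * coef f i ≈ 1ˢ i
          at zero    = ⁻¹-inverseˡ (proj₂ hf₀)
          at (suc i) = trans (*-congˡ (proj₁ hf₀ (suc i) (s≤s z≤n))) (zeroʳ _)
      ... | inj₂ (m , hr) with rec (degree-< {f = r} hr small) r hr (ℕₚ.<-trans (degree-< {f = r} hr small) n<b)
      ... | u , congruent T ur≈1 = 𝒫.- (u 𝒫.* Q) , congruent (T 𝒫.- u) (begin
        𝒫.- (u 𝒫.* Q) 𝒫.* f ≈⟨ 𝒫.sym (-‿distribˡ-* (u 𝒫.* Q) f) ⟩
        𝒫.- (u 𝒫.* Q 𝒫.* f) ≈⟨ inverseʳ-unique _ _ sum≈0 ⟨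
        𝒫.1# 𝒫.+ (T 𝒫.- u) 𝒫.* B ∎)
        where
        open RingProperties 𝒫.ring using (-‿distribˡ-*)
        open GroupProperties 𝒫.+-group using (inverseʳ-unique)
        sum≈0 : u 𝒫.* Q 𝒫.* f 𝒫.+ (𝒫.1# 𝒫.+ (T 𝒫.- u) 𝒫.* B) 𝒫.≈ 𝒫.0#
        sum≈0 = begin
          u 𝒫.* Q 𝒫.* f 𝒫.+ (𝒫.1# 𝒫.+ (T 𝒫.- u) 𝒫.* B)
            ≈⟨ solve 7 (λ u Q f o T v B → u :* Q :* f :+ (o :+ (T :+ v) :* B) := u :* Q :* f :+ (o :+ T :* B) :+ v :* B) 𝒫.refl u Q f 𝒫.1# T (𝒫.- u) B ⟩
          u 𝒫.* Q 𝒫.* f 𝒫.+ (𝒫.1# 𝒫.+ T 𝒫.* B) 𝒫.+ 𝒫.- u 𝒫.* B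
            ≈⟨ 𝒫.+-congʳ (𝒫.+-congˡ ur≈1) ⟨
          u 𝒫.* Q 𝒫.* f 𝒫.+ u 𝒫.* r 𝒫.+ 𝒫.- u 𝒫.* B
            ≈⟨ 𝒫.+-congʳ (solve 4 (λ u Q f r → u :* Q :* f :+ u :* r := u :* (Q :* f :+ r)) 𝒫.refl u Q f r) ⟩
          u 𝒫.* (Q 𝒫.* f 𝒫.+ r) 𝒫.+ 𝒫.- u 𝒫.* B
            ≈⟨ 𝒫.+-cong (𝒫.*-congˡ (𝒫.sym B≈Qf+r)) (𝒫.sym (-‿distribˡ-* u B)) ⟩
          u 𝒫.* B 𝒫.- u 𝒫.* B
            ≈⟨ 𝒫.-‿inverseʳ _ ⟩
          𝒫.0# ∎

    reduce : Poly → Poly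
    reduce f = DivMod.remainder (divide {b} {B} hasDegree f)

    reduce-small : ∀ f → Deg< b (coef (reduce f))
    reduce-small f = DivMod.small (divide {b} {B} hasDegree f)

    reduce-~ : ∀ f → f ~ reduce f
    reduce-~ f = congruent (DivMod.quotient (divide {b} {B} hasDegree f)) (𝒫.trans (DivMod.property (divide {b} {B} hasDegree f)) (𝒫.+-comm _ _))

    private
      encode : Poly → Fin (q ℕ.^ b)
      encode f = funToFin {b} {q} (λ i → to (coef f (toℕ i)))

      decodeCoef : Fin (q ℕ.^ b) → Series
      decodeCoef k n with n ℕₚ.<? b
      ... | yes n<b = from (finToFun {q} {b} k (fromℕ< n<b))
      ... | no _    = 0#

      decode : Fin (q ℕ.^ b) → Poly
      decode k = poly {decodeCoef k} {b} vanish
        where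
        vanish : Deg< b (decodeCoef k)
        vanish n b≤n with n ℕₚ.<? b
        ... | yes n<b = contradiction b≤n (ℕₚ.<⇒≱ n<b)
        ... | no _    = refl

      decode-toℕ : ∀ k (i : Fin b) → to (decodeCoef k (toℕ i)) ≡ finToFun {q} {b} k i
      decode-toℕ k i with toℕ i ℕₚ.<? b
      ... | yes i<b = ≡.trans (strictlyInverseˡ _) (≡.cong (finToFun {q} {b} k) (Finₚ.fromℕ<-toℕ i i<b))
      ... | no i≮b  = contradiction (Finₚ.toℕ<n i) i≮b

      encode-decode : ∀ k → encode (decode k) ≡ k
      encode-decode k = ≡.trans (funToFin-cong (decode-toℕ k)) (Finₚ.funToFin-finToFin {b} {q} k)

      decode-encode : ∀ f → Deg< b (coef f) → decode (encode f) 𝒫.≈ f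
      decode-encode f d = coefs at
        where
        at : ∀ n → decodeCoef (encode f) n ≈ coef f n
        at n with n ℕₚ.<? b
        ... | yes n<b = trans (reflexive (≡.cong from (Finₚ.finToFun-funToFin (λ i → to (coef f (toℕ i))) (fromℕ< n<b))))
                          (trans (strictlyInverseʳ _) (reflexive (≡.cong (coef f) (Finₚ.toℕ-fromℕ< n<b))))
        ... | no n≮b  = sym (d n (ℕₚ.≮⇒≥ n≮b))

      encode-cong : ∀ {f g} → f 𝒫.≈ g → encode f ≡ encode g
      encode-cong f≈g = funToFin-cong {b} λ i → to-cong (coef-≈ f≈g (toℕ i))

    -- Its purpose is its order: Fermat's theorem in a field with `q^b` elements, applied to the
    -- class of `Y`, is the congruence `Y^q^b~Y`.
    residueField : FiniteField (c ⊔ ℓ) (c ⊔ ℓ) (q ℕ.^ b)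
    residueField = record
      { commutativeRing = quotientRing B
      ; 1≉0 = λ 1~0 → 1≉0 (coef-≈ (small-unique 1~0 (deg-mono {f = 1ˢ} positive (deg-constant 1#)) deg-0) 0)
      ; invertible = invertible
      ; enumerate = record
        { to = λ f → encode (reduce f)
        ; from = decode
        ; to-cong = λ {f} {g} f~g → encode-cong (small-unique (~-trans B (~-sym B (reduce-~ f)) (~-trans B f~g (reduce-~ g))) (reduce-small f) (reduce-small g))
        ; from-cong = λ { ≡.refl → congruent-≈ 𝒫.refl }
        ; inverse = (λ {k} {f} f~ → ≡.trans (encode-cong (small-unique (~-trans B (~-sym B (reduce-~ f)) f~) (reduce-small f) (degree (decode k)))) (encode-decode k))
                  , λ { {f} ≡.refl → ~-trans B (congruent-≈ (decode-encode (reduce f) (reduce-small f))) (~-sym B (reduce-~ f)) } } }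
      where
      invertible : ∀ f → ¬ f ~ 𝒫.0# → ∃[ u ] ((u 𝒫.* f) ~ 𝒫.1# × (f 𝒫.* u) ~ 𝒫.1#)
      invertible f f≁0 with degree? (reduce f)
      ... | inj₁ r≈0 = contradiction (~-trans B (reduce-~ f) (congruent-≈ r≈0)) f≁0
      ... | inj₂ (n , hr) with inverse-small n (reduce f) hr (degree-< {f = reduce f} hr (reduce-small f))
      ... | u , ur~1 = u , uf~1 , ~-trans B (congruent-≈ (𝒫.*-comm f u)) uf~1
        where
        uf~1 : (u 𝒫.* f) ~ 𝒫.1#
        uf~1 = ~-trans B (~-* B (congruent-≈ 𝒫.refl) (reduce-~ f)) ur~1

    Y^q^b~Y : (Y 𝒫.^ (q ℕ.^ b)) ~ Y
    Y^q^b~Y = ≡.subst (_~ Y) (power (q ℕ.^ b)) (FiniteFieldProperties.fermat residueField Y)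
      where
      open Exponentiation (CommutativeRing.commutativeSemiring (quotientRing B)) using () renaming (_^_ to _^ᴮ_)
      power : ∀ n → Y ^ᴮ n ≡ Y 𝒫.^ n
      power zero    = ≡.refl
      power (suc n) = ≡.cong (Y 𝒫.*_) (power n)

module DistinctProducts where

  open import Data.Nat.Base using (_+_; _*_; _^_)
  open ListAction using (sum; product)

  -- Products of distinct numbers with a given sum

  unique⇒lookup-injective : ∀ {xs : List ℕ} → Unique xs → ∀ i j → lookup xs i ≡ lookup xs j → i ≡ j
  unique⇒lookup-injective (x∉ ∷ u) zero    zero    eq = ≡.refl
  unique⇒lookup-injective (x∉ ∷ u) zero    (suc j) eq = contradiction eq (All.lookup x∉ (∈-lookup j))
  unique⇒lookup-injective (x∉ ∷ u) (suc i) zero    eq = contradiction (≡.sym eq) (All.lookup x∉ (∈-lookup i))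
  unique⇒lookup-injective (x∉ ∷ u) (suc i) (suc j) eq = ≡.cong suc (unique⇒lookup-injective u i j eq)

  unique⇒length≤ : ∀ {t} {xs : List ℕ} → Unique xs → All (_< t) xs → length xs ≤ t
  unique⇒length≤ {t} {xs} u small = Finₚ.injective⇒≤ {f = λ i → fromℕ< (All.lookup small (∈-lookup i))}
    λ {i} {j} eq → unique⇒lookup-injective u i j (Finₚ.fromℕ<-injective _ _ _ _ eq)

  -- The range cannot start earlier than 13: at 12 the left side is 589824 and the right side
  -- 531441. The induction step rests on `2 (m + 1)² ≤ 3 m²`.
  m²*2^m≤3^m : ∀ j → let m = 13 + j in m * m * 2 ^ m ≤ 3 ^ m
  m²*2^m≤3^m zero    = toWitness {a? = 13 * 13 * 2 ^ 13 ℕₚ.≤? 3 ^ 13} _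
  m²*2^m≤3^m (suc j) = begin
    suc m * suc m * (2 * 2 ^ m) ≡⟨ solve 2 (λ m x → (con 1 :+ m) :* (con 1 :+ m) :* (con 2 :* x) := (con 2 :* ((con 1 :+ m) :* (con 1 :+ m))) :* x) ≡.refl m (2 ^ m) ⟩
    2 * (suc m * suc m) * 2 ^ m ≤⟨ ℕₚ.*-monoˡ-≤ (2 ^ m) square ⟩
    3 * (m * m) * 2 ^ m ≡⟨ ℕₚ.*-assoc 3 (m * m) (2 ^ m) ⟩
    3 * (m * m * 2 ^ m) ≤⟨ ℕₚ.*-monoʳ-≤ 3 (m²*2^m≤3^m j) ⟩
    3 * 3 ^ m ∎
    where
    open ℕₚ.≤-Reasoning
    open +-*-Solver
    m = 13 + j
    square : 2 * (suc m * suc m) ≤ 3 * (m * m)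
    square = begin
      2 * (suc m * suc m) ≡⟨ solve 1 (λ j → con 2 :* ((con 14 :+ j) :* (con 14 :+ j)) := con 2 :* j :* j :+ con 56 :* j :+ con 392) ≡.refl j ⟩
      2 * j * j + 56 * j + 392 ≤⟨ ℕₚ.m≤m+n _ (j * j + 22 * j + 115) ⟩
      2 * j * j + 56 * j + 392 + (j * j + 22 * j + 115) ≡⟨ solve 1 (λ j → con 2 :* j :* j :+ con 56 :* j :+ con 392 :+ (j :* j :+ con 22 :* j :+ con 115) := con 3 :* ((con 13 :+ j) :* (con 13 :+ j))) ≡.refl j ⟩
      3 * (m * m) ∎

  -- Numbers below 13, of which a list of distinct numbers has at most 13,
  -- contribute a factor at most 144 each.

  opaque
    productConstant : ℕ
    productConstant = 144 ^ 13

    product-bound : ∀ n ms → Unique ms → sum ms ≤ n →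
                    product ms * product ms * 2 ^ n ≤ productConstant * 3 ^ n
    product-bound n ms unique sum≤n = begin
      product ms * product ms * 2 ^ n ≡⟨ ≡.cong (λ k → product ms * product ms * 2 ^ k) n≡ ⟩
      product ms * product ms * 2 ^ (sum ms + r) ≡⟨ ≡.cong (product ms * product ms *_) (ℕₚ.^-distribˡ-+-* 2 (sum ms) r) ⟩
      product ms * product ms * (2 ^ sum ms * 2 ^ r) ≡⟨ ℕₚ.*-assoc (product ms * product ms) _ _ ⟨
      product ms * product ms * 2 ^ sum ms * 2 ^ r ≤⟨ ℕₚ.*-mono-≤ (weighted ms) (ℕₚ.^-monoˡ-≤ r (s≤s (s≤s (z≤n {1})))) ⟩
      144 ^ length (small ms) * 3 ^ sum ms * 3 ^ r ≤⟨ ℕₚ.*-monoˡ-≤ (3 ^ r) (ℕₚ.*-monoˡ-≤ (3 ^ sum ms) (ℕₚ.^-monoʳ-≤ 144 (unique⇒length≤ (filter⁺ (ℕₚ._<? 13) unique) (all-filter (ℕₚ._<? 13) ms)))) ⟩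
      144 ^ 13 * 3 ^ sum ms * 3 ^ r ≡⟨ ℕₚ.*-assoc (144 ^ 13) (3 ^ sum ms) (3 ^ r) ⟩
      144 ^ 13 * (3 ^ sum ms * 3 ^ r) ≡⟨ ≡.cong (144 ^ 13 *_) (ℕₚ.^-distribˡ-+-* 3 (sum ms) r) ⟨
      144 ^ 13 * 3 ^ (sum ms + r) ≡⟨ ≡.cong (λ k → 144 ^ 13 * 3 ^ k) n≡ ⟨
      144 ^ 13 * 3 ^ n ∎
      where
      open ℕₚ.≤-Reasoning
      open +-*-Solver
      r : ℕ
      r = n ℕ.∸ sum ms
      n≡ : n ≡ sum ms + r
      n≡ = ≡.sym (ℕₚ.m+[n∸m]≡n sum≤n)
      small : List ℕ → List ℕ
      small = filter (ℕₚ._<? 13)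
      regroup : ∀ m P x X → m * P * (m * P) * (x * X) ≡ m * m * x * (P * P * X)
      regroup = solve 4 (λ m P x X → m :* P :* (m :* P) :* (x :* X) := m :* m :* x :* (P :* P :* X)) ≡.refl
      weighted : ∀ ms → product ms * product ms * 2 ^ sum ms ≤ 144 ^ length (small ms) * 3 ^ sum ms
      weighted []       = s≤s z≤n
      weighted (m ∷ ms) = by-size (m ℕₚ.<? 13)
       where
       by-size : Dec (m < 13) → product (m ∷ ms) * product (m ∷ ms) * 2 ^ sum (m ∷ ms) ≤ 144 ^ length (small (m ∷ ms)) * 3 ^ sum (m ∷ ms)
       by-size (yes m<13) = begin
        m * product ms * (m * product ms) * 2 ^ (m + sum ms)
          ≡⟨ ≡.trans (≡.cong (m * product ms * (m * product ms) *_) (ℕₚ.^-distribˡ-+-* 2 m (sum ms))) (regroup m (product ms) (2 ^ m) (2 ^ sum ms)) ⟩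
        m * m * 2 ^ m * (product ms * product ms * 2 ^ sum ms)
          ≤⟨ ℕₚ.*-mono-≤ (ℕₚ.*-mono-≤ (ℕₚ.*-mono-≤ (ℕₚ.≤-pred m<13) (ℕₚ.≤-pred m<13)) (ℕₚ.^-monoˡ-≤ m (s≤s (s≤s (z≤n {1}))))) (weighted ms) ⟩
        144 * 3 ^ m * (144 ^ length (small ms) * 3 ^ sum ms)
          ≡⟨ solve 4 (λ c x y X → c :* x :* (y :* X) := c :* y :* (x :* X)) ≡.refl 144 (3 ^ m) (144 ^ length (small ms)) (3 ^ sum ms) ⟩
        144 * 144 ^ length (small ms) * (3 ^ m * 3 ^ sum ms)
          ≡⟨ ≡.cong (144 * 144 ^ length (small ms) *_) (ℕₚ.^-distribˡ-+-* 3 m (sum ms)) ⟨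
        144 ^ suc (length (small ms)) * 3 ^ (m + sum ms)
          ≡⟨ ≡.cong (λ l → 144 ^ length l * 3 ^ (m + sum ms)) (filter-accept (ℕₚ._<? 13) m<13) ⟨
        144 ^ length (small (m ∷ ms)) * 3 ^ (m + sum ms) ∎
       by-size (no m≮13) = begin
        m * product ms * (m * product ms) * 2 ^ (m + sum ms)
          ≡⟨ ≡.trans (≡.cong (m * product ms * (m * product ms) *_) (ℕₚ.^-distribˡ-+-* 2 m (sum ms))) (regroup m (product ms) (2 ^ m) (2 ^ sum ms)) ⟩
        m * m * 2 ^ m * (product ms * product ms * 2 ^ sum ms)
          ≤⟨ ℕₚ.*-mono-≤ (≡.subst (λ k → k * k * 2 ^ k ≤ 3 ^ k) (ℕₚ.m+[n∸m]≡n (ℕₚ.≮⇒≥ m≮13)) (m²*2^m≤3^m (m ℕ.∸ 13))) (weighted ms) ⟩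
        3 ^ m * (144 ^ length (small ms) * 3 ^ sum ms)
          ≡⟨ solve 3 (λ x y X → x :* (y :* X) := y :* (x :* X)) ≡.refl (3 ^ m) (144 ^ length (small ms)) (3 ^ sum ms) ⟩
        144 ^ length (small ms) * (3 ^ m * 3 ^ sum ms)
          ≡⟨ ≡.cong (144 ^ length (small ms) *_) (ℕₚ.^-distribˡ-+-* 3 m (sum ms)) ⟨
        144 ^ length (small ms) * 3 ^ (m + sum ms)
          ≡⟨ ≡.cong (λ l → 144 ^ length l * 3 ^ (m + sum ms)) (filter-reject (ℕₚ._<? 13) m≮13) ⟨
        144 ^ length (small (m ∷ ms)) * 3 ^ (m + sum ms) ∎

open DistinctProducts

product-positive : ∀ {ms} → All (0 <_) ms → 0 < ListAction.product ms
product-positive []       = s≤s z≤n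
product-positive (p ∷ ps) = ℕₚ.*-mono-< p (product-positive ps)

pred-* : ∀ m n → 0 < m → 0 < n → pred n ℕ.+ pred m ℕ.* n ≡ pred (m ℕ.* n)
pred-* (suc m) (suc n) _ _ = ≡.refl

n<m^n : ∀ {m} n → 2 ≤ m → n < m ℕ.^ n
n<m^n zero    2≤m = s≤s z≤n
n<m^n {m} (suc n) 2≤m = begin-strict
  suc n <⟨ s≤s (n<m^n n 2≤m) ⟩
  1 ℕ.+ m ℕ.^ n ≤⟨ ℕₚ.+-monoˡ-≤ (m ℕ.^ n) (ℕₚ.≤-trans (s≤s z≤n) (n<m^n n 2≤m)) ⟩
  m ℕ.^ n ℕ.+ m ℕ.^ n ≡⟨ ≡.cong (m ℕ.^ n ℕ.+_) (ℕₚ.+-identityʳ (m ℕ.^ n)) ⟨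
  2 ℕ.* m ℕ.^ n ≤⟨ ℕₚ.*-monoˡ-≤ (m ℕ.^ n) 2≤m ⟩
  m ℕ.* m ℕ.^ n ∎
  where open ℕₚ.≤-Reasoning

module PrimePowerField {c ℓ q} (K : FiniteField c ℓ q) {p k} (pr : Prime p) (q≡p^k : q ≡ p ℕ.^ suc k) where

  open FiniteField K using (commutativeRing)
  open CommutativeRing commutativeRing hiding (zero)
  open FiniteFieldProperties K
  open PolynomialRing commutativeRing
  open FieldPolynomials K
  open Characteristic commutativeRing
  open SetoidReasoning 𝒫.setoid
  open Exponentiation commutativeSemiring using (_^_; ^-congˡ; ^-assocʳ)
  open Multiples semiring using () renaming (_×_ to _⋆_)

  q^j≡ : ∀ j → p ℕ.^ (suc k ℕ.* j) ≡ q ℕ.^ j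
  q^j≡ j = ≡.trans (≡.sym (ℕₚ.^-*-assoc p (suc k) j)) (≡.cong (ℕ._^ j) (≡.sym q≡p^k))

  p⋆1≈0 : p ⋆ 1# ≈ 0#
  p⋆1≈0 = characteristic {p} {suc k} q≡p^k

  ^q^-distrib-⊞ : ∀ j f g → ((f ⊞ g) ^ˢ (q ℕ.^ j)) ≋ ((f ^ˢ (q ℕ.^ j)) ⊞ (g ^ˢ (q ℕ.^ j)))
  ^q^-distrib-⊞ j f g = ≡.subst (λ m → ((f ⊞ g) ^ˢ m) ≋ ((f ^ˢ m) ⊞ (g ^ˢ m))) (q^j≡ j)
    (Frobenius.^p^k-distrib-+ seriesRing pr (characteristicˢ {p} p⋆1≈0) (suc k ℕ.* j) f g)

  ^q^-distrib-+ᴾ : ∀ j f g → (f 𝒫.+ g) 𝒫.^ (q ℕ.^ j) 𝒫.≈ f 𝒫.^ (q ℕ.^ j) 𝒫.+ g 𝒫.^ (q ℕ.^ j)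
  ^q^-distrib-+ᴾ j f g = ≡.subst (λ m → (f 𝒫.+ g) 𝒫.^ m 𝒫.≈ f 𝒫.^ m 𝒫.+ g 𝒫.^ m) (q^j≡ j)
    (Frobenius.^p^k-distrib-+ polyRing pr (characteristicᴾ {p} p⋆1≈0) (suc k ℕ.* j) f g)

  ^q^-fixes : ∀ j a → a ^ (q ℕ.^ j) ≈ a
  ^q^-fixes zero    a = *-identityʳ a
  ^q^-fixes (suc j) a = trans (sym (^-assocʳ a q (q ℕ.^ j))) (trans (^-congˡ (q ℕ.^ j) (fermat a)) (^q^-fixes j a))

  q^>0 : ∀ j → 0 < q ℕ.^ j
  q^>0 j = ℕₚ.≤-trans (s≤s z≤n) (n<m^n j 2≤q)

  -- Factorisation

  Z : ℕ → Poly
  Z m = Y 𝒫.^ (q ℕ.^ m) 𝒫.- Y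

  Z+Y : ∀ m → Z m 𝒫.+ Y 𝒫.≈ Y 𝒫.^ (q ℕ.^ m)
  Z+Y m = 𝒫.trans (𝒫.+-assoc _ _ _) (𝒫.trans (𝒫.+-congˡ (𝒫.-‿inverseˡ Y)) (𝒫.+-identityʳ _))

  ∣-+ : ∀ {B f g} → B ∣ f → B ∣ g → B ∣ f 𝒫.+ g
  ∣-+ {B} (Q , eq) (Q′ , eq′) = Q 𝒫.+ Q′ , 𝒫.trans (𝒫.distribʳ B Q Q′) (𝒫.+-cong eq eq′)

  ∣-^ : ∀ {B f} n → 0 < n → B ∣ f → B ∣ f 𝒫.^ n
  ∣-^ {B} {f} (suc n) _ B∣f = ∣ʳ-respʳ-≈ (𝒫.*-comm _ f) (x∣ʳy⇒x∣ʳzy (f 𝒫.^ n) B∣f)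

  -- Frobenius with exponent `N = q^(t b)`, applied to `Y^(q^b) = Z b + Y`, gives
  -- `Z (b + t b) = (Z b)^N + Z (t b)`.
  Z-multiple : ∀ b t → Z b ∣ Z (t ℕ.* b)
  Z-multiple b zero = 𝒫.0# , 𝒫.trans (𝒫.zeroˡ _) (𝒫.sym (𝒫.trans (𝒫.+-congʳ (𝒫.*-identityʳ Y)) (𝒫.-‿inverseʳ Y)))
  Z-multiple b (suc t) = ∣ʳ-respʳ-≈ (𝒫.sym expansion) (∣-+ (∣-^ N (q^>0 (t ℕ.* b)) ∣ʳ-refl) (Z-multiple b t))
    where
    N = q ℕ.^ (t ℕ.* b)
    M = q ℕ.^ b
    expansion : Z (b ℕ.+ t ℕ.* b) 𝒫.≈ Z b 𝒫.^ N 𝒫.+ Z (t ℕ.* b)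
    expansion = begin
      Y 𝒫.^ (q ℕ.^ (b ℕ.+ t ℕ.* b)) 𝒫.- Y ≡⟨ ≡.cong (λ e → Y 𝒫.^ e 𝒫.- Y) (ℕₚ.^-distribˡ-+-* q b (t ℕ.* b)) ⟩
      Y 𝒫.^ (M ℕ.* N) 𝒫.- Y ≈⟨ 𝒫.+-congʳ (𝒫.^-assocʳ Y M N) ⟨
      (Y 𝒫.^ M) 𝒫.^ N 𝒫.- Y ≈⟨ 𝒫.+-congʳ (𝒫.^-congˡ N (𝒫.sym (Z+Y b))) ⟩
      (Z b 𝒫.+ Y) 𝒫.^ N 𝒫.- Y ≈⟨ 𝒫.+-congʳ (^q^-distrib-+ᴾ (t ℕ.* b) (Z b) Y) ⟩
      Z b 𝒫.^ N 𝒫.+ Y 𝒫.^ N 𝒫.- Y ≈⟨ 𝒫.+-assoc _ _ _ ⟩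
      Z b 𝒫.^ N 𝒫.+ Z (t ℕ.* b) ∎

  irreducible∣Z : ∀ {b B} → Irreducible b B → B ∣ Z b
  irreducible∣Z {b} {B} irr = difference (Y^q^b~Y irr)
    where
    difference : Congruent B (Y 𝒫.^ (q ℕ.^ b)) Y → B ∣ Z b
    difference (congruent T eq) = T , 𝒫.sym (𝒫.trans (𝒫.+-congʳ (𝒫.trans eq (𝒫.+-comm Y _)))
          (𝒫.trans (𝒫.+-assoc _ _ _) (𝒫.trans (𝒫.+-congˡ (𝒫.-‿inverseʳ Y)) (𝒫.+-identityʳ _))))

  degree-unique : ∀ {m n f} → HasDegree m f → HasDegree n f → m ≡ n
  degree-unique {f = f} hm hn = ℕₚ.≤-antisym (ℕₚ.≤-pred (degree-< {f = f} hm (proj₁ hn))) (ℕₚ.≤-pred (degree-< {f = f} hn (proj₁ hm)))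

  -- A divisor of least positive degree is irreducible. Whether a divisor of smaller positive degree
  -- exists is not decided, so excluded middle is applied to it under double negation.
  irreducible-divisor : ∀ n f → HasDegree n f → 0 < n → ¬ ¬ (∃[ b ] ∃[ B ] (Irreducible b B × B ∣ f))
  irreducible-divisor = <-rec HasIrreducibleDivisor step
    where
    HasIrreducibleDivisor : ℕ → Set (c ⊔ ℓ)
    HasIrreducibleDivisor n = ∀ f → HasDegree n f → 0 < n → ¬ ¬ (∃[ b ] ∃[ B ] (Irreducible b B × B ∣ f))
    step : ∀ n → (∀ {m} → m < n → HasIrreducibleDivisor m) → HasIrreducibleDivisor n
    step n rec f hf 0<n none = ¬¬-excluded-middle {A = ∃[ g ] ∃[ m ] (g ∣ f × HasDegree m g × 0 < m × m < n)} λ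
      { (yes (g , m , g∣f , hg , 0<m , m<n)) →
          rec m<n g hg 0<m λ { (b , B , irr , B∣g) → none (b , B , irr , ∣ʳ-trans B∣g g∣f) }
      ; (no minimal) → none (n , f , record
          { hasDegree = hf ; positive = 0<n
          ; minimal   = λ { g g∣f zero hg m<n → ≡.refl
                          ; g g∣f (suc m) hg m<n → contradiction (g , suc m , g∣f , hg , s≤s z≤n , m<n) minimal } } , ∣ʳ-refl) }

  -- Degrees are listed without repetition, since `Z m` contains all irreducibles of degree dividing
  -- `m` at once. Multiplicities are absorbed by the exponent `n`, which is at least the number of
  -- irreducible factors.
  record Factored (n : ℕ) (f : Poly) : Set (c ⊔ ℓ) where
    field
      degrees  : List ℕ
      unique   : Unique degrees
      positive : All (0 <_) degrees
      total    : ListAction.sum degrees ≤ n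
      ∣Z^      : ∀ m → All (_∣ℕ m) degrees → f ∣ Z m 𝒫.^ n

  factor : ∀ n f → HasDegree n f → ¬ ¬ Factored n f
  factor = <-rec _ step
    where
    step : ∀ n → (∀ {m} → m < n → ∀ f → HasDegree m f → ¬ ¬ Factored m f) →
           ∀ f → HasDegree n f → ¬ ¬ Factored n f
    step zero rec f (d , f₀≉0) none = none record
      { degrees = [] ; unique = [] ; positive = [] ; total = z≤n
      ; ∣Z^ = λ m _ → C (f₀≉0 ⁻¹) , coefs λ i → trans (reflexive (≡.cong (λ h → h i) (coef-* (C _) f))) (trans (constant-⊛ _ (coef f) i) (at i)) }
      where
      at : ∀ i → (f₀≉0 ⁻¹) * coef f i ≈ 1ˢ i
      at zero    = ⁻¹-inverseˡ f₀≉0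
      at (suc i) = trans (*-congˡ (d (suc i) (s≤s z≤n))) (zeroʳ _)
    step n@(suc _) rec f hf none = irreducible-divisor n f hf (s≤s z≤n) λ
      { (b , B , irr , Q , QB≈f) → split-off b B irr Q QB≈f }
      where
      split-off : ∀ b B → Irreducible b B → ∀ Q → Q 𝒫.* B 𝒫.≈ f → _
      split-off b@(suc b′) B irr Q QB≈f with degree? Q
      ... | inj₁ Q≈0 = proj₂ hf (trans (coef-≈ (𝒫.trans (𝒫.sym QB≈f) (𝒫.trans (𝒫.*-congʳ Q≈0) (𝒫.zeroˡ B))) n) (0ˢ≈0 n))
      ... | inj₂ (m , hQ) = rec m<n Q hQ λ fac → none (extend fac)
        where
        m+b≡n : m ℕ.+ b ≡ n
        m+b≡n = degree-unique {f = f} (degree-cong QB≈f (degree-* hQ (Irreducible.hasDegree irr))) hf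
        m<n : m < n
        m<n = ≡.subst (m <_) m+b≡n (ℕₚ.m<m+n m (s≤s z≤n))
        ∣Z^-* : ∀ t → Q ∣ Z t 𝒫.^ m → B ∣ Z t → f ∣ Z t 𝒫.^ n
        -- `Q` consumes `m` factors `Z t` and `B` one more; the remaining `b′ = b − 1` factors fill
        -- the exponent up to `n = m + b`.
        ∣Z^-* t (H , HQ≈) (G , GB≈) = Z t 𝒫.^ b′ 𝒫.* (H 𝒫.* G) , (begin
          Z t 𝒫.^ b′ 𝒫.* (H 𝒫.* G) 𝒫.* f ≈⟨ 𝒫.*-congˡ QB≈f ⟨
          Z t 𝒫.^ b′ 𝒫.* (H 𝒫.* G) 𝒫.* (Q 𝒫.* B)
            ≈⟨ solve 5 (λ z H G Q B → z :* (H :* G) :* (Q :* B) := (H :* Q) :* ((G :* B) :* z)) 𝒫.refl (Z t 𝒫.^ b′) H G Q B ⟩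
          (H 𝒫.* Q) 𝒫.* ((G 𝒫.* B) 𝒫.* Z t 𝒫.^ b′) ≈⟨ 𝒫.*-cong HQ≈ (𝒫.*-congʳ GB≈) ⟩
          Z t 𝒫.^ m 𝒫.* Z t 𝒫.^ b ≈⟨ 𝒫.^-homo-* (Z t) m b ⟨
          Z t 𝒫.^ (m ℕ.+ b) ≡⟨ ≡.cong (Z t 𝒫.^_) m+b≡n ⟩
          Z t 𝒫.^ n ∎)
          where open RingSolver 𝒫.commutativeSemiring using (solve; _:=_; _:*_)
        divides-power : ∀ t → Q ∣ Z t 𝒫.^ m → b ∣ℕ t → f ∣ Z t 𝒫.^ n
        divides-power t Q∣ (divides s ≡.refl) = ∣Z^-* t Q∣ (∣ʳ-trans (irreducible∣Z irr) (Z-multiple b s))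
        extend : Factored m Q → Factored n f
        extend fac with b ∈? Factored.degrees fac
        ... | yes b∈ = record
          { degrees = degrees ; unique = unique ; positive = positive
          ; total = ℕₚ.≤-trans total (ℕₚ.<⇒≤ m<n)
          ; ∣Z^ = λ t all → divides-power t (∣Z^ t all) (All.lookup all b∈) }
          where open Factored fac
        ... | no b∉ = record
          { degrees = b ∷ degrees ; unique = ¬Any⇒All¬ degrees b∉ ∷ unique ; positive = s≤s z≤n ∷ positive
          ; total = ≡.subst (b ℕ.+ ListAction.sum degrees ≤_) (≡.trans (ℕₚ.+-comm b m) m+b≡n) (ℕₚ.+-monoʳ-≤ b total)
          ; ∣Z^ = λ { t (b∣t ∷ all) → divides-power t (∣Z^ t all) b∣t } }
          where open Factored fac
      split-off zero B irr Q QB≈f = contradiction (Irreducible.positive irr) λ ()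

-- Iterated Cartier operators on polynomials and their periods

module Periods {c ℓ q} (K : FiniteField c ℓ q) {p k} (pr : Prime p) (q≡p^k : q ≡ p ℕ.^ suc k) where

  open FiniteField K using (commutativeRing; 1≉0)
  open CommutativeRing commutativeRing hiding (zero)
  open FiniteFieldProperties K
  open PolynomialRing commutativeRing
  open FieldPolynomials K
  open PrimePowerField K {p} {k} pr q≡p^k
  open Exponentiation commutativeSemiring using (_^_)
  open SetoidReasoning 𝒫.setoid

  index≥ : ∀ j n → n ≤ pred (q ℕ.^ j) ℕ.+ n ℕ.* q ℕ.^ j
  index≥ j n = ℕₚ.≤-trans (ℕₚ.m≤m*n n (q ℕ.^ j) {{ℕ.>-nonZero (q^>0 j)}}) (ℕₚ.m≤n+m _ (pred (q ℕ.^ j)))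

  pred[q^]<q^ : ∀ j → pred (q ℕ.^ j) < q ℕ.^ j
  pred[q^]<q^ j = ℕₚ.≤-reflexive (ℕₚ.suc-pred (q ℕ.^ j) {{ℕ.>-nonZero (q^>0 j)}})

  opaque
    unfolding _+ᴾ_

    -- The residue class is the last one, `q^j − 1`. Last classes are compatible with composition,
    -- as `(q^j − 1) + (q^i − 1) q^j = q^(i+j) − 1`; this gives `Λ-Λ`.
    Λ : ℕ → Poly → Poly
    Λ j f = poly {section (q ℕ.^ j) (pred (q ℕ.^ j)) (coef f)} {bound f} λ n b≤n → degree f _ (ℕₚ.≤-trans b≤n (index≥ j n))

    coef-Λ : ∀ j f n → coef (Λ j f) n ≡ coef f (pred (q ℕ.^ j) ℕ.+ n ℕ.* q ℕ.^ j)
    coef-Λ j f n = ≡.refl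

    Λ-cong : ∀ j {f g} → f 𝒫.≈ g → Λ j f 𝒫.≈ Λ j g
    Λ-cong j f≈g = coefs λ n → coef-≈ f≈g _

    Λ-+ : ∀ j f g → Λ j (f 𝒫.+ g) 𝒫.≈ Λ j f 𝒫.+ Λ j g
    Λ-+ j f g = coefs λ n → refl

    Λ-scale : ∀ j a f → Λ j (C a 𝒫.* f) 𝒫.≈ C a 𝒫.* Λ j f
    Λ-scale j a f = coefs λ n → trans (constant-⊛ a (coef f) _) (sym (constant-⊛ a _ n))

    Λ-^ : ∀ j f g → Λ j (f 𝒫.* g 𝒫.^ (q ℕ.^ j)) 𝒫.≈ Λ j f 𝒫.* g
    Λ-^ j f g = coefs λ n → trans (⊛-congˡ (λ i → reflexive (≡.cong (λ h → h i) (coef-^ g (q ℕ.^ j)))) _)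
      (section-⊛-^ (q ℕ.^ j) (^q^-fixes j) (^q^-distrib-⊞ j) (pred (q ℕ.^ j)) (pred[q^]<q^ j) (coef f) (coef g) n)

    Λ-Λ : ∀ i j f → Λ i (Λ j f) 𝒫.≈ Λ (i ℕ.+ j) f
    Λ-Λ i j f = coefs λ n → trans (section-section (q ℕ.^ j) (q ℕ.^ i) (pred (q ℕ.^ j)) (pred (q ℕ.^ i)) (coef f) n)
      (reflexive (≡.cong₂ (λ M r → coef f (r ℕ.+ n ℕ.* M)) (≡.sym (ℕₚ.^-distribˡ-+-* q i j))
        (≡.trans (pred-* (q ℕ.^ i) (q ℕ.^ j) (q^>0 i) (q^>0 j)) (≡.cong pred (≡.sym (ℕₚ.^-distribˡ-+-* q i j))))))

    Λ-degree : ∀ j b f → Deg< (pred (q ℕ.^ j) ℕ.+ b ℕ.* q ℕ.^ j) (coef f) → Deg< b (coef (Λ j f))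
    Λ-degree j b f d n b≤n = d _ (ℕₚ.+-monoʳ-≤ (pred (q ℕ.^ j)) (ℕₚ.*-monoˡ-≤ (q ℕ.^ j) b≤n))

  ^-pred : ∀ n (f : Poly) → 0 < n → f 𝒫.* f 𝒫.^ pred n 𝒫.≈ f 𝒫.^ n
  ^-pred (suc n) f _ = 𝒫.refl

  degree-0 : ∀ {b f} → f 𝒫.≈ 𝒫.0# → Deg< b (coef f)
  degree-0 f≈0 n _ = trans (coef-≈ f≈0 n) (0ˢ≈0 n)

  degree-1 : HasDegree 0 𝒫.1#
  degree-1 = deg-constant 1# , 1≉0

  degree-^ : ∀ {b B} n → HasDegree b B → HasDegree (n ℕ.* b) (B 𝒫.^ n)
  degree-^ zero    hB = degree-1
  degree-^ {B = B} (suc n) hB = degree-* hB (degree-^ n hB)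

  degree-Y : HasDegree 1 Y
  degree-Y = deg-X , 1≉0

  degree-Z : ∀ m → 0 < m → HasDegree (q ℕ.^ m) (Z m)
  degree-Z m@(suc m′) _ =
      ≡.subst (Deg< (suc M)) (≡.sym coef-Z) (deg-+ (proj₁ Y^M) (deg-neg {f = X _} (deg-mono {f = X _} (s≤s 1≤M) deg-X)))
    , λ eq → proj₂ Y^M (trans (sym (trans (+-congˡ (trans (-‿cong XM≈0) ε⁻¹≈ε)) (+-identityʳ _)))
        (trans (reflexive (≡.cong (λ h → h M) (≡.sym coef-Z))) eq))
    where
    M = q ℕ.^ m
    open GroupProperties +-group using (ε⁻¹≈ε)
    2≤M : 2 ≤ M
    2≤M = ℕₚ.≤-trans 2≤q (ℕₚ.m≤m*n q (q ℕ.^ m′) {{ℕ.>-nonZero (q^>0 m′)}})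
    1≤M : 1 ≤ M
    1≤M = ℕₚ.<⇒≤ 2≤M
    Y^M : HasDegree M (Y 𝒫.^ M)
    Y^M = ≡.subst (λ d → HasDegree d (Y 𝒫.^ M)) (ℕₚ.*-identityʳ M) (degree-^ M degree-Y)
    XM≈0 : X commutativeRing M ≈ 0#
    XM≈0 = deg-X M 2≤M
    coef-Z : coef (Z m) ≡ coef (Y 𝒫.^ M) ⊞ ⊟ X commutativeRing
    coef-Z = ≡.trans (coef-+ _ _) (≡.cong (coef (Y 𝒫.^ M) ⊞_) (coef-neg Y))

  -- With M = q^m and W = Y^M − Y the operator f ↦ Λ(f W^(M−1)) is the identity
  -- in degrees < M: since Y = Y^M − W, it commutes with multiplication by Y as
  -- long as Λ f = 0, and comparing the two evaluations at f = Y^M shows that it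
  -- fixes 1.

  module _ (m : ℕ) (0<m : 0 < m) where

    private
      M = q ℕ.^ m
      W = Z m

      T : Poly → Poly
      T f = Λ m (f 𝒫.* W 𝒫.^ pred M)

      T-cong : ∀ {f g} → f 𝒫.≈ g → T f 𝒫.≈ T g
      T-cong f≈g = Λ-cong m (𝒫.*-congʳ f≈g)

      T-Y : ∀ f → T (Y 𝒫.* f) 𝒫.+ Λ m f 𝒫.* W 𝒫.≈ Y 𝒫.* T f
      T-Y f = begin
        T (Y 𝒫.* f) 𝒫.+ Λ m f 𝒫.* W ≈⟨ 𝒫.+-congˡ (Λ-^ m f W) ⟨
        T (Y 𝒫.* f) 𝒫.+ Λ m (f 𝒫.* W 𝒫.^ M) ≈⟨ Λ-+ m _ _ ⟨
        Λ m (Y 𝒫.* f 𝒫.* W 𝒫.^ pred M 𝒫.+ f 𝒫.* W 𝒫.^ M) ≈⟨ Λ-cong m rearranged ⟩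
        Λ m (f 𝒫.* W 𝒫.^ pred M 𝒫.* Y 𝒫.^ M) ≈⟨ Λ-^ m _ Y ⟩
        T f 𝒫.* Y ≈⟨ 𝒫.*-comm _ Y ⟩
        Y 𝒫.* T f ∎
        where
        open RingSolver 𝒫.commutativeSemiring using (solve; _:=_; _:+_; _:*_)
        rearranged : Y 𝒫.* f 𝒫.* W 𝒫.^ pred M 𝒫.+ f 𝒫.* W 𝒫.^ M 𝒫.≈ f 𝒫.* W 𝒫.^ pred M 𝒫.* Y 𝒫.^ M
        rearranged = begin
          Y 𝒫.* f 𝒫.* W 𝒫.^ pred M 𝒫.+ f 𝒫.* W 𝒫.^ M ≈⟨ 𝒫.+-congˡ (𝒫.*-congˡ (^-pred M W (q^>0 m))) ⟨
          Y 𝒫.* f 𝒫.* W 𝒫.^ pred M 𝒫.+ f 𝒫.* (W 𝒫.* W 𝒫.^ pred M)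
            ≈⟨ solve 4 (λ y f w d → y :* f :* d :+ f :* (w :* d) := f :* d :* (w :+ y)) 𝒫.refl Y f W (W 𝒫.^ pred M) ⟩
          f 𝒫.* W 𝒫.^ pred M 𝒫.* (W 𝒫.+ Y) ≈⟨ 𝒫.*-congˡ (Z+Y m) ⟩
          f 𝒫.* W 𝒫.^ pred M 𝒫.* Y 𝒫.^ M ∎

      T-Y-small : ∀ f → Deg< (pred M) (coef f) → T (Y 𝒫.* f) 𝒫.≈ Y 𝒫.* T f
      T-Y-small f d = 𝒫.trans (𝒫.sym (𝒫.trans (𝒫.+-congˡ (𝒫.trans (𝒫.*-congʳ Λf≈0) (𝒫.zeroˡ W))) (𝒫.+-identityʳ _))) (T-Y f)
        where
        Λf≈0 : Λ m f 𝒫.≈ 𝒫.0#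
        Λf≈0 = Deg<0⇒≈0 (Λ-degree m 0 f (≡.subst (λ b → Deg< b (coef f)) (≡.sym (ℕₚ.+-identityʳ (pred M))) d))

      T-small : ∀ b f → b ≤ M → Deg< b (coef f) → T f 𝒫.≈ f 𝒫.* T 𝒫.1#
      T-small zero f b≤M d = 𝒫.trans (Deg<0⇒≈0 (Λ-degree m 0 _ (degree-0 (0* f≈0)))) (𝒫.sym (0* f≈0))
        where
        f≈0 : f 𝒫.≈ 𝒫.0#
        f≈0 = Deg<0⇒≈0 d
        0* : ∀ {f g} → f 𝒫.≈ 𝒫.0# → f 𝒫.* g 𝒫.≈ 𝒫.0#
        0* f≈0 = 𝒫.trans (𝒫.*-congʳ f≈0) (𝒫.zeroˡ _)
      T-small (suc b) f b<M d = begin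
        T f ≈⟨ Λ-cong m (𝒫.trans (𝒫.*-congʳ (splitᴾ f)) (𝒫.distribʳ _ _ _)) ⟩
        Λ m (C a 𝒫.* D 𝒫.+ Y 𝒫.* f′ 𝒫.* D) ≈⟨ Λ-+ m _ _ ⟩
        Λ m (C a 𝒫.* D) 𝒫.+ T (Y 𝒫.* f′) ≈⟨ 𝒫.+-cong (Λ-scale m a D) (T-Y-small f′ (deg-mono {f = coef f′} (ℕₚ.pred-mono-≤ b<M) df′)) ⟩
        C a 𝒫.* Λ m D 𝒫.+ Y 𝒫.* T f′ ≈⟨ 𝒫.+-cong (𝒫.*-congˡ (Λ-cong m (𝒫.sym (𝒫.*-identityˡ D)))) (𝒫.*-congˡ (T-small b f′ (ℕₚ.<⇒≤ b<M) df′)) ⟩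
        C a 𝒫.* T 𝒫.1# 𝒫.+ Y 𝒫.* (f′ 𝒫.* T 𝒫.1#) ≈⟨ 𝒫.+-congˡ (𝒫.*-assoc Y f′ _) ⟨
        C a 𝒫.* T 𝒫.1# 𝒫.+ Y 𝒫.* f′ 𝒫.* T 𝒫.1# ≈⟨ 𝒫.distribʳ _ _ _ ⟨
        (C a 𝒫.+ Y 𝒫.* f′) 𝒫.* T 𝒫.1# ≈⟨ 𝒫.*-congʳ (splitᴾ f) ⟨
        f 𝒫.* T 𝒫.1# ∎
        where
        D : Poly
        D = W 𝒫.^ pred M
        a : Carrier
        a = coef f 0
        f′ : Poly
        f′ = tailᴾ f
        df′ : Deg< b (coef f′)
        df′ = deg-tail {f = coef f} d

      1+pred : suc (pred M) ≡ M
      1+pred = ℕₚ.suc-pred M {{ℕ.>-nonZero (q^>0 m)}}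

      Y^[M-1] : HasDegree (pred M) (Y 𝒫.^ pred M)
      Y^[M-1] = ≡.subst (λ d → HasDegree d (Y 𝒫.^ pred M)) (ℕₚ.*-identityʳ (pred M)) (degree-^ (pred M) degree-Y)

      Y^-top : ∀ n → coef (Y 𝒫.^ n) n ≈ 1#
      Y^-top n = trans (reflexive (≡.cong₂ (λ f i → f i) (coef-^ Y n) (≡.sym (ℕₚ.*-identityʳ n))))
        (trans (^-top n deg-X) (1^ n))
        where
        1^ : ∀ n → 1# ^ n ≈ 1#
        1^ zero    = refl
        1^ (suc n) = trans (*-identityˡ _) (1^ n)

      ΛY^[M-1]≈1 : Λ m (Y 𝒫.^ pred M) 𝒫.≈ 𝒫.1#
      ΛY^[M-1]≈1 = coefs λ n → trans (reflexive (coef-Λ m _ n)) (at n)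
        where
        at : ∀ n → coef (Y 𝒫.^ pred M) (pred M ℕ.+ n ℕ.* M) ≈ 1ˢ n
        at zero    = trans (reflexive (≡.cong (coef (Y 𝒫.^ pred M)) (ℕₚ.+-identityʳ (pred M)))) (Y^-top (pred M))
        at (suc n) = proj₁ Y^[M-1] _ (≡.subst (_≤ pred M ℕ.+ (M ℕ.+ n ℕ.* M)) (≡.sym 1+pred)
          (ℕₚ.≤-trans (ℕₚ.m≤m+n M (n ℕ.* M)) (ℕₚ.m≤n+m _ (pred M))))

      T1≈1 : T 𝒫.1# 𝒫.≈ 𝒫.1#
      -- The chain is `T-Y` at `Y^(M−1)`. Linearity in degrees below `M` makes the right side
      -- `Y^M u = u (W + Y)`; taking `Y^M` out of `Λ` as an `M`-th power makes the left side
      -- `Y u + W`. Hence `u W = W`.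
      T1≈1 = *-cancelʳ (degree-Z m 0<m) (T 𝒫.1#) 𝒫.1# (∙-cancelˡ (Y 𝒫.* T 𝒫.1#) _ _ (begin
        Y 𝒫.* u 𝒫.+ u 𝒫.* W ≈⟨ solve 3 (λ y u w → y :* u :+ u :* w := u :* (w :+ y)) 𝒫.refl Y u W ⟩
        u 𝒫.* (W 𝒫.+ Y) ≈⟨ 𝒫.*-congˡ (𝒫.trans (Z+Y m) (𝒫.sym (^-pred M Y (q^>0 m)))) ⟩
        u 𝒫.* (Y 𝒫.* Y 𝒫.^ pred M) ≈⟨ solve 3 (λ y u v → u :* (y :* v) := y :* (v :* u)) 𝒫.refl Y u (Y 𝒫.^ pred M) ⟩
        Y 𝒫.* (Y 𝒫.^ pred M 𝒫.* u) ≈⟨ 𝒫.*-congˡ (T-small M (Y 𝒫.^ pred M) ℕₚ.≤-refl (≡.subst (λ b → Deg< b (coef (Y 𝒫.^ pred M))) 1+pred (proj₁ Y^[M-1]))) ⟨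
        Y 𝒫.* T (Y 𝒫.^ pred M) ≈⟨ T-Y (Y 𝒫.^ pred M) ⟨
        T (Y 𝒫.* Y 𝒫.^ pred M) 𝒫.+ Λ m (Y 𝒫.^ pred M) 𝒫.* W ≈⟨ 𝒫.+-cong (T-cong (^-pred M Y (q^>0 m))) (𝒫.*-congʳ ΛY^[M-1]≈1) ⟩
        T (Y 𝒫.^ M) 𝒫.+ 𝒫.1# 𝒫.* W ≈⟨ 𝒫.+-congʳ (Λ-cong m (𝒫.trans (𝒫.*-comm _ _) (𝒫.*-congʳ (𝒫.sym (𝒫.*-identityˡ _))))) ⟩
        Λ m (𝒫.1# 𝒫.* W 𝒫.^ pred M 𝒫.* Y 𝒫.^ M) 𝒫.+ 𝒫.1# 𝒫.* W ≈⟨ 𝒫.+-congʳ (𝒫.trans (Λ-^ m _ Y) (𝒫.*-comm u Y)) ⟩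
        Y 𝒫.* u 𝒫.+ 𝒫.1# 𝒫.* W ∎))
        where
        open RingSolver 𝒫.commutativeSemiring using (solve; _:=_; _:+_; _:*_)
        open GroupProperties 𝒫.+-group using (∙-cancelˡ)
        u : Poly
        u = T 𝒫.1#

    Λ-fixed : ∀ f → Deg< M (coef f) → Λ m (f 𝒫.* Z m 𝒫.^ pred M) 𝒫.≈ f
    Λ-fixed f d = 𝒫.trans (T-small M f ℕₚ.≤-refl d) (𝒫.trans (𝒫.*-congˡ T1≈1) (𝒫.*-identityʳ f))

  -- Orbits of f ↦ Λ(f A^(q−1))

  module _ (A : Poly) (E : ℕ → Poly) (step : ∀ i → E (suc i) 𝒫.≈ Λ 1 (E i 𝒫.* A 𝒫.^ pred (q ℕ.^ 1))) where

    open RingSolver 𝒫.commutativeSemiring using (solve; _:=_; _:*_)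

    pred-q^-+ : ∀ i j → pred (q ℕ.^ j) ℕ.+ pred (q ℕ.^ i) ℕ.* q ℕ.^ j ≡ pred (q ℕ.^ (i ℕ.+ j))
    pred-q^-+ i j = ≡.trans (pred-* (q ℕ.^ i) (q ℕ.^ j) (q^>0 i) (q^>0 j)) (≡.cong pred (≡.sym (ℕₚ.^-distribˡ-+-* q i j)))

    ^-pred-+ : ∀ (g : Poly) i j → g 𝒫.^ pred (q ℕ.^ j) 𝒫.* (g 𝒫.^ pred (q ℕ.^ i)) 𝒫.^ (q ℕ.^ j) 𝒫.≈ g 𝒫.^ pred (q ℕ.^ (i ℕ.+ j))
    ^-pred-+ g i j = begin
      g 𝒫.^ pred (q ℕ.^ j) 𝒫.* (g 𝒫.^ pred (q ℕ.^ i)) 𝒫.^ (q ℕ.^ j) ≈⟨ 𝒫.*-congˡ (𝒫.^-assocʳ g (pred (q ℕ.^ i)) (q ℕ.^ j)) ⟩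
      g 𝒫.^ pred (q ℕ.^ j) 𝒫.* g 𝒫.^ (pred (q ℕ.^ i) ℕ.* q ℕ.^ j) ≈⟨ 𝒫.^-homo-* g (pred (q ℕ.^ j)) (pred (q ℕ.^ i) ℕ.* q ℕ.^ j) ⟨
      g 𝒫.^ (pred (q ℕ.^ j) ℕ.+ pred (q ℕ.^ i) ℕ.* q ℕ.^ j) ≡⟨ ≡.cong (g 𝒫.^_) (pred-q^-+ i j) ⟩
      g 𝒫.^ pred (q ℕ.^ (i ℕ.+ j)) ∎

    -- Inside `Λ j` the factor `A^(q−1)` becomes its `q^j`-th power, and the exponents add up to
    -- `q^j − 1 + (q − 1) q^j = q^(j+1) − 1`.
    iterate : ∀ j → E j 𝒫.≈ Λ j (E 0 𝒫.* A 𝒫.^ pred (q ℕ.^ j))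
    iterate zero = 𝒫.sym (𝒫.trans (Λ-cong 0 (𝒫.*-identityʳ (E 0))) (coefs λ n → trans (reflexive (coef-Λ 0 (E 0) n)) (reflexive (≡.cong (coef (E 0)) (ℕₚ.*-identityʳ n)))))
    iterate (suc j) = begin
      E (suc j) ≈⟨ step j ⟩
      Λ 1 (E j 𝒫.* A 𝒫.^ pred (q ℕ.^ 1)) ≈⟨ Λ-cong 1 (𝒫.*-congʳ (iterate j)) ⟩
      Λ 1 (Λ j (E 0 𝒫.* A 𝒫.^ pred N) 𝒫.* A 𝒫.^ pred (q ℕ.^ 1)) ≈⟨ Λ-cong 1 (Λ-^ j _ _) ⟨
      Λ 1 (Λ j (E 0 𝒫.* A 𝒫.^ pred N 𝒫.* (A 𝒫.^ pred (q ℕ.^ 1)) 𝒫.^ N)) ≈⟨ Λ-Λ 1 j _ ⟩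
      Λ (suc j) (E 0 𝒫.* A 𝒫.^ pred N 𝒫.* (A 𝒫.^ pred (q ℕ.^ 1)) 𝒫.^ N) ≈⟨ Λ-cong (suc j) (𝒫.trans (𝒫.*-assoc (E 0) _ _) (𝒫.*-congˡ (^-pred-+ A 1 j))) ⟩
      Λ (suc j) (E 0 𝒫.* A 𝒫.^ pred (q ℕ.^ suc j)) ∎
      where N = q ℕ.^ j

    -- Both sides are compared after multiplication by G, where G A = W^Q.

    periodic-at : ∀ n m {a} → 0 < m → HasDegree a A → A ∣ Z m 𝒫.^ (q ℕ.^ n) → Deg< n (coef (E 0)) →
                  E (n ℕ.+ m) 𝒫.≈ E n
    periodic-at n m {a} 0<m hA (G , GA≈) d₀ = by-degree (degree? G)
      where
      Q = q ℕ.^ n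
      M = q ℕ.^ m
      W = Z m
      v = Λ n (E 0 𝒫.* G)
      hW : HasDegree (Q ℕ.* M) (W 𝒫.^ Q)
      hW = degree-^ Q (degree-Z m 0<m)

      -- `A^(N−1) G^N` equals `G (G A)^(N−1)`, so multiplying by `G` replaces the powers of `A` by
      -- powers of `W`, to which `Λ-^` and `Λ-fixed` apply.
      E-G : ∀ j → E j 𝒫.* G 𝒫.≈ Λ j ((E 0 𝒫.* G) 𝒫.* (W 𝒫.^ pred (q ℕ.^ j)) 𝒫.^ Q)
      E-G j = begin
        E j 𝒫.* G ≈⟨ 𝒫.*-congʳ (iterate j) ⟩
        Λ j (E 0 𝒫.* A 𝒫.^ pred N) 𝒫.* G ≈⟨ Λ-^ j _ G ⟨
        Λ j (E 0 𝒫.* A 𝒫.^ pred N 𝒫.* G 𝒫.^ N) ≈⟨ Λ-cong j (𝒫.*-congˡ (^-pred N G (q^>0 j))) ⟨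
        Λ j (E 0 𝒫.* A 𝒫.^ pred N 𝒫.* (G 𝒫.* G 𝒫.^ pred N))
          ≈⟨ Λ-cong j (solve 4 (λ e x g y → e :* x :* (g :* y) := e :* g :* (y :* x)) 𝒫.refl (E 0) (A 𝒫.^ pred N) G (G 𝒫.^ pred N)) ⟩
        Λ j (E 0 𝒫.* G 𝒫.* (G 𝒫.^ pred N 𝒫.* A 𝒫.^ pred N)) ≈⟨ Λ-cong j (𝒫.*-congˡ (𝒫.trans (𝒫.sym (𝒫.^-distrib-* G A (pred N))) (𝒫.^-congˡ (pred N) GA≈))) ⟩
        Λ j (E 0 𝒫.* G 𝒫.* (W 𝒫.^ Q) 𝒫.^ pred N) ≈⟨ Λ-cong j (𝒫.*-congˡ (𝒫.trans (𝒫.^-assocʳ W Q (pred N)) (𝒫.trans (𝒫.reflexive (≡.cong (W 𝒫.^_) (ℕₚ.*-comm Q (pred N)))) (𝒫.sym (𝒫.^-assocʳ W (pred N) Q))))) ⟩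
        Λ j (E 0 𝒫.* G 𝒫.* (W 𝒫.^ pred N) 𝒫.^ Q) ∎
        where N = q ℕ.^ j

      En-G : E n 𝒫.* G 𝒫.≈ v 𝒫.* W 𝒫.^ pred Q
      En-G = 𝒫.trans (E-G n) (Λ-^ n _ _)

      -- `Λ n` extracts a `Q`-th power and leaves `v W^(MQ−1)`. As `MQ − 1 = (M − 1) + (Q − 1) M`,
      -- `Λ m` extracts `W^(Q−1)` and acts on `v W^(M−1)`, which it sends to `v`.
      En+m-G : Deg< M (coef v) → E (n ℕ.+ m) 𝒫.* G 𝒫.≈ v 𝒫.* W 𝒫.^ pred Q
      En+m-G dv = begin
        E (n ℕ.+ m) 𝒫.* G ≡⟨ ≡.cong (λ i → E i 𝒫.* G) (ℕₚ.+-comm n m) ⟩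
        E (m ℕ.+ n) 𝒫.* G ≈⟨ E-G (m ℕ.+ n) ⟩
        Λ (m ℕ.+ n) (E 0 𝒫.* G 𝒫.* (W 𝒫.^ pred (q ℕ.^ (m ℕ.+ n))) 𝒫.^ Q) ≈⟨ Λ-Λ m n _ ⟨
        Λ m (Λ n (E 0 𝒫.* G 𝒫.* (W 𝒫.^ pred (q ℕ.^ (m ℕ.+ n))) 𝒫.^ Q)) ≈⟨ Λ-cong m (Λ-^ n _ _) ⟩
        Λ m (v 𝒫.* W 𝒫.^ pred (q ℕ.^ (m ℕ.+ n))) ≡⟨ ≡.cong (λ i → Λ m (v 𝒫.* W 𝒫.^ pred (q ℕ.^ i))) (ℕₚ.+-comm m n) ⟩
        Λ m (v 𝒫.* W 𝒫.^ pred (q ℕ.^ (n ℕ.+ m))) ≈⟨ Λ-cong m (𝒫.trans (𝒫.*-congˡ (𝒫.sym (^-pred-+ W n m))) (𝒫.sym (𝒫.*-assoc v _ _))) ⟩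
        Λ m (v 𝒫.* W 𝒫.^ pred M 𝒫.* (W 𝒫.^ pred Q) 𝒫.^ M) ≈⟨ Λ-^ m _ _ ⟩
        Λ m (v 𝒫.* W 𝒫.^ pred M) 𝒫.* W 𝒫.^ pred Q ≈⟨ 𝒫.*-congʳ (Λ-fixed m 0<m v dv) ⟩
        v 𝒫.* W 𝒫.^ pred Q ∎

      by-degree : G 𝒫.≈ 𝒫.0# ⊎ ∃[ g ] HasDegree g G → E (n ℕ.+ m) 𝒫.≈ E n
      by-degree (inj₁ G≈0) = contradiction (trans (coef-≈ (𝒫.trans (𝒫.sym GA≈) (𝒫.trans (𝒫.*-congʳ G≈0) (𝒫.zeroˡ A))) (Q ℕ.* M)) (0ˢ≈0 (Q ℕ.* M))) (proj₂ hW)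
      by-degree (inj₂ (g , hG)) = *-cancelʳ hG (E (n ℕ.+ m)) (E n) (𝒫.trans (En+m-G dv) (𝒫.sym En-G))
        where
        g≤QM : g ≤ Q ℕ.* M
        g≤QM = ≡.subst (g ≤_) (degree-unique {f = W 𝒫.^ Q} (degree-cong GA≈ (degree-* hG hA)) hW) (ℕₚ.m≤m+n g a)
        -- `Λ n` lands below degree `M` when its argument has degree below `Q − 1 + M Q`. Here
        -- `g ≤ Q M` because `G A = W^Q`, and `n ≤ Q − 1` because `Q = q^n`.
        sufficient : g ℕ.+ n ≤ pred Q ℕ.+ M ℕ.* Q
        sufficient = ≡.subst (g ℕ.+ n ≤_) (≡.trans (≡.cong (ℕ._+ pred Q) (ℕₚ.*-comm Q M)) (ℕₚ.+-comm (M ℕ.* Q) (pred Q)))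
          (ℕₚ.+-mono-≤ g≤QM (ℕₚ.pred-mono-≤ (n<m^n n 2≤q)))
        dv : Deg< M (coef v)
        dv = Λ-degree n M (E 0 𝒫.* G) (deg-mono {f = coef (E 0 𝒫.* G)} sufficient
          (deg-cong (coef-≈ (𝒫.*-comm G (E 0))) (≡.subst (Deg< (g ℕ.+ n)) (≡.sym (coef-* G (E 0))) (deg-⊛ g (proj₁ hG) d₀))))

    periodic : ∀ n m {a} → 0 < m → HasDegree a A → A ∣ Z m 𝒫.^ (q ℕ.^ n) → Deg< n (coef (E 0)) →
               ∀ i → n ≤ i → E (i ℕ.+ m) 𝒫.≈ E i
    periodic n m 0<m hA A∣ d₀ i n≤i = ≡.subst (λ i → E (i ℕ.+ m) 𝒫.≈ E i) (ℕₚ.m∸n+n≡m n≤i) (go (i ℕ.∸ n))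
      where
      go : ∀ j → E (j ℕ.+ n ℕ.+ m) 𝒫.≈ E (j ℕ.+ n)
      go zero    = periodic-at n m 0<m hA A∣ d₀
      go (suc j) = 𝒫.trans (step _) (𝒫.trans (Λ-cong 1 (𝒫.*-congʳ (go j))) (𝒫.sym (step _)))

  -- `n` bounds the degree of the starting polynomial (and, in `period-exists`, that of `A`) and is
  -- also the preperiod.
  record Period (n : ℕ) (A : Poly) : Set (c ⊔ ℓ) where
    field
      period   : ℕ
      positive : 0 < period
      bounded  : period ℕ.* period ℕ.* 2 ℕ.^ n ≤ productConstant ℕ.* 3 ℕ.^ n
      recurrence : ∀ (E : ℕ → Poly) → (∀ i → E (suc i) 𝒫.≈ Λ 1 (E i 𝒫.* A 𝒫.^ pred (q ℕ.^ 1))) →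
                 Deg< n (coef (E 0)) → ∀ i → n ≤ i → E (i ℕ.+ period) 𝒫.≈ E i

  -- The period is the product of the listed degrees, hence a multiple of each. Since `a ≤ n < q^n`,
  -- the exponent of the factorisation can be raised from `a` to the power `q^n` that `periodic`
  -- asks for.
  period-exists : ∀ n {a A} → HasDegree a A → a ≤ n → ¬ ¬ Period n A
  period-exists n {a} {A} hA a≤n = ¬¬-map from-factors (factor a A hA)
    where
    from-factors : Factored a A → Period n A
    from-factors fac = record
      { period   = m
      ; positive = 0<m
      ; bounded  = product-bound n degrees unique (ℕₚ.≤-trans total a≤n)
      ; recurrence = Orbit }
      where
      open Factored fac renaming (positive to all-positive)
      m : ℕ
      m = ListAction.product degrees
      0<m : 0 < m
      0<m = product-positive all-positive
      a≤q^n : a ≤ q ℕ.^ n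
      a≤q^n = ℕₚ.≤-trans a≤n (ℕₚ.<⇒≤ (n<m^n n 2≤q))
      A∣Z^Q : A ∣ Z m 𝒫.^ (q ℕ.^ n)
      A∣Z^Q = ∣ʳ-respʳ-≈ (𝒫.trans (𝒫.sym (𝒫.^-homo-* (Z m) (q ℕ.^ n ℕ.∸ a) a)) (𝒫.reflexive (≡.cong (Z m 𝒫.^_) (ℕₚ.m∸n+n≡m a≤q^n))))
        (x∣ʳy⇒x∣ʳzy _ (∣Z^ m (All.tabulate ∈⇒∣product)))
      Orbit : ∀ E → (∀ i → E (suc i) 𝒫.≈ Λ 1 (E i 𝒫.* A 𝒫.^ pred (q ℕ.^ 1))) → Deg< n (coef (E 0)) →
              ∀ i → n ≤ i → E (i ℕ.+ m) 𝒫.≈ E i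
      Orbit E step = periodic A E step n m 0<m hA A∣Z^Q

-- A maximal set of inequivalent words is grown one word at a time; it is
-- closed under the transitions once no further word can be added.

module Closure {s r} {S : Set s} {q} (step : S → Fin q → S) (_~_ : S → S → Set r)
  (_~?_ : ∀ x y → Dec (x ~ y)) (~-sym : ∀ {x y} → x ~ y → y ~ x) (N : ℕ)
  (finite : ∀ {n} (v : Fin n → S) → (∀ {i j} → v i ~ v j → i ≡ j) → n ≤ N) (s₀ : S) where

  reach : List (Fin q) → S
  reach = foldl step s₀

  record Closed : Set (s ⊔ r) where
    field
      size     : ℕ
      word     : Fin size → List (Fin q)
      distinct : ∀ {i j} → reach (word i) ~ reach (word j) → i ≡ j
      start    : Fin size
      start-[] : word start ≡ []
      next     : ∀ i a → ∃[ j ] step (reach (word i)) a ~ reach (word j)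

  private
    grow : ∀ fuel n (word : Fin n → List (Fin q)) → (∀ {i j} → reach (word i) ~ reach (word j) → i ≡ j) →
           (start : Fin n) → word start ≡ [] → N < fuel ℕ.+ n → Closed
    grow zero n word distinct start start-[] N<n = contradiction (finite _ distinct) (ℕₚ.<⇒≱ N<n)
    grow (suc fuel) n word distinct start start-[] N< with Finₚ.all? (λ i → Finₚ.all? (λ a → Finₚ.any? (λ j → step (reach (word i)) a ~? reach (word j))))
    ... | yes next = record { size = n ; word = word ; distinct = distinct ; start = start ; start-[] = start-[] ; next = next }
    ... | no ¬next with Finₚ.¬∀⟶∃¬ n _ (λ i → Finₚ.all? (λ a → Finₚ.any? (λ j → step (reach (word i)) a ~? reach (word j)))) ¬next
    ... | i , ¬nextᵢ with Finₚ.¬∀⟶∃¬ q _ (λ a → Finₚ.any? (λ j → step (reach (word i)) a ~? reach (word j))) ¬nextᵢ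
    ... | a , new = grow fuel (suc n) word′ distinct′ (suc start) start-[] (≡.subst (N <_) (≡.sym (ℕₚ.+-suc fuel n)) N<)
      where
      word′ : Fin (suc n) → List (Fin q)
      word′ zero    = word i ∷ʳ a
      word′ (suc j) = word j
      new′ : ∀ j → ¬ reach (word i ∷ʳ a) ~ reach (word j)
      new′ j eq = new (j , ≡.subst (_~ reach (word j)) (foldl-∷ʳ step s₀ a (word i)) eq)
      distinct′ : ∀ {j l} → reach (word′ j) ~ reach (word′ l) → j ≡ l
      distinct′ {zero}  {zero}  eq = ≡.refl
      distinct′ {zero}  {suc l} eq = contradiction eq (new′ l)
      distinct′ {suc j} {zero}  eq = contradiction (~-sym eq) (new′ j)
      distinct′ {suc j} {suc l} eq = ≡.cong suc (distinct eq)

  -- Opaque, so that the search is not run while comparing types.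
  opaque
    closure : Closed
    closure = grow (suc N) 1 (λ _ → []) (λ { {zero} {zero} _ → ≡.refl }) zero ≡.refl
      (ℕₚ.m≤m+n (suc N) 1)

-- Minimisation of automata with finitely many codes of states

module Minimisation {o ℓ s} (O : Setoid o ℓ) {q : ℕ} {S : Set s}
  (_≟O_ : ∀ x y → Dec (Setoid._≈_ O x y))
  (step : S → Fin q → S) (output : S → Setoid.Carrier O) (s₀ : S)
  {N : ℕ} (code : S → Fin N)
  (code-step : ∀ {x y} a → code x ≡ code y → code (step x a) ≡ code (step y a))
  (code-output : ∀ {x y} → code x ≡ code y → Setoid._≈_ O (output x) (output y))
  (a : ℕ → Setoid.Carrier O)
  (generates : ∀ w → Setoid._≈_ O (output (foldl step s₀ w)) (a (fromDigits w))) where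

  open Setoid O renaming (Carrier to Output)

  -- Nerode equivalence. It quantifies over all words; `code` supplies a finite bisimulation that
  -- refines it.
  _≈ᴹ_ : S → S → Set ℓ
  x ≈ᴹ y = ∀ w → output (foldl step x w) ≈ output (foldl step y w)

  code⇒≈ᴹ : ∀ {x y} → code x ≡ code y → x ≈ᴹ y
  code⇒≈ᴹ eq []      = code-output eq
  code⇒≈ᴹ eq (d ∷ w) = code⇒≈ᴹ (code-step d eq) w

  private
    stepᴾ : S × S → Fin q → S × S
    stepᴾ (x , y) d = step x d , step y d

    _~_ : S × S → S × S → Set
    (x , y) ~ (x′ , y′) = code x ≡ code x′ × code y ≡ code y′

    ~-sym : ∀ {p p′} → p ~ p′ → p′ ~ p
    ~-sym (e , e′) = ≡.sym e , ≡.sym e′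

    finiteᴾ : ∀ {n} (v : Fin n → S × S) → (∀ {i j} → v i ~ v j → i ≡ j) → n ≤ N ℕ.* N
    finiteᴾ v distinct = Finₚ.injective⇒≤ {f = λ i → combine (code (proj₁ (v i))) (code (proj₂ (v i)))}
      λ eq → distinct (Finₚ.combine-injective _ _ _ _ eq)

    foldl-pair : ∀ w x y → foldl stepᴾ (x , y) w ≡ (foldl step x w , foldl step y w)
    foldl-pair []      x y = ≡.refl
    foldl-pair (d ∷ w) x y = foldl-pair w (step x d) (step y d)

  -- Run in parallel, `x` and `y` pass through at most `N²` pairs of codes. The words found by
  -- `closure` represent all reachable pairs, so it suffices to compare outputs there.
  _≈ᴹ?_ : ∀ x y → Dec (x ≈ᴹ y)
  x ≈ᴹ? y = decide (Finₚ.all? (λ i → output (proj₁ (reach (word i))) ≟O output (proj₂ (reach (word i)))))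
    where
    open Closure stepᴾ _~_ (λ p p′ → (code (proj₁ p) Finₚ.≟ code (proj₁ p′)) ×-dec (code (proj₂ p) Finₚ.≟ code (proj₂ p′)))
      ~-sym (N ℕ.* N) finiteᴾ (x , y)
    open Closed closure
    decide : Dec (∀ i → output (proj₁ (reach (word i))) ≈ output (proj₂ (reach (word i)))) → Dec (x ≈ᴹ y)
    decide (yes agree) = yes (bisimulation start (≡.subst (λ w → (x , y) ~ reach w) (≡.sym start-[]) (≡.refl , ≡.refl)))
      where
      bisimulation : ∀ {x y} i → (x , y) ~ reach (word i) → x ≈ᴹ y
      bisimulation i (ex , ey) []      = trans (code-output ex) (trans (agree i) (sym (code-output ey)))
      bisimulation i (ex , ey) (d ∷ w) with next i d
      ... | j , (ex′ , ey′) = bisimulation j (≡.trans (code-step d ex) ex′ , ≡.trans (code-step d ey) ey′) w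
    decide (no disagree) = no λ x≈y → disagree λ i →
      ≡.subst (λ p → output (proj₁ p) ≈ output (proj₂ p)) (≡.sym (foldl-pair (word i) x y)) (x≈y (word i))

  private
    finite : ∀ {n} (v : Fin n → S) → (∀ {i j} → v i ≈ᴹ v j → i ≡ j) → n ≤ N
    finite v distinct = Finₚ.injective⇒≤ {f = λ i → code (v i)} λ eq → distinct (code⇒≈ᴹ eq)

    open Closure step _≈ᴹ_ _≈ᴹ?_ (λ p w → sym (p w)) N finite s₀
    open Closed closure

  automaton : Automaton q Output
  automaton = record
    { size    = size
    ; initial = start
    ; step    = λ i d → proj₁ (next i d)
    ; output  = λ i → output (reach (word i)) }

  -- The form in which minimality enters the counting: any bound on the number of codes of reachable
  -- states bounds the size.
  states-distinct : ∀ i j → code (reach (word i)) ≡ code (reach (word j)) → i ≡ j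
  states-distinct i j eq = distinct (code⇒≈ᴹ eq)

  access : Fin size → Expansion q
  access = word

  automaton-run : ∀ w → Automaton.run automaton w ≈ output (foldl step s₀ w)
  automaton-run w = trans (simulate w start _ (λ u → reflexive (≡.cong (λ v → output (foldl step (reach v) u)) start-[]))) refl
    where
    simulate : ∀ w i x → reach (word i) ≈ᴹ x → Automaton.output automaton (foldl (Automaton.step automaton) i w) ≈ output (foldl step x w)
    simulate []      i x eq = eq []
    simulate (d ∷ w) i x eq = simulate w (proj₁ (next i d)) (step x d)
      (λ u → trans (sym (proj₂ (next i d) u)) (eq (d ∷ u)))

  minimal : IsMinimalAutomaton O automaton a
  minimal = (λ n ds eq _ → correct n ds eq) , correct , smallest
    where
    correct : UnaffectedByLeadingZeros O automaton a
    correct n ds ≡.refl = trans (automaton-run ds) (generates ds)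
    smallest : ∀ M → Generates O M a → UnaffectedByLeadingZeros O M a → size ≤ Automaton.size M
    -- A state of `M` determines the outputs after all continuations, so words leading to the same
    -- state of `M` are Nerode equivalent. A continued word may end in zero digits, whence the
    -- appeal to `unaffected`.
    smallest M _ unaffected = Finₚ.injective⇒≤ {f = λ i → foldl (Automaton.step M) (Automaton.initial M) (word i)}
      λ {i} {j} eq → distinct λ w → trans (sym (agrees i w)) (trans (reflexive (≡.cong (λ z → Automaton.output M (foldl (Automaton.step M) z w)) eq)) (agrees j w))
      where
      agrees : ∀ i w → Automaton.output M (foldl (Automaton.step M) (foldl (Automaton.step M) (Automaton.initial M) (word i)) w) ≈ output (foldl step (reach (word i)) w)
      agrees i w = trans (reflexive (≡.cong (Automaton.output M) (≡.sym (foldl-++ (Automaton.step M) _ (word i) w))))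
        (trans (unaffected _ (word i ++ w) ≡.refl) (trans (sym (generates (word i ++ w)))
          (reflexive (≡.cong output (foldl-++ step s₀ (word i) w)))))

-- Polynomials in two variables, as polynomials in y over the power series in x

module Bivariate {c ℓ} (R : CommutativeRing c ℓ) where

  open CommutativeRing R hiding (zero)
  open Degree R
  open SetoidReasoning setoid
  module L = Degree seriesRing

  Series₂ : Set c
  Series₂ = L.Series

  -- In a `Series₂` the outer index is the exponent of `y` and the inner one that of `x`, so that
  -- `F` can be substituted for `y` over the ring of series in `x`. A column is the coefficient of
  -- `x^i`.
  column : ℕ → Series₂ → Series
  column i f j = f j i

  Degˣ≤ : ℕ → Series₂ → Set ℓ
  Degˣ≤ a f = ∀ j → Deg< (suc a) (f j)

  column-0-⊛ : ∀ f g → column 0 (f L.⊛ g) ≋ (column 0 f ⊛ column 0 g)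
  column-0-⊛ f g zero = begin
    (f L.⊛ g) 0 0 ≈⟨ L.⊛-head f g 0 ⟩
    (f 0 ⊛ g 0) 0 ≈⟨ ⊛-head (f 0) (g 0) ⟩
    f 0 0 * g 0 0 ≈⟨ ⊛-head (column 0 f) (column 0 g) ⟨
    (column 0 f ⊛ column 0 g) 0 ∎
  column-0-⊛ f g (suc j) = begin
    (f L.⊛ g) (suc j) 0 ≈⟨ L.⊛-tail f g j 0 ⟩
    (f 0 ⊛ g (suc j)) 0 + (L.tail f L.⊛ g) j 0 ≈⟨ +-cong (⊛-head (f 0) (g (suc j))) (column-0-⊛ (L.tail f) g j) ⟩
    f 0 0 * g (suc j) 0 + (column 0 (L.tail f) ⊛ column 0 g) j ≈⟨ ⊛-tail (column 0 f) (column 0 g) j ⟨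
    (column 0 f ⊛ column 0 g) (suc j) ∎

  column-0-^ : ∀ n f → column 0 (f L.^ˢ n) ≋ (column 0 f ^ˢ n)
  column-0-^ zero    f zero    = refl
  column-0-^ zero    f (suc j) = refl
  column-0-^ (suc n) f j = trans (column-0-⊛ f _ j) (⊛-congˡ (column-0-^ n f) j)

  module _ {a b : ℕ} where

    degˣ-⊛ : ∀ f g → Degˣ≤ a f → Degˣ≤ b g → Degˣ≤ (a ℕ.+ b) (f L.⊛ g)
    degˣ-⊛ f g df dg zero = deg-cong (λ i → sym (L.⊛-head f g i)) (≡.subst (λ k → Deg< k (f 0 ⊛ g 0)) (ℕₚ.+-suc a b) (deg-⊛ a (df 0) (dg 0)))
    degˣ-⊛ f g df dg (suc j) = deg-cong (λ i → sym (L.⊛-tail f g j i)) (deg-+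
      (≡.subst (λ k → Deg< k (f 0 ⊛ g (suc j))) (ℕₚ.+-suc a b) (deg-⊛ a (df 0) (dg (suc j))))
      (degˣ-⊛ (L.tail f) g (λ j → df (suc j)) dg j))

    column-top-⊛ : ∀ f g → Degˣ≤ a f → Degˣ≤ b g → column (a ℕ.+ b) (f L.⊛ g) ≋ (column a f ⊛ column b g)
    column-top-⊛ f g df dg zero = begin
      (f L.⊛ g) 0 (a ℕ.+ b) ≈⟨ L.⊛-head f g (a ℕ.+ b) ⟩
      (f 0 ⊛ g 0) (a ℕ.+ b) ≈⟨ ⊛-top a (df 0) (dg 0) ⟩
      f 0 a * g 0 b ≈⟨ ⊛-head (column a f) (column b g) ⟨
      (column a f ⊛ column b g) 0 ∎
    column-top-⊛ f g df dg (suc j) = begin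
      (f L.⊛ g) (suc j) (a ℕ.+ b) ≈⟨ L.⊛-tail f g j (a ℕ.+ b) ⟩
      (f 0 ⊛ g (suc j)) (a ℕ.+ b) + (L.tail f L.⊛ g) j (a ℕ.+ b) ≈⟨ +-cong (⊛-top a (df 0) (dg (suc j))) (column-top-⊛ (L.tail f) g (λ j → df (suc j)) dg j) ⟩
      f 0 a * g (suc j) b + (column a (L.tail f) ⊛ column b g) j ≈⟨ ⊛-tail (column a f) (column b g) j ⟨
      (column a f ⊛ column b g) (suc j) ∎

  degˣ-^ : ∀ n {a} f → Degˣ≤ a f → Degˣ≤ (n ℕ.* a) (f L.^ˢ n)
  degˣ-^ zero    f df zero    = deg-constant 1#
  degˣ-^ zero    f df (suc j) = deg-0
  degˣ-^ (suc n) f df = degˣ-⊛ f (f L.^ˢ n) df (degˣ-^ n f df)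

  column-top-^ : ∀ n {a} f → Degˣ≤ a f → column (n ℕ.* a) (f L.^ˢ n) ≋ (column a f ^ˢ n)
  column-top-^ zero    f df zero    = refl
  column-top-^ zero    f df (suc j) = refl
  column-top-^ (suc n) f df j = trans (column-top-⊛ f (f L.^ˢ n) df (degˣ-^ n f df) j) (⊛-congˡ (column-top-^ n f df) j)

  ev-at-0 : ∀ b f x → x 0 ≈ 0# → L.ev (suc b) f x 0 ≈ f 0 0
  ev-at-0 b f x x₀≈0 = trans (+-congˡ (trans (⊛-head x _) (trans (*-congʳ x₀≈0) (zeroˡ _)))) (+-identityʳ _)

-- Values of `Polynomial₂` by Horner's scheme

module SumEvaluation {c ℓ} (R : CommutativeRing c ℓ) where

  open CommutativeRing R hiding (zero)
  open Degree R
  open SetoidReasoning setoid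
  open SemiringSum semiring using (sum; *-distribˡ-sum)
  open CommutativeMonoidSum +-commutativeMonoid using (sum-cong-≋)
  open Exponentiation commutativeSemiring using (_^_)

  sum≈ev : ∀ b f x → sum {b} (λ j → f (toℕ j) * x ^ toℕ j) ≈ ev b f x
  sum≈ev zero    f x = refl
  sum≈ev (suc b) f x = +-cong (*-identityʳ _) (begin
    sum {b} (λ j → f (suc (toℕ j)) * (x * x ^ toℕ j))
      ≈⟨ sum-cong-≋ {b} (λ j → trans (sym (*-assoc _ _ _)) (trans (*-congʳ (*-comm _ x)) (*-assoc _ _ _))) ⟩
    sum {b} (λ j → x * (f (suc (toℕ j)) * x ^ toℕ j))
      ≈⟨ *-distribˡ-sum x (λ j → f (suc (toℕ {b} j)) * x ^ toℕ j) ⟨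
    x * sum {b} (λ j → f (suc (toℕ j)) * x ^ toℕ j)
      ≈⟨ *-congˡ (sum≈ev b (tail f) x) ⟩
    x * ev b (tail f) x ∎)

module EvaluationOfSeries {c ℓ} (R : CommutativeRing c ℓ) where

  open CommutativeRing R hiding (zero)
  open Bivariate R
  open Degree R
  open Exponentiation (CommutativeRing.commutativeSemiring seriesRing) using (_^_)
  open SemiringSum Sˢ.semiring using (sum; *-distribʳ-sum; sum-cong-≋)
  open CommutativeMonoidSum Sˢ.+-commutativeMonoid using (∑-comm)
  open Polynomial₂
  open SetoidReasoning Sˢ.setoid

  ev-constant-X : ∀ b f → Deg< b f → L.ev b (λ i → constant R (f i)) (X R) ≋ f
  ev-constant-X zero    f d n = trans (0ˢ≈0 n) (sym (d n z≤n))
  ev-constant-X (suc b) f d n = trans (+-congˡ (trans (⊛-congˡ (ev-constant-X b (tail f) (deg-tail {f = f} d)) n) (X-⊛ (tail f) n)))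
                                      (sym (split f n))

  opaque
    unfolding _⊛_

    evalSeries-unfold : ∀ P s t → evalSeries R P s t ≡
      sum {bound P} (λ i → sum {bound P} (λ j → (constant R (coeff P (toℕ i) (toℕ j)) ⊛ s ^ toℕ i) ⊛ t ^ toℕ j))
    evalSeries-unfold P s t = ≡.refl

  -- Exchanging the sums collects the coefficient of each power of `F`, which `ev-constant-X`
  -- identifies as a series in `x`; the sum over `j` is then Horner's scheme over the series ring.
  evalSeries≋ev : ∀ P F → evalSeries R P (X R) F ≋ L.ev (bound P) (λ j i → coeff P i j) F
  evalSeries≋ev P F = begin
    evalSeries R P (X R) F
      ≡⟨ evalSeries-unfold P (X R) F ⟩
    sum {b} (λ i → sum {b} (λ j → (constant R (coeff P (toℕ i) (toℕ j)) ⊛ X R ^ toℕ i) ⊛ F ^ toℕ j))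
      ≈⟨ ∑-comm {b} {b} (λ i j → (constant R (coeff P (toℕ i) (toℕ j)) ⊛ X R ^ toℕ i) ⊛ F ^ toℕ j) ⟩
    sum {b} (λ j → sum {b} (λ i → (constant R (coeff P (toℕ i) (toℕ j)) ⊛ X R ^ toℕ i) ⊛ F ^ toℕ j))
      ≈⟨ sum-cong-≋ {b} (λ j → Sˢ.sym (*-distribʳ-sum {b} (F ^ toℕ j) (λ i → constant R (coeff P (toℕ i) (toℕ j)) ⊛ X R ^ toℕ i))) ⟩
    sum {b} (λ j → sum {b} (λ i → constant R (coeff P (toℕ i) (toℕ j)) ⊛ X R ^ toℕ i) ⊛ F ^ toℕ j)
      ≈⟨ sum-cong-≋ {b} (λ j → Sˢ.*-congʳ {F ^ toℕ j} (Sˢ.trans {j = L.ev b (λ i → constant R (coeff P i (toℕ j))) (X R)}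
           (SumEvaluation.sum≈ev seriesRing b (λ i → constant R (coeff P i (toℕ j))) (X R))
           (ev-constant-X b (λ i → coeff P i (toℕ j)) (λ i → vanishesˣ P i (toℕ j))))) ⟩
    sum {b} (λ j → (λ i → coeff P i (toℕ j)) ⊛ F ^ toℕ j)
      ≈⟨ SumEvaluation.sum≈ev seriesRing b (λ j i → coeff P i j) F ⟩
    L.ev b (λ j i → coeff P i j) F ∎
    where b = bound P

module EvaluationAtOrigin {c ℓ} (R : CommutativeRing c ℓ) where

  open CommutativeRing R hiding (zero)
  open Exponentiation commutativeSemiring using (_^_)
  open SemiringSum semiring using (sum-cong-≋; sum-replicate-zero)
  open Polynomial₂

  eval-origin : ∀ P → coeff P 0 0 ≈ 0# → eval R P 0# 0# ≈ 0#
  eval-origin P c≈0 = trans (sum-cong-≋ {b} (λ i → trans (sum-cong-≋ {b} (λ j → term (toℕ i) (toℕ j))) (sum-replicate-zero b))) (sum-replicate-zero b)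
    where
    b = bound P
    term : ∀ i j → (coeff P i j * 0# ^ i) * 0# ^ j ≈ 0#
    term zero    zero    = trans (*-congʳ (trans (*-congʳ c≈0) (zeroˡ _))) (zeroˡ _)
    term zero    (suc j) = trans (*-congˡ (zeroˡ _)) (zeroʳ _)
    term (suc i) j       = trans (*-congʳ (trans (*-congˡ (zeroˡ _)) (zeroʳ _))) (zeroˡ _)

-- Eventually periodic sequences of series

module PeriodicSequences {c ℓ} (R : CommutativeRing c ℓ) where

  open CommutativeRing R hiding (zero)
  open SeriesRing R

  Periodic : ℕ → ℕ → (ℕ → Series) → Set ℓ
  Periodic N m e = ∀ i → N ≤ i → e (i ℕ.+ m) ≋ e i

  periodic-* : ∀ {N m e} → Periodic N m e → ∀ t → Periodic N (t ℕ.* m) e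
  periodic-* {e = e} per zero i N≤i j = reflexive (≡.cong (λ k → e k j) (ℕₚ.+-identityʳ i))
  periodic-* {m = m} {e} per (suc t) i N≤i j = trans
    (reflexive (≡.cong (λ k → e k j) (≡.sym (ℕₚ.+-assoc i m (t ℕ.* m)))))
    (trans (periodic-* {e = e} per t (i ℕ.+ m) (ℕₚ.≤-trans N≤i (ℕₚ.m≤m+n i m)) j) (per i N≤i j))

  periodic-% : ∀ {N m′ e} → Periodic N (suc m′) e → ∀ i i′ → N ≤ i → N ≤ i′ →
               i % suc m′ ≡ i′ % suc m′ → e i ≋ e i′
  periodic-% {N} {m′} {e} per i i′ N≤i N≤i′ eq j = trans (canonical i N≤i)
    (trans (reflexive (≡.cong (λ r → e (r ℕ.+ N ℕ.* m) j) eq)) (sym (canonical i′ N≤i′)))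
    where
    m = suc m′
    -- Adding `N` periods keeps the common representative `i % m + N * m` at or beyond the
    -- preperiod.
    canonical : ∀ i → N ≤ i → e i j ≈ e (i % m ℕ.+ N ℕ.* m) j
    canonical i N≤i = trans (sym (periodic-* {e = e} per N i N≤i j))
      (trans (reflexive (≡.cong (λ k → e k j) index))
        (periodic-* {e = e} per (i / m) (i % m ℕ.+ N ℕ.* m) (ℕₚ.≤-trans (ℕₚ.m≤m*n N m) (ℕₚ.m≤n+m _ (i % m))) j))
      where
      index : i ℕ.+ N ℕ.* m ≡ i % m ℕ.+ N ℕ.* m ℕ.+ i / m ℕ.* m
      index = ≡.trans (≡.cong (ℕ._+ N ℕ.* m) (m≡m%n+[m/n]*n i m))
        (≡.trans (ℕₚ.+-assoc (i % m) _ _) (≡.trans (≡.cong (i % m ℕ.+_) (ℕₚ.+-comm (i / m ℕ.* m) (N ℕ.* m))) (≡.sym (ℕₚ.+-assoc (i % m) _ _))))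

record PeriodBound (N m : ℕ) : Set where
  constructor periodBound
  field
    0<m : 0 < m
    m²≤ : m ℕ.* m ℕ.* 2 ℕ.^ N ≤ productConstant ℕ.* 3 ℕ.^ N

module SeriesPeriods {c ℓ n} (K : FiniteField c ℓ (suc n)) {p k} (pr : Prime p) (q≡p^k : suc n ≡ p ℕ.^ suc k) where

  open FiniteField K using (commutativeRing)
  open CommutativeRing commutativeRing hiding (zero)
  open PolynomialRing commutativeRing
  open FieldPolynomials K using (HasDegree; degree?; degree-<)
  open Periods K {p} {k} pr q≡p^k
  open PeriodicSequences commutativeRing

  private
    q = suc n

  -- The result on polynomials, restated for bare coefficient sequences. A nonzero coefficient
  -- guarantees that `A` has a degree, of which only the bound `N` is known.
  series-period : ∀ N A j → Deg< (suc N) A → ¬ A j ≈ 0# →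
    ¬ ¬ (∃[ m ] (PeriodBound N m × (∀ (e : ℕ → Series) → (∀ i → Deg< N (e i)) →
      (∀ i → e (suc i) ≋ section q n (e i ⊛ (A ^ˢ n))) → Periodic N m e)))
  series-period N A j dA Aⱼ≉0 = by-degree (degree? Aᴾ)
    where
    Aᴾ : Poly
    Aᴾ = poly dA
    extract : Period N Aᴾ → _
    extract per = period , periodBound positive bounded , λ e de step i N≤i j →
      coef-≈ (recurrence (λ i → poly (de i)) (λ i → coefs λ j → trans (step i j) (sym (Λ-step (poly (de i)) j))) (de 0) i N≤i) j
      where
      open Period per
      Λ-step : ∀ E j → coef (Λ 1 (E 𝒫.* Aᴾ 𝒫.^ pred (q ℕ.^ 1))) j ≈ section q n (coef E ⊛ (A ^ˢ n)) j
      Λ-step E j = reflexive (begin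
        coef (Λ 1 (E 𝒫.* Aᴾ 𝒫.^ r)) j ≡⟨ coef-Λ 1 _ j ⟩
        coef (E 𝒫.* Aᴾ 𝒫.^ r) (r ℕ.+ j ℕ.* q ℕ.^ 1) ≡⟨ ≡.cong (λ f → f (r ℕ.+ j ℕ.* q ℕ.^ 1)) (coef-* E (Aᴾ 𝒫.^ r)) ⟩
        (coef E ⊛ coef (Aᴾ 𝒫.^ r)) (r ℕ.+ j ℕ.* q ℕ.^ 1) ≡⟨ ≡.cong (λ f → (coef E ⊛ f) (r ℕ.+ j ℕ.* q ℕ.^ 1)) (coef-^ Aᴾ r) ⟩
        (coef E ⊛ (A ^ˢ r)) (r ℕ.+ j ℕ.* q ℕ.^ 1) ≡⟨ ≡.cong (λ M → (coef E ⊛ (A ^ˢ pred M)) (pred M ℕ.+ j ℕ.* M)) (ℕₚ.*-identityʳ q) ⟩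
        (coef E ⊛ (A ^ˢ n)) (n ℕ.+ j ℕ.* q) ∎)
        where
        open ≡.≡-Reasoning
        r : ℕ
        r = pred (q ℕ.^ 1)
    by-degree : (Aᴾ 𝒫.≈ 𝒫.0# ⊎ ∃[ a ] HasDegree a Aᴾ) → _
    by-degree (inj₁ A≈0) = contradiction (trans (coef-≈ A≈0 j) (0ˢ≈0 j)) Aⱼ≉0
    by-degree (inj₂ (a , hA)) = ¬¬-map extract (period-exists N {a} {Aᴾ} hA (ℕₚ.≤-pred (degree-< {f = Aᴾ} hA dA)))

-- States and transitions of a Furstenberg series

module Furstenberg {c ℓ n} (K : FiniteField c ℓ (suc n)) {p k} (pr : Prime p) (q≡p^k : suc n ≡ p ℕ.^ suc k)
  (P : Polynomial₂ (FiniteField.commutativeRing K))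
  (condition : FurstenbergCondition (FiniteField.commutativeRing K) P)
  {h d′ : ℕ} (degreeˣ : HasDegreeˣ (FiniteField.commutativeRing K) P h)
  (degreeʸ : HasDegreeʸ (FiniteField.commutativeRing K) P (suc d′))
  (F : PowerSeries (FiniteField.commutativeRing K))
  (furstenberg : IsFurstenbergSeries (FiniteField.commutativeRing K) P F) where

  open FiniteField K using (commutativeRing)
  open CommutativeRing commutativeRing hiding (zero)
  open FiniteFieldProperties K
  open Degree commutativeRing
  open Bivariate commutativeRing
  open PrimePowerField K {p} {k} pr q≡p^k using (^q^-distrib-⊞; p⋆1≈0)
  open Polynomial₂
  open Multiples semiring using () renaming (_×_ to _⋆_)

  private
    q d : ℕ
    q = suc n
    d = suc d′

  module 𝐋 where
    open PolynomialRing (SeriesRing.seriesRing commutativeRing) public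
    open Evaluation (SeriesRing.seriesRing commutativeRing) public
    open Characteristic (SeriesRing.seriesRing commutativeRing) public
  open 𝐋 using (module 𝒫; poly; coefs; _⟨_⟩)

  P₂ : Series₂
  P₂ j i = coeff P i j

  P₂-degree : L.Deg< (suc d) P₂
  P₂-degree j d<j i = trans (proj₂ degreeʸ i j d<j) (sym (0ˢ≈0 i))

  P₂-degreeˣ : Degˣ≤ h P₂
  P₂-degreeˣ j i h<i = proj₂ degreeˣ i j h<i

  P₁ : 𝐋.Poly
  P₁ = poly P₂-degree

  F₀≈0 : F 0 ≈ 0#
  F₀≈0 = proj₁ furstenberg

  P⟨F⟩≈0 : P₁ ⟨ F ⟩ ≋ 0ˢ
  P⟨F⟩≈0 = Sˢ.trans {j = L.ev (bound P) P₂ F}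
    (𝐋.⟨⟩-bound (bound P) P₁ F (λ j b≤j i → trans (vanishesʸ P i j b≤j) (sym (0ˢ≈0 i))))
    (Sˢ.trans {j = evalSeries commutativeRing P (X commutativeRing) F}
      (Sˢ.sym (EvaluationOfSeries.evalSeries≋ev commutativeRing P F)) (proj₂ furstenberg))

  c₀₁≉0 : ¬ coeff P 0 1 ≈ 0#
  c₀₁≉0 eq = proj₂ condition (EvaluationAtOrigin.eval-origin commutativeRing (∂ʸ commutativeRing P) (trans (+-identityʳ _) eq))

  H : 𝐋.Poly
  H = 𝐋.quotient P₁ F

  ∂P : Series
  ∂P = H ⟨ F ⟩

  -- As `F` has no constant term, evaluation at `F` followed by `x = 0` keeps only the term of
  -- exponent 0. This is applied to `H` and then to its lowest coefficient, itself a value at `F`.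
  ∂P₀≈c₀₁ : ∂P 0 ≈ coeff P 0 1
  ∂P₀≈c₀₁ = trans (𝐋.⟨⟩-bound (suc d) H F (𝐋.degree H) 0)
    (trans (ev-at-0 d (𝐋.coef H) F F₀≈0) (ev-at-0 d (λ j → P₂ (suc j)) F F₀≈0))

  ∂P₀≉0 : ¬ ∂P 0 ≈ 0#
  ∂P₀≉0 eq = c₀₁≉0 (trans (sym ∂P₀≈c₀₁) eq)

  -- A state stands for the series S(x, F) / ∂P/∂y(x, F).

  record State : Set (c ⊔ ℓ) where
    constructor state
    field
      entry    : Series₂
      entry-y  : L.Deg< d entry
      entry-x  : Degˣ≤ h entry

  open State public

  toPoly : State → 𝐋.Poly
  toPoly S = poly (entry-y S)

  Represents : State → Series → Set ℓ
  Represents S g = (∂P ⊛ g) ≋ toPoly S ⟨ F ⟩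

  timesPower : State → Series₂
  timesPower S = entry S L.⊛ (P₂ L.^ˢ n)

  -- A factor of degree `m` times the `n`-th power of another has degree `m + n m = m q`, which a
  -- section cuts back to `m`; this keeps the degree bounds of states invariant.
  m*q≡ : ∀ m → m ℕ.* q ≡ m ℕ.+ n ℕ.* m
  m*q≡ m = ≡.trans (ℕₚ.*-suc m n) (≡.cong (m ℕ.+_) (ℕₚ.*-comm m n))

  timesPower-y : ∀ S → L.Deg< (suc (d′ ℕ.+ n ℕ.* d)) (timesPower S)
  timesPower-y S = ≡.subst (λ b → L.Deg< b (timesPower S)) (ℕₚ.+-suc d′ (n ℕ.* d)) (L.deg-⊛ d′ (entry-y S) (L.deg-^ n P₂-degree))

  timesPower-x : ∀ S → Degˣ≤ (h ℕ.+ n ℕ.* h) (timesPower S)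
  timesPower-x S = degˣ-⊛ (entry S) (P₂ L.^ˢ n) (entry-x S) (degˣ-^ n P₂ P₂-degreeˣ)

  transition : State → Fin q → State
  transition S r = state (λ j i → timesPower S (n ℕ.+ j ℕ.* q) (toℕ r ℕ.+ i ℕ.* q)) y-bound x-bound
    where
    y-bound : L.Deg< d (λ j i → timesPower S (n ℕ.+ j ℕ.* q) (toℕ r ℕ.+ i ℕ.* q))
    y-bound j d≤j i = trans (timesPower-y S (n ℕ.+ j ℕ.* q) (ℕₚ.≤-trans (ℕₚ.≤-reflexive (≡.sym (m*q≡ d)))
      (ℕₚ.≤-trans (ℕₚ.*-monoˡ-≤ q d≤j) (ℕₚ.m≤n+m _ n))) _) (trans (0ˢ≈0 (toℕ r ℕ.+ i ℕ.* q)) (sym (0ˢ≈0 i)))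
    x-bound : Degˣ≤ h (λ j i → timesPower S (n ℕ.+ j ℕ.* q) (toℕ r ℕ.+ i ℕ.* q))
    x-bound j i h<i = timesPower-x S (n ℕ.+ j ℕ.* q) (toℕ r ℕ.+ i ℕ.* q)
      (ℕₚ.≤-trans (s≤s (ℕₚ.≤-trans (ℕₚ.≤-reflexive (≡.sym (m*q≡ h))) (ℕₚ.m≤n+m _ n)))
        (ℕₚ.≤-trans (ℕₚ.*-monoˡ-≤ q h<i) (ℕₚ.m≤n+m _ (toℕ r))))

  _≃_ : State → State → Set ℓ
  S ≃ S′ = ∀ j i → entry S j i ≈ entry S′ j i

  transition-cong : ∀ {S S′} r → S ≃ S′ → transition S r ≃ transition S′ r
  transition-cong r eq j i = L.⊛-congʳ eq _ _

  private
    frobenius : ∀ f g → ((f ⊞ g) ^ˢ q) ≋ ((f ^ˢ q) ⊞ (g ^ˢ q))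
    frobenius f g = ≡.subst (λ m → ((f ⊞ g) ^ˢ m) ≋ ((f ^ˢ m) ⊞ (g ^ˢ m))) (ℕₚ.*-identityʳ q) (^q^-distrib-⊞ 1 f g)

    frobeniusᴾ : ∀ f g → (f 𝒫.+ g) 𝒫.^ q 𝒫.≈ f 𝒫.^ q 𝒫.+ g 𝒫.^ q
    frobeniusᴾ f g = ≡.subst (λ m → (f 𝒫.+ g) 𝒫.^ m 𝒫.≈ f 𝒫.^ m 𝒫.+ g 𝒫.^ m) (≡.sym q≡p^k)
      (Frobenius.^p^k-distrib-+ 𝐋.polyRing pr (𝐋.characteristicᴾ {p} (Characteristic.characteristicˢ commutativeRing {p} p⋆1≈0)) (suc k) f g)

  cartier : ∀ r → r < q → ∀ f g → section q r (f ⊛ (g ^ˢ q)) ≋ (section q r f ⊛ g)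
  cartier = section-⊛-^ q fermat frobenius

  -- At each step of Horner's scheme `cartier` moves the `q`-th power `F^q` out of the section as
  -- `F`.
  section-ev : ∀ r → r < q → ∀ b f → section q r (L.ev b f (F ^ˢ q)) ≋ L.ev b (λ j → section q r (f j)) F
  section-ev r r<q zero    f i = trans (0ˢ≈0 (r ℕ.+ i ℕ.* q)) (sym (0ˢ≈0 i))
  section-ev r r<q (suc b) f i = +-congˡ (begin
    section q r ((F ^ˢ q) ⊛ e) i ≈⟨ section-cong q r (⊛-comm (F ^ˢ q) e) i ⟩
    section q r (e ⊛ (F ^ˢ q)) i ≈⟨ cartier r r<q e F i ⟩
    (section q r e ⊛ F) i ≈⟨ ⊛-comm (section q r e) F i ⟩
    (F ⊛ section q r e) i ≈⟨ ⊛-congˡ (section-ev r r<q b (L.tail f)) i ⟩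
    (F ⊛ L.ev b (λ j → section q r (f (suc j))) F) i ∎)
    where
    open SetoidReasoning setoid
    e : Series
    e = L.ev b (L.tail f) (F ^ˢ q)

  opaque
    unfolding 𝐋.residue

    residue≋ev : ∀ N → 𝐋.residue n frobeniusᴾ F N ≋ L.ev (𝐋.bound N) (L.section q n (𝐋.coef N)) (F ^ˢ q)
    residue≋ev N = 𝐋.⟨⟩-bound (𝐋.bound N) (𝐋.sectionᴾ q n N) (F ^ˢ q) (𝐋.degree (𝐋.sectionᴾ q n N))

  -- By `cartier`, `∂P` times the section of `g` is the section of `g ∂P^q = S(F) ∂P^(q−1)`. By
  -- `residue-power` this series is the residue of `S P^(q−1)`, a polynomial expression in `F^q`,
  -- and `section-ev` turns `F^q` into `F`.
  transition-represents : ∀ {S g} r → Represents S g → Represents (transition S r) (section q (toℕ r) g)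
  transition-represents {S} {g} r rep = begin
    ∂P ⊛ section q ρ g ≈⟨ ⊛-comm ∂P _ ⟩
    section q ρ g ⊛ ∂P ≈⟨ cartier ρ ρ<q g ∂P ⟨
    section q ρ (g ⊛ (∂P ^ˢ q)) ≈⟨ section-cong q ρ power ⟩
    section q ρ (𝐋.residue n frobeniusᴾ F N) ≈⟨ section-cong q ρ (residue≋ev N) ⟩
    section q ρ (L.ev b (L.section q n (𝐋.coef N)) (F ^ˢ q)) ≈⟨ section-ev ρ ρ<q b _ ⟩
    L.ev b (λ j → section q ρ (𝐋.coef N (n ℕ.+ j ℕ.* q))) F ≈⟨ L.ev-cong b F (λ j i → coef-N (n ℕ.+ j ℕ.* q) (ρ ℕ.+ i ℕ.* q)) ⟩
    L.ev b (entry (transition S r)) F ≈⟨ 𝐋.⟨⟩-bound b (toPoly (transition S r)) F b-degree ⟨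
    toPoly (transition S r) ⟨ F ⟩ ∎
    where
    open SetoidReasoning Sˢ.setoid
    ρ : ℕ
    ρ = toℕ r
    ρ<q : ρ < q
    ρ<q = Finₚ.toℕ<n r
    N : 𝐋.Poly
    N = toPoly S 𝒫.* P₁ 𝒫.^ n
    b : ℕ
    b = 𝐋.bound N
    coef-N : 𝐋.coef N L.≋ timesPower S
    coef-N j i = reflexive (≡.cong (λ f → f j i) (≡.trans (𝐋.coef-* (toPoly S) (P₁ 𝒫.^ n)) (≡.cong (entry S L.⊛_) (𝐋.coef-^ P₁ n))))
    b-degree : L.Deg< b (entry (transition S r))
    b-degree j b≤j i = trans (sym (coef-N (n ℕ.+ j ℕ.* q) (ρ ℕ.+ i ℕ.* q)))
      (trans (𝐋.degree N (n ℕ.+ j ℕ.* q) (ℕₚ.≤-trans b≤j (ℕₚ.≤-trans (ℕₚ.m≤m*n j q) (ℕₚ.m≤n+m _ n))) _) (trans (0ˢ≈0 (ρ ℕ.+ i ℕ.* q)) (sym (0ˢ≈0 i))))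
    power : (g ⊛ (∂P ^ˢ q)) ≋ 𝐋.residue n frobeniusᴾ F N
    power = begin
      g ⊛ (∂P ⊛ (∂P ^ˢ n)) ≈⟨ ⊛-assoc g ∂P _ ⟨
      g ⊛ ∂P ⊛ (∂P ^ˢ n) ≈⟨ ⊛-congʳ (⊛-comm g ∂P) ⟩
      ∂P ⊛ g ⊛ (∂P ^ˢ n) ≈⟨ ⊛-congʳ rep ⟩
      toPoly S ⟨ F ⟩ ⊛ (∂P ^ˢ n) ≈⟨ 𝐋.residue-power n frobeniusᴾ F P₁ P⟨F⟩≈0 (toPoly S) ⟨
      𝐋.residue n frobeniusᴾ F N ∎

  -- y ∂P/∂y − d P, which agrees with y ∂P/∂y at y = F and has smaller degree in y

  initialState : State
  initialState = state (λ j i → j ⋆ coeff P i j - d ⋆ coeff P i j) y-bound x-bound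
    where
    open Characteristic commutativeRing using (⋆-0)
    open GroupProperties +-group using (x≈y⇒x∙y⁻¹≈ε)
    open Multiples semiring using (×-congʳ)
    vanish : ∀ j i → coeff P i j ≈ 0# → j ⋆ coeff P i j - d ⋆ coeff P i j ≈ 0#
    vanish j i eq = x≈y⇒x∙y⁻¹≈ε (trans (trans (×-congʳ j eq) (⋆-0 j)) (sym (trans (×-congʳ d eq) (⋆-0 d))))
    y-bound : L.Deg< d (λ j i → j ⋆ coeff P i j - d ⋆ coeff P i j)
    y-bound j d≤j i with ℕₚ.m≤n⇒m<n∨m≡n d≤j
    ... | inj₁ d<j    = trans (vanish j i (proj₂ degreeʸ i j d<j)) (sym (0ˢ≈0 i))
    ... | inj₂ ≡.refl = trans (-‿inverseʳ _) (sym (0ˢ≈0 i))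
    x-bound : Degˣ≤ h (λ j i → j ⋆ coeff P i j - d ⋆ coeff P i j)
    x-bound j i h<i = vanish j i (proj₂ degreeˣ i j h<i)

  initial-represents : Represents initialState F
  initial-represents = begin
    ∂P ⊛ F ≈⟨ ⊛-comm ∂P F ⟩
    F ⊛ ∂P ≈⟨ 𝐋.⟨⟩-θ P₁ F P⟨F⟩≈0 ⟨
    𝐋.θᴾ P₁ ⟨ F ⟩ ≈⟨ Sˢ.+-identityʳ _ ⟨
    𝐋.θᴾ P₁ ⟨ F ⟩ ⊞ 0ˢ ≈⟨ Sˢ.+-congˡ {𝐋.θᴾ P₁ ⟨ F ⟩} (Sˢ.trans {j = D ⊛ 0ˢ} (Sˢ.sym (Sˢ.zeroʳ D)) (⊛-congˡ (Sˢ.sym P⟨F⟩≈0))) ⟩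
    𝐋.θᴾ P₁ ⟨ F ⟩ ⊞ (D ⊛ P₁ ⟨ F ⟩) ≈⟨ Sˢ.+-congˡ {𝐋.θᴾ P₁ ⟨ F ⟩} (𝐋.⟨⟩-scale D P₁ F) ⟨
    𝐋.θᴾ P₁ ⟨ F ⟩ ⊞ (𝐋.C D 𝒫.* P₁) ⟨ F ⟩ ≈⟨ 𝐋.⟨⟩-+ (𝐋.θᴾ P₁) (𝐋.C D 𝒫.* P₁) F ⟨
    (𝐋.θᴾ P₁ 𝒫.+ 𝐋.C D 𝒫.* P₁) ⟨ F ⟩ ≈⟨ 𝐋.⟨⟩-cong F (coefs (λ j i → coefficient j i)) ⟩
    toPoly initialState ⟨ F ⟩ ∎
    where
    open SetoidReasoning Sˢ.setoid
    open Multiples semiring using (×-assoc-*; ×-congʳ)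
    open RingProperties ring using (-‿distribˡ-*)
    D : Series
    D = constant commutativeRing (- (d ⋆ 1#))
    coefficient : ∀ j i → 𝐋.coef (𝐋.θᴾ P₁ 𝒫.+ 𝐋.C D 𝒫.* P₁) j i ≈ j ⋆ coeff P i j - d ⋆ coeff P i j
    coefficient j i = trans (reflexive (≡.cong (λ f → f j i) (≡.trans (𝐋.coef-+ (𝐋.θᴾ P₁) _) (≡.cong (𝐋.θ P₂ L.⊞_) (𝐋.coef-* (𝐋.C D) P₁)))))
      (+-cong (Characteristic.⋆ˢ-coef commutativeRing j (P₂ j) i)
        (trans (L.constant-⊛ D P₂ j i) (trans (constant-⊛ (- (d ⋆ 1#)) (P₂ j) i)
          (trans (sym (-‿distribˡ-* (d ⋆ 1#) _)) (-‿cong (trans (×-assoc-* d 1# _) (×-congʳ d (*-identityˡ _))))))))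

  reach : List (Fin q) → State
  reach = foldl transition initialState

  output : State → Carrier
  output S = (∂P₀≉0 ⁻¹) * entry S 0 0

  output-represents : ∀ {S g} → Represents S g → output S ≈ g 0
  output-represents {S} {g} rep = begin
    (∂P₀≉0 ⁻¹) * entry S 0 0 ≈⟨ *-congˡ (ev-at-0 d′ (entry S) F F₀≈0) ⟨
    (∂P₀≉0 ⁻¹) * L.ev d (entry S) F 0 ≈⟨ *-congˡ (𝐋.⟨⟩-bound d (toPoly S) F (entry-y S) 0) ⟨
    (∂P₀≉0 ⁻¹) * (toPoly S ⟨ F ⟩) 0 ≈⟨ *-congˡ (rep 0) ⟨
    (∂P₀≉0 ⁻¹) * (∂P ⊛ g) 0 ≈⟨ *-congˡ (⊛-head ∂P g) ⟩
    (∂P₀≉0 ⁻¹) * (∂P 0 * g 0) ≈⟨ *-assoc _ _ _ ⟨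
    (∂P₀≉0 ⁻¹) * ∂P 0 * g 0 ≈⟨ *-congʳ (⁻¹-inverseˡ ∂P₀≉0) ⟩
    1# * g 0 ≈⟨ *-identityˡ _ ⟩
    g 0 ∎
    where open SetoidReasoning setoid

  generates : ∀ w → output (reach w) ≈ F (fromDigits w)
  generates w = go w initialState F initial-represents
    where
    go : ∀ w S g → Represents S g → output (foldl transition S w) ≈ g (fromDigits w)
    go []      S g rep = output-represents {S} {g} rep
    go (r ∷ w) S g rep = go w (transition S r) (section q (toℕ r) g) (transition-represents {S} {g} r rep)

  block : ∀ {a b} → (Fin a → ℕ) → (Fin b → ℕ) → State → Fin ((q ℕ.^ b) ℕ.^ a)
  block rows columns S = funToFin (λ i → funToFin (λ j → to (entry S (columns j) (rows i))))

  block-injective : ∀ {a b} (rows : Fin a → ℕ) (columns : Fin b → ℕ) S S′ → block rows columns S ≡ block rows columns S′ →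
                    ∀ i j → entry S (columns j) (rows i) ≈ entry S′ (columns j) (rows i)
  block-injective rows columns S S′ eq i j = trans (sym (strictlyInverseʳ _))
    (trans (reflexive (≡.cong from (funToFin-injective _ _ (funToFin-injective _ _ eq i) j))) (strictlyInverseʳ _))

  code : State → Fin ((q ℕ.^ d) ℕ.^ suc h)
  code = block {suc h} {d} toℕ toℕ

  code-cong : ∀ {S S′} → S ≃ S′ → code S ≡ code S′
  code-cong eq = funToFin-cong {suc h} (λ i → funToFin-cong {d} (λ j → to-cong (eq (toℕ j) (toℕ i))))

  ≃-bounded : ∀ {S S′} → (∀ j i → j < d → i ≤ h → entry S j i ≈ entry S′ j i) → S ≃ S′
  ≃-bounded {S} {S′} eq j i with j ℕₚ.<? d | i ℕₚ.≤? h
  ... | yes j<d | yes i≤h = eq j i j<d i≤h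
  ... | no j≮d  | _       = trans (entry-y S j (ℕₚ.≮⇒≥ j≮d) i) (sym (entry-y S′ j (ℕₚ.≮⇒≥ j≮d) i))
  ... | yes _   | no i≰h  = trans (entry-x S j i (ℕₚ.≰⇒> i≰h)) (sym (entry-x S′ j i (ℕₚ.≰⇒> i≰h)))

  code-injective : ∀ {S S′} → code S ≡ code S′ → S ≃ S′
  code-injective {S} {S′} eq = ≃-bounded {S} {S′} λ j i j<d i≤h →
    ≡.subst₂ (λ j i → entry S j i ≈ entry S′ j i) (Finₚ.toℕ-fromℕ< j<d) (Finₚ.toℕ-fromℕ< (s≤s i≤h))
      (block-injective {suc h} {d} toℕ toℕ S S′ eq (fromℕ< (s≤s i≤h)) (fromℕ< j<d))

  -- Counting states

  open PeriodicSequences commutativeRing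
  open SeriesPeriods K {p} {k} pr q≡p^k
  open SetoidReasoning setoid

  orbit : ℕ → State
  orbit zero    = initialState
  orbit (suc i) = transition (orbit i) zero

  -- `S P^(q−1)` has degree at most `h q` in `x`, so its coefficient of `x^(h q)` is the product of
  -- the coefficients in the top degrees of the factors.
  column-top-step : ∀ S → column h (entry (transition S zero)) ≋ section q n (column h (entry S) ⊛ (column h P₂ ^ˢ n))
  column-top-step S j = begin
    timesPower S J (h ℕ.* q) ≡⟨ ≡.cong (timesPower S J) (m*q≡ h) ⟩
    timesPower S J (h ℕ.+ n ℕ.* h) ≈⟨ column-top-⊛ (entry S) (P₂ L.^ˢ n) (entry-x S) (degˣ-^ n P₂ P₂-degreeˣ) J ⟩
    (column h (entry S) ⊛ column (n ℕ.* h) (P₂ L.^ˢ n)) J ≈⟨ ⊛-congˡ (column-top-^ n P₂ P₂-degreeˣ) J ⟩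
    (column h (entry S) ⊛ (column h P₂ ^ˢ n)) J ∎
    where
    J : ℕ
    J = n ℕ.+ j ℕ.* q

  column-0-step : ∀ S → column 0 (entry (transition S zero)) ≋ section q n (column 0 (entry S) ⊛ (column 0 P₂ ^ˢ n))
  column-0-step S j = trans (column-0-⊛ (entry S) (P₂ L.^ˢ n) (n ℕ.+ j ℕ.* q))
    (⊛-congˡ (column-0-^ n P₂) (n ℕ.+ j ℕ.* q))

  -- In the top degree in `y` only leading coefficients meet, and the section in `x` has residue 0.
  -- Multiplying by `x^n` moves it to residue `n`, the class of `series-period`; the factor `x^n`
  -- joins the `n`-th power, whence the `shift`.
  row-top-step : ∀ S → entry (transition S zero) d′ ≋ section q n (entry S d′ ⊛ (shift (P₂ d) ^ˢ n))
  row-top-step S i = begin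
    timesPower S (n ℕ.+ d′ ℕ.* q) (i ℕ.* q) ≡⟨ ≡.cong (λ J → timesPower S J (i ℕ.* q)) index ⟩
    timesPower S (d′ ℕ.+ n ℕ.* d) (i ℕ.* q) ≈⟨ L.⊛-top d′ (entry-y S) (L.deg-^ n P₂-degree) (i ℕ.* q) ⟩
    (entry S d′ ⊛ (P₂ L.^ˢ n) (n ℕ.* d)) (i ℕ.* q) ≈⟨ ⊛-congˡ (L.^-top n P₂-degree) (i ℕ.* q) ⟩
    (entry S d′ ⊛ (P₂ d ^ˢ n)) (i ℕ.* q) ≡⟨ shiftBy-+ n _ (i ℕ.* q) ⟨
    shiftBy n (entry S d′ ⊛ (P₂ d ^ˢ n)) (n ℕ.+ i ℕ.* q) ≈⟨ ⊛-shiftBy n (entry S d′) (P₂ d ^ˢ n) _ ⟨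
    (entry S d′ ⊛ shiftBy n (P₂ d ^ˢ n)) (n ℕ.+ i ℕ.* q) ≈⟨ ⊛-congˡ (shift-^ n (P₂ d)) _ ⟨
    (entry S d′ ⊛ (shift (P₂ d) ^ˢ n)) (n ℕ.+ i ℕ.* q) ∎
    where
    index : n ℕ.+ d′ ℕ.* q ≡ d′ ℕ.+ n ℕ.* d
    index = ≡.trans (≡.cong (n ℕ.+_) (≡.trans (ℕₚ.*-suc d′ n) (≡.cong (d′ ℕ.+_) (ℕₚ.*-comm d′ n))))
      (≡.trans (≡.sym (ℕₚ.+-assoc n d′ _)) (≡.trans (≡.cong (ℕ._+ n ℕ.* d′) (ℕₚ.+-comm n d′))
        (≡.trans (ℕₚ.+-assoc d′ n _) (≡.cong (d′ ℕ.+_) (≡.sym (ℕₚ.*-suc n d′))))))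

  Low : State → Set ℓ
  Low S = ∀ j → entry S j h ≈ 0#

  low-transition : ∀ S r → Low S → Low (transition S r)
  low-suc : ∀ S r → Low (transition S (suc r))

  low-suc S r j = timesPower-x S (n ℕ.+ j ℕ.* q) (suc (toℕ r) ℕ.+ h ℕ.* q)
    (s≤s (ℕₚ.≤-trans (ℕₚ.≤-reflexive (≡.sym (m*q≡ h))) (ℕₚ.m≤n+m _ (toℕ r))))

  low-transition S zero    low j = trans (column-top-step S j) (⊛-vanish _ _ low _)
  low-transition S (suc r) low   = low-suc S r

  orbit-or-low : ∀ w → (∃[ i ] reach w ≡ orbit i) ⊎ Low (reach w)
  orbit-or-low w = go w 0
    where
    stays : ∀ w S → Low S → Low (foldl transition S w)
    stays []      S low = low
    stays (r ∷ w) S low = stays w (transition S r) (low-transition S r low)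
    go : ∀ w i → (∃[ i′ ] foldl transition (orbit i) w ≡ orbit i′) ⊎ Low (foldl transition (orbit i) w)
    go []          i = inj₁ (i , ≡.refl)
    go (zero ∷ w)  i = go w (suc i)
    go (suc r ∷ w) i = inj₂ (stays w (transition (orbit i) (suc r)) (low-suc (orbit i) r))

  ≃-by-columns : ∀ {S S′} → (∀ (j : Fin d) i → i ≤ h → entry S (toℕ j) i ≈ entry S′ (toℕ j) i) → S ≃ S′
  ≃-by-columns {S} {S′} eq = ≃-bounded {S} {S′} λ j i j<d i≤h →
    ≡.subst (λ j → entry S j i ≈ entry S′ j i) (Finₚ.toℕ-fromℕ< j<d) (eq (fromℕ< j<d) i i≤h)

  block-agree : ∀ {a b} (rows : Fin a → ℕ) (columns : Fin b → ℕ) S S′ → block rows columns S ≡ block rows columns S′ →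
                ∀ i j {x y} → rows i ≡ x → columns j ≡ y → entry S y x ≈ entry S′ y x
  block-agree rows columns S S′ eq i j ≡.refl ≡.refl = block-injective rows columns S S′ eq i j

  module _ {size} (word : Fin size → List (Fin q)) (distinct : ∀ i j → code (reach (word i)) ≡ code (reach (word j)) → i ≡ j) where

    module _ (N m′ : ℕ) {I} (interior : State → Fin I)
      (determined : ∀ i i′ → N ≤ i → N ≤ i′ → i % suc m′ ≡ i′ % suc m′ →
                    interior (orbit i) ≡ interior (orbit i′) → orbit i ≃ orbit i′) where

      private
        m = suc m′
        Class : Set
        Class = Fin ((q ℕ.^ d) ℕ.^ h) ⊎ (Fin N ⊎ Fin (m ℕ.* I))

        orbit-class : ∀ i → Dec (i < N) → Fin N ⊎ Fin (m ℕ.* I)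
        orbit-class i (yes i<N) = inj₁ (fromℕ< i<N)
        orbit-class i (no _)    = inj₂ (combine (fromℕ< (m%n<n i m)) (interior (orbit i)))

        orbit-class-injective : ∀ i i′ di di′ → orbit-class i di ≡ orbit-class i′ di′ → orbit i ≃ orbit i′
        orbit-class-injective i i′ (yes i<N) (yes i′<N) eq with Finₚ.fromℕ<-injective i i′ i<N i′<N (inj₁-injective eq)
        ... | ≡.refl = λ _ _ → refl
        orbit-class-injective i i′ (no i≮N) (no i′≮N) eq with Finₚ.combine-injective _ _ _ _ (inj₂-injective eq)
        ... | eq% , eqI = determined i i′ (ℕₚ.≮⇒≥ i≮N) (ℕₚ.≮⇒≥ i′≮N) (Finₚ.fromℕ<-injective _ _ _ _ eq%) eqI

        class : ∀ S → (∃[ i ] S ≡ orbit i) ⊎ Low S → Class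
        class S (inj₁ (i , _)) = inj₂ (orbit-class i (i ℕₚ.<? N))
        class S (inj₂ _)       = inj₁ (block {h} {d} toℕ toℕ S)

        class-injective : ∀ S S′ c c′ → class S c ≡ class S′ c′ → S ≃ S′
        class-injective S S′ (inj₁ (i , ≡.refl)) (inj₁ (i′ , ≡.refl)) eq = orbit-class-injective i i′ _ _ (inj₂-injective eq)
        class-injective S S′ (inj₂ low) (inj₂ low′) eq = ≃-by-columns {S} {S′} λ j i i≤h → at j i (ℕₚ.m≤n⇒m<n∨m≡n i≤h)
          where
          at : ∀ (j : Fin d) i → i < h ⊎ i ≡ h → entry S (toℕ j) i ≈ entry S′ (toℕ j) i
          at j i (inj₁ i<h)    = block-agree {h} {d} toℕ toℕ S S′ (inj₁-injective eq) (fromℕ< i<h) j (Finₚ.toℕ-fromℕ< i<h) ≡.refl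
          at j i (inj₂ ≡.refl) = trans (low (toℕ j)) (sym (low′ (toℕ j)))

        index : Class → Fin ((q ℕ.^ d) ℕ.^ h ℕ.+ (N ℕ.+ m ℕ.* I))
        index (inj₁ x) = join _ _ (inj₁ x)
        index (inj₂ y) = join ((q ℕ.^ d) ℕ.^ h) _ (inj₂ (join N (m ℕ.* I) y))

        join-injective : ∀ a b (x y : Fin a ⊎ Fin b) → join a b x ≡ join a b y → x ≡ y
        join-injective a b x y eq = ≡.trans (≡.sym (Finₚ.splitAt-join a b x)) (≡.trans (≡.cong (splitAt a) eq) (Finₚ.splitAt-join a b y))

        index-injective : ∀ x y → index x ≡ index y → x ≡ y
        index-injective (inj₁ x) (inj₁ y) eq = ≡.cong inj₁ (inj₁-injective (join-injective ((q ℕ.^ d) ℕ.^ h) (N ℕ.+ m ℕ.* I) (inj₁ x) (inj₁ y) eq))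
        index-injective (inj₂ x) (inj₂ y) eq = ≡.cong inj₂ (join-injective N (m ℕ.* I) x y (inj₂-injective (join-injective ((q ℕ.^ d) ℕ.^ h) _ (inj₂ (join N _ x)) (inj₂ (join N _ y)) eq)))
        index-injective (inj₁ x) (inj₂ y) eq = contradiction (join-injective ((q ℕ.^ d) ℕ.^ h) _ (inj₁ x) (inj₂ (join N _ y)) eq) λ ()
        index-injective (inj₂ x) (inj₁ y) eq = contradiction (join-injective ((q ℕ.^ d) ℕ.^ h) _ (inj₂ (join N _ x)) (inj₁ y) eq) λ ()

      -- A low state is told apart by its coefficients of `x^0` up to `x^(h−1)`. An orbit state is
      -- told apart by its index if that is below `N`, and otherwise by its index modulo `m` and its
      -- interior, by `determined`.
      size-bound : size ≤ (q ℕ.^ d) ℕ.^ h ℕ.+ (N ℕ.+ m ℕ.* I)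
      size-bound = Finₚ.injective⇒≤ {f = λ i → index (class (reach (word i)) (orbit-or-low (word i)))} λ {i} {j} eq →
        distinct i j (code-cong {reach (word i)} {reach (word j)}
          (class-injective (reach (word i)) (reach (word j)) (orbit-or-low (word i)) (orbit-or-low (word j)) (index-injective (class (reach (word i)) (orbit-or-low (word i))) (class (reach (word j)) (orbit-or-low (word j))) eq)))

    -- For d → ∞ and for q → ∞: the columns of x^0 and x^h are eventually periodic.

    size-bound-columns : ∀ h′ → h ≡ suc h′ → ¬ ¬ (∃[ m₀ ] ∃[ m₁ ] (PeriodBound d m₀ × PeriodBound d m₁ ×
      size ≤ (q ℕ.^ d) ℕ.^ h ℕ.+ (d ℕ.+ (m₀ ℕ.* m₁) ℕ.* (q ℕ.^ d) ℕ.^ h′)))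
    size-bound-columns h′ h≡ none =
      series-period d (column 0 P₂) 1 (column-degree 0) c₀₁≉0 λ { (m₀ , b₀ , periodic₀) →
      series-period d (column h P₂) (proj₁ (proj₁ degreeˣ)) (column-degree h) (proj₂ (proj₁ degreeˣ)) λ { (m₁ , b₁ , periodic₁) →
      none (m₀ , m₁ , b₀ , b₁ , size≤ m₀ m₁ (PeriodBound.0<m b₀) (PeriodBound.0<m b₁)
        (periodic₀ (λ i → column 0 (entry (orbit i))) (λ i → entry-column (orbit i) 0) (λ i → column-0-step (orbit i)))
        (periodic₁ (λ i → column h (entry (orbit i))) (λ i → entry-column (orbit i) h) (λ i → column-top-step (orbit i)))) } }
      where
      column-degree : ∀ i → Deg< (suc d) (column i P₂)
      column-degree i j d<j = trans (P₂-degree j d<j i) (0ˢ≈0 i)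
      entry-column : ∀ S i → Deg< d (column i (entry S))
      entry-column S i j d≤j = trans (entry-y S j d≤j i) (0ˢ≈0 i)
      size≤ : ∀ m₀ m₁ → 0 < m₀ → 0 < m₁ → Periodic d m₀ (λ i → column 0 (entry (orbit i))) → Periodic d m₁ (λ i → column h (entry (orbit i))) →
              size ≤ (q ℕ.^ d) ℕ.^ h ℕ.+ (d ℕ.+ (m₀ ℕ.* m₁) ℕ.* (q ℕ.^ d) ℕ.^ h′)
      -- `m₀ * m₁` is a common period of the two columns, and the interior consists of the columns
      -- strictly between them.
      size≤ m₀@(suc _) m₁@(suc _) _ _ periodic₀ periodic₁ = size-bound d (pred (m₀ ℕ.* m₁)) interior determined
        where
        interior : State → Fin ((q ℕ.^ d) ℕ.^ h′)
        interior = block {h′} {d} (λ i → suc (toℕ i)) toℕ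
        e₀ e₁ : ℕ → Series
        e₀ i = column 0 (entry (orbit i))
        e₁ i = column h (entry (orbit i))
        determined : ∀ i i′ → d ≤ i → d ≤ i′ → i % (m₀ ℕ.* m₁) ≡ i′ % (m₀ ℕ.* m₁) →
                     interior (orbit i) ≡ interior (orbit i′) → orbit i ≃ orbit i′
        determined i i′ d≤i d≤i′ eq% eqI = ≃-by-columns {orbit i} {orbit i′} at
          where
          periodic₀′ : Periodic d (m₀ ℕ.* m₁) e₀
          periodic₀′ = ≡.subst (λ t → Periodic d t e₀) (ℕₚ.*-comm m₁ m₀) (periodic-* {e = e₀} periodic₀ m₁)
          at : ∀ (j : Fin d) x → x ≤ h → entry (orbit i) (toℕ j) x ≈ entry (orbit i′) (toℕ j) x
          at j zero    _   = periodic-% {e = e₀} periodic₀′ i i′ d≤i d≤i′ eq% (toℕ j)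
          at j (suc x) x<h with ℕₚ.m≤n⇒m<n∨m≡n x<h
          ... | inj₁ x+1<h  = block-agree {h′} {d} (λ i → suc (toℕ i)) toℕ (orbit i) (orbit i′) eqI (fromℕ< x<h′) j (≡.cong suc (Finₚ.toℕ-fromℕ< x<h′)) ≡.refl
            where
            x<h′ : x < h′
            x<h′ = ℕₚ.≤-pred (≡.subst (suc x <_) h≡ x+1<h)
          ... | inj₂ ≡.refl = periodic-% {e = e₁} (periodic-* {e = e₁} periodic₁ m₀) i i′ d≤i d≤i′ eq% (toℕ j)

    -- For h → ∞: the row of y^(d−1) is eventually periodic.

    size-bound-row : ¬ ¬ (∃[ m ] (PeriodBound (suc h) m ×
      size ≤ (q ℕ.^ d) ℕ.^ h ℕ.+ (suc h ℕ.+ m ℕ.* (q ℕ.^ d′) ℕ.^ suc h)))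
    size-bound-row none =
      -- `shift (P₂ d)` is `x` times the leading coefficient of `P` in `y`. Its degree may be
      -- `h + 1`, hence the preperiod `suc h`, and the nonzero coefficient has moved up one place.
      series-period (suc h) (shift (P₂ d)) (suc (proj₁ (proj₁ degreeʸ))) (deg-shift (P₂-degreeˣ d)) (proj₂ (proj₁ degreeʸ)) λ { (m , b , periodic) →
      none (m , b , size≤ m (PeriodBound.0<m b)
        (periodic (λ i → entry (orbit i) d′) (λ i → entry-x (orbit i) d′) (λ i → row-top-step (orbit i)))) }
      where
      size≤ : ∀ m → 0 < m → Periodic (suc h) m (λ i → entry (orbit i) d′) →
              size ≤ (q ℕ.^ d) ℕ.^ h ℕ.+ (suc h ℕ.+ m ℕ.* (q ℕ.^ d′) ℕ.^ suc h)
      size≤ (suc m′) _ periodic = size-bound (suc h) m′ interior determined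
        where
        interior : State → Fin ((q ℕ.^ d′) ℕ.^ suc h)
        interior = block {suc h} {d′} toℕ toℕ
        determined : ∀ i i′ → suc h ≤ i → suc h ≤ i′ → i % suc m′ ≡ i′ % suc m′ →
                     interior (orbit i) ≡ interior (orbit i′) → orbit i ≃ orbit i′
        determined i i′ h<i h<i′ eq% eqI = ≃-bounded {orbit i} {orbit i′} λ j x j<d x≤h → at j x x≤h (ℕₚ.m≤n⇒m<n∨m≡n (ℕₚ.≤-pred j<d))
          where
          at : ∀ j x → x ≤ h → j < d′ ⊎ j ≡ d′ → entry (orbit i) j x ≈ entry (orbit i′) j x
          at j x x≤h (inj₁ j<d′)   = block-agree {suc h} {d′} toℕ toℕ (orbit i) (orbit i′) eqI (fromℕ< (s≤s x≤h)) (fromℕ< j<d′) (Finₚ.toℕ-fromℕ< (s≤s x≤h)) (Finₚ.toℕ-fromℕ< j<d′)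
          at j x x≤h (inj₂ ≡.refl) = periodic-% {e = λ i → entry (orbit i) d′} periodic i i′ h<i h<i′ eq% x

  -- Here the coefficient of `y^0` in `P` is a constant, and it is zero because `F` has no constant
  -- term. So `P(F) = F G`, where `G 0` is the nonzero coefficient of `y`, and `F` vanishes
  -- coefficient by coefficient.
  F≈0 : h ≡ 0 → ∀ i → F i ≈ 0#
  F≈0 h≡0 = cancel F FG≈0
    where
    G : Series
    G = L.ev d (L.tail P₂) F
    G₀≉0 : ¬ G 0 ≈ 0#
    G₀≉0 eq = c₀₁≉0 (trans (sym (ev-at-0 d′ (L.tail P₂) F F₀≈0)) eq)
    P⟨F⟩ : (P₂ 0 ⊞ (F ⊛ G)) ≋ 0ˢ
    P⟨F⟩ i = trans (sym (𝐋.⟨⟩-bound (suc d) P₁ F P₂-degree i)) (P⟨F⟩≈0 i)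
    P₂0≈0 : ∀ i → P₂ 0 i ≈ 0#
    P₂0≈0 zero    = trans (sym (ev-at-0 d P₂ F F₀≈0)) (P⟨F⟩ 0)
    P₂0≈0 (suc i) = P₂-degreeˣ 0 (suc i) (≡.subst (λ h → suc h ≤ suc i) (≡.sym h≡0) (s≤s z≤n))
    FG≈0 : ∀ i → (F ⊛ G) i ≈ 0#
    FG≈0 i = trans (sym (+-identityˡ _)) (trans (+-congʳ (sym (P₂0≈0 i))) (trans (P⟨F⟩ i) (0ˢ≈0 i)))
    cancel : ∀ f → (∀ i → (f ⊛ G) i ≈ 0#) → ∀ i → f i ≈ 0#
    cancel f fG≈0 = go
      where
      f₀≈0 : f 0 ≈ 0#
      f₀≈0 = *-cancel-0 G₀≉0 (trans (*-comm _ _) (trans (sym (⊛-head f G)) (fG≈0 0)))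
      go : ∀ i → f i ≈ 0#
      go zero    = f₀≈0
      go (suc i) = cancel (tail f) (λ j → trans (sym (+-identityˡ _)) (trans (+-congʳ (sym (trans (*-congʳ f₀≈0) (zeroˡ _))))
        (trans (sym (⊛-tail f G j)) (fG≈0 (suc j))))) i

-- Null sequences c/(n + 1)

reciprocal : ℕ → ℕ → ℚ
reciprocal c n = (ℤ.+ c) ℚ./ suc n

reciprocal-toℚᵘ : ∀ c n → toℚᵘ (reciprocal c n) ℚᵘ.≃ mkℚᵘ (ℤ.+ c) n
reciprocal-toℚᵘ c n = ℚₚ.toℚᵘ-fromℚᵘ (mkℚᵘ (ℤ.+ c) n)

reciprocal-nonNegative : ∀ c n → 0ℚ ℚ.≤ reciprocal c n
reciprocal-nonNegative c n = ℚₚ.toℚᵘ-cancel-≤ (ℚᵘₚ.≤-respʳ-≃ (ℚᵘₚ.≃-sym (reciprocal-toℚᵘ c n))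
  (*≤* (≡.subst₂ ℤ._≤_ (≡.sym (ℤₚ.*-zeroˡ (ℤ.+ suc n))) (≡.sym (ℤₚ.*-identityʳ (ℤ.+ c))) (+≤+ z≤n))))

reciprocal-tendsToZero : ∀ c → TendsToZero (reciprocal c)
reciprocal-tendsToZero c (mkℚ (ℤ.+ zero)   b _) (ℚ.*<* (+<+ ()))
reciprocal-tendsToZero c (mkℚ ℤ.-[1+ a ] b _) (ℚ.*<* ())
-- For `δ = (a + 1)/(b + 1)` the threshold `c (b + 1)` works, as `c (b + 1) < (a + 1) (n + 1)` from
-- there on.
reciprocal-tendsToZero c δ@(mkℚ (ℤ.+ suc a) b _) _ = c ℕ.* suc b , λ n N≤n →
  ≡.subst (ℚ._< δ) (≡.sym (ℚₚ.0≤p⇒∣p∣≡p (reciprocal-nonNegative c n)))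
    (ℚₚ.toℚᵘ-cancel-< (ℚᵘₚ.<-respˡ-≃ (ℚᵘₚ.≃-sym (reciprocal-toℚᵘ c n)) (*<* (below n N≤n))))
  where
  below : ∀ n → c ℕ.* suc b ≤ n → (ℤ.+ c) ℤ.* (ℤ.+ suc b) ℤ.< (ℤ.+ suc a) ℤ.* (ℤ.+ suc n)
  below n N≤n = ≡.subst (ℤ._< (ℤ.+ suc a) ℤ.* (ℤ.+ suc n)) (ℤₚ.pos-* c (suc b))
    (+<+ (ℕₚ.≤-trans (s≤s N≤n) (ℕₚ.m≤m+n (suc n) (a ℕ.* suc n))))

rational-bound : ∀ s c n Q → s ℕ.* suc n ≤ (suc n ℕ.+ c) ℕ.* Q →
                 (ℤ.+ s) ℚ./ 1 ℚ.≤ (1ℚ ℚ.+ reciprocal c n) ℚ.* ((ℤ.+ Q) ℚ./ 1)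
rational-bound s c n Q le = ℚₚ.toℚᵘ-cancel-≤ (begin
  toℚᵘ ((ℤ.+ s) ℚ./ 1) ≃⟨ ℚₚ.toℚᵘ-fromℚᵘ (mkℚᵘ (ℤ.+ s) 0) ⟩
  mkℚᵘ (ℤ.+ s) 0 ≤⟨ *≤* integers ⟩
  (ℚᵘ.1ℚᵘ ℚᵘ.+ mkℚᵘ (ℤ.+ c) n) ℚᵘ.* mkℚᵘ (ℤ.+ Q) 0 ≃⟨ ℚᵘₚ.*-cong (ℚᵘₚ.+-congʳ ℚᵘ.1ℚᵘ (reciprocal-toℚᵘ c n)) (ℚₚ.toℚᵘ-fromℚᵘ (mkℚᵘ (ℤ.+ Q) 0)) ⟨
  (toℚᵘ 1ℚ ℚᵘ.+ toℚᵘ (reciprocal c n)) ℚᵘ.* toℚᵘ ((ℤ.+ Q) ℚ./ 1) ≃⟨ ℚᵘₚ.*-congʳ (ℚₚ.toℚᵘ-homo-+ 1ℚ (reciprocal c n)) ⟨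
  toℚᵘ (1ℚ ℚ.+ reciprocal c n) ℚᵘ.* toℚᵘ ((ℤ.+ Q) ℚ./ 1) ≃⟨ ℚₚ.toℚᵘ-homo-* (1ℚ ℚ.+ reciprocal c n) ((ℤ.+ Q) ℚ./ 1) ⟨
  toℚᵘ ((1ℚ ℚ.+ reciprocal c n) ℚ.* ((ℤ.+ Q) ℚ./ 1)) ∎)
  where
  open ℚᵘₚ.≤-Reasoning
  denominator : suc (n ℕ.+ 0) ℕ.* 1 ≡ suc n
  denominator = ≡.trans (ℕₚ.*-identityʳ _) (≡.cong suc (ℕₚ.+-identityʳ n))
  numerator : ((ℤ.+ 1) ℤ.* (ℤ.+ suc n) ℤ.+ (ℤ.+ c) ℤ.* (ℤ.+ 1)) ℤ.* (ℤ.+ Q) ≡ ℤ.+ ((suc n ℕ.+ c) ℕ.* Q)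
  numerator = ≡.trans (≡.cong₂ (λ x y → (x ℤ.+ y) ℤ.* (ℤ.+ Q)) (ℤₚ.*-identityˡ (ℤ.+ suc n)) (ℤₚ.*-identityʳ (ℤ.+ c)))
    (≡.sym (ℤₚ.pos-* (suc n ℕ.+ c) Q))
  integers : (ℤ.+ s) ℤ.* (ℤ.+ (suc (n ℕ.+ 0) ℕ.* 1)) ℤ.≤ (((ℤ.+ 1) ℤ.* (ℤ.+ suc n) ℤ.+ (ℤ.+ c) ℤ.* (ℤ.+ 1)) ℤ.* (ℤ.+ Q)) ℤ.* (ℤ.+ 1)
  integers = ≡.subst₂ ℤ._≤_
    (≡.trans (ℤₚ.pos-* s (suc n)) (≡.cong (λ m → (ℤ.+ s) ℤ.* (ℤ.+ m)) (≡.sym denominator)))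
    (≡.trans (≡.sym numerator) (≡.sym (ℤₚ.*-identityʳ _)))
    (+≤+ le)

-- Minimal automata of Furstenberg series

-- What the asymptotics need to know about a size `s`, detached from the field and the polynomial.
-- `columns` serves growing `q` and `d`, `row` growing `h`; for `h` = 0 the two extreme columns
-- coincide and `trivial` takes over.
record SizeBounds (q h d s : ℕ) : Set where
  field
    trivial : h ≡ 0 → s ≤ 1
    columns : ∀ h′ → h ≡ suc h′ → ¬ ¬ (∃[ m₀ ] ∃[ m₁ ] (PeriodBound d m₀ × PeriodBound d m₁ ×
              s ≤ (q ℕ.^ d) ℕ.^ h ℕ.+ (d ℕ.+ (m₀ ℕ.* m₁) ℕ.* (q ℕ.^ d) ℕ.^ h′)))
    row     : ∀ d′ → d ≡ suc d′ → ¬ ¬ (∃[ m ] (PeriodBound (suc h) m ×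
              s ≤ (q ℕ.^ d) ℕ.^ h ℕ.+ (suc h ℕ.+ m ℕ.* (q ℕ.^ d′) ℕ.^ suc h)))

module _ {c ℓ : Level} where

  furstenberg-automaton : ∀ {q} (K : FiniteField c ℓ q) → IsPrimePower q → ∀ {h d} →
    let R = FiniteField.commutativeRing K in
    (P : Polynomial₂ R) → FurstenbergCondition R P → HasDegreeˣ R P h → HasDegreeʸ R P d →
    (F : PowerSeries R) → IsFurstenbergSeries R P F →
    ∃[ M ] (IsMinimalAutomaton (CommutativeRing.setoid R) {q} M F × 0 < d × SizeBounds q h d (Automaton.size M))
  furstenberg-automaton {zero} K pp P cond hx hy F isF = contradiction (FiniteFieldProperties.2≤q K) λ ()
  furstenberg-automaton {suc n} K pp {d = zero} P cond hx hy F isF =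
    contradiction (EvaluationAtOrigin.eval-origin R (∂ʸ R P) (trans (+-identityʳ _) (proj₂ hy 0 1 (s≤s z≤n)))) (proj₂ cond)
    where
    R : CommutativeRing c ℓ
    R = FiniteField.commutativeRing K
    open CommutativeRing R hiding (zero)
  furstenberg-automaton {suc n} K (p , k , pr , q≡p^k) {h} {suc d′} P cond hx hy F isF =
    automaton , minimal , s≤s z≤n , record
      -- Minimality is applied to the one-state automaton with output 0, since the series is zero.
      { trivial = λ h≡0 → proj₂ (proj₂ minimal) (oneState) (λ m ds _ _ → sym (F.F≈0 h≡0 m)) (λ m ds _ → sym (F.F≈0 h≡0 m))
      ; columns = F.size-bound-columns access states-distinct
      ; row     = λ { _ ≡.refl → F.size-bound-row access states-distinct } }
    where
    open CommutativeRing (FiniteField.commutativeRing K) hiding (zero)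
    module F = Furstenberg K {p} {k} pr q≡p^k P cond hx hy F isF
    open Minimisation setoid (FiniteFieldProperties._≈?_ K) F.transition F.output F.initialState F.code
      (λ {S} {S′} r eq → F.code-cong {F.transition S r} {F.transition S′ r}
        (F.transition-cong {S} {S′} r (F.code-injective {S} {S′} eq)))
      (λ {S} {S′} eq → *-congˡ (F.code-injective {S} {S′} eq 0 0)) F F.generates
    oneState : Automaton (suc n) Carrier
    oneState = record { size = 1 ; initial = zero ; step = λ _ _ → zero ; output = λ _ → 0# }

-- Arithmetic

module Arithmetic where

  open import Data.Nat.Base using (_+_; _*_; _^_)

  -- `(n + 1) (3/4)^n` does not increase from `n` = 2 on; the cases up to 2 are checked directly.
  [1+n]3^n≤2*4^n : ∀ n → suc n * 3 ^ n ≤ 2 * (2 ^ n * 2 ^ n)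
  [1+n]3^n≤2*4^n 0 = s≤s z≤n
  [1+n]3^n≤2*4^n 1 = ℕₚ.m≤m+n 6 2
  [1+n]3^n≤2*4^n 2 = ℕₚ.m≤m+n 27 5
  [1+n]3^n≤2*4^n (suc (suc n@(suc j))) = begin
    suc m * (3 * 3 ^ pred m) ≡⟨ solve 2 (λ j x → (con 4 :+ j) :* (con 3 :* x) := (con 12 :+ con 3 :* j) :* x) ≡.refl j (3 ^ pred m) ⟩
    (12 + 3 * j) * 3 ^ pred m ≤⟨ ℕₚ.*-monoˡ-≤ (3 ^ pred m) (ℕₚ.+-mono-≤ (ℕₚ.≤-refl {12}) (ℕₚ.*-monoˡ-≤ j (ℕₚ.n≤1+n 3))) ⟩
    (12 + 4 * j) * 3 ^ pred m ≡⟨ solve 2 (λ j x → (con 12 :+ con 4 :* j) :* x := con 4 :* ((con 3 :+ j) :* x)) ≡.refl j (3 ^ pred m) ⟩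
    4 * (suc (pred m) * 3 ^ pred m) ≤⟨ ℕₚ.*-monoʳ-≤ 4 ([1+n]3^n≤2*4^n (suc n)) ⟩
    4 * (2 * (2 ^ pred m * 2 ^ pred m)) ≡⟨ solve 1 (λ x → con 4 :* (con 2 :* (x :* x)) := con 2 :* ((con 2 :* x) :* (con 2 :* x))) ≡.refl (2 ^ pred m) ⟩
    2 * (2 ^ m * 2 ^ m) ∎
    where
    open ℕₚ.≤-Reasoning
    open +-*-Solver
    m = suc (suc n)

  n[1+n]≤2*2^n : ∀ n → n * suc n ≤ 2 * 2 ^ n
  n[1+n]≤2*2^n 0 = z≤n
  n[1+n]≤2*2^n 1 = ℕₚ.m≤m+n 2 2
  n[1+n]≤2*2^n 2 = ℕₚ.m≤m+n 6 2
  n[1+n]≤2*2^n (suc (suc n@(suc j))) = begin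
    (3 + j) * (4 + j) ≡⟨ solve 1 (λ j → (con 3 :+ j) :* (con 4 :+ j) := con 12 :+ con 7 :* j :+ j :* j) ≡.refl j ⟩
    12 + 7 * j + j * j ≤⟨ ℕₚ.m≤m+n _ (3 * j + j * j) ⟩
    12 + 7 * j + j * j + (3 * j + j * j) ≡⟨ solve 1 (λ j → con 12 :+ con 7 :* j :+ j :* j :+ (con 3 :* j :+ j :* j) := con 2 :* ((con 2 :+ j) :* (con 3 :+ j))) ≡.refl j ⟩
    2 * ((2 + j) * (3 + j)) ≤⟨ ℕₚ.*-monoʳ-≤ 2 (n[1+n]≤2*2^n (suc n)) ⟩
    2 * (2 * 2 ^ suc n) ∎
    where
    open ℕₚ.≤-Reasoning
    open +-*-Solver

  private
    C₀ : ℕ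
    C₀ = productConstant

  square-bound : ∀ {N m t} → PeriodBound N m → t ≤ m * m → t * 2 ^ N ≤ C₀ * 3 ^ N
  square-bound {N} b t≤ = ℕₚ.≤-trans (ℕₚ.*-monoˡ-≤ (2 ^ N) t≤) (PeriodBound.m²≤ b)

  -- A product is at most the square of its larger factor; this is why the squares of periods are
  -- bounded.
  product-bound₂ : ∀ {N m₀ m₁} → PeriodBound N m₀ → PeriodBound N m₁ → m₀ * m₁ * 2 ^ N ≤ C₀ * 3 ^ N
  product-bound₂ {N} {m₀} {m₁} b₀ b₁ with ℕₚ.≤-total m₀ m₁
  ... | inj₁ m₀≤m₁ = square-bound b₁ (ℕₚ.*-monoˡ-≤ m₁ m₀≤m₁)
  ... | inj₂ m₁≤m₀ = square-bound b₀ (ℕₚ.*-monoʳ-≤ m₀ m₁≤m₀)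

  -- A quantity of order `(3/2)^N` leaves room for a factor `N + 1` below `2^N`; for growing `d` and
  -- `h` this is the source of the error `c/(N + 1)`.
  linear-bound : ∀ {N t} → t * 2 ^ N ≤ C₀ * 3 ^ N → t * suc N ≤ 2 * C₀ * 2 ^ N
  linear-bound {N} {t} le = ℕₚ.*-cancelʳ-≤ _ _ (2 ^ N) {{ℕₚ.m^n≢0 2 N}} (begin
    t * suc N * 2 ^ N ≡⟨ solve 3 (λ t n x → t :* n :* x := n :* (t :* x)) ≡.refl t (suc N) (2 ^ N) ⟩
    suc N * (t * 2 ^ N) ≤⟨ ℕₚ.*-monoʳ-≤ (suc N) le ⟩
    suc N * (C₀ * 3 ^ N) ≡⟨ solve 3 (λ n c x → n :* (c :* x) := c :* (n :* x)) ≡.refl (suc N) C₀ (3 ^ N) ⟩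
    C₀ * (suc N * 3 ^ N) ≤⟨ ℕₚ.*-monoʳ-≤ C₀ ([1+n]3^n≤2*4^n N) ⟩
    C₀ * (2 * (2 ^ N * 2 ^ N)) ≡⟨ solve 2 (λ c x → c :* (con 2 :* (x :* x)) := con 2 :* c :* x :* x) ≡.refl C₀ (2 ^ N) ⟩
    2 * C₀ * 2 ^ N * 2 ^ N ∎)
    where
    open ℕₚ.≤-Reasoning
    open +-*-Solver

  ^-distribʳ-* : ∀ a b n → (a * b) ^ n ≡ a ^ n * b ^ n
  ^-distribʳ-* a b zero    = ≡.refl
  ^-distribʳ-* a b (suc n) = ≡.trans (≡.cong (a * b *_) (^-distribʳ-* a b n))
    (solve 4 (λ a b x y → a :* b :* (x :* y) := a :* x :* (b :* y)) ≡.refl a b (a ^ n) (b ^ n))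
    where open +-*-Solver

  [q^d]^h≡ : ∀ q d h → (q ^ d) ^ h ≡ q ^ (h * d)
  [q^d]^h≡ q d h = ≡.trans (ℕₚ.^-*-assoc q d h) (≡.cong (q ^_) (ℕₚ.*-comm d h))

  size-from-excess : ∀ {q h d s e N c} → s ≤ (q ^ d) ^ h + e → e * suc N ≤ c * (q ^ d) ^ h →
                     s * suc N ≤ (suc N + c) * q ^ (h * d)
  size-from-excess {q} {h} {d} {s} {e} {N} {c} s≤ e≤ = begin
    s * suc N ≤⟨ ℕₚ.*-monoˡ-≤ (suc N) s≤ ⟩
    (B + e) * suc N ≡⟨ ℕₚ.*-distribʳ-+ (suc N) B e ⟩
    B * suc N + e * suc N ≤⟨ ℕₚ.+-mono-≤ (ℕₚ.≤-reflexive (ℕₚ.*-comm B (suc N))) e≤ ⟩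
    suc N * B + c * B ≡⟨ ℕₚ.*-distribʳ-+ B (suc N) c ⟨
    (suc N + c) * B ≡⟨ ≡.cong ((suc N + c) *_) ([q^d]^h≡ q d h) ⟩
    (suc N + c) * q ^ (h * d) ∎
    where
    open ℕₚ.≤-Reasoning
    B : ℕ
    B = (q ^ d) ^ h

  positive-power : ∀ {q} n → 2 ≤ q → 1 ≤ q ^ n
  positive-power n 2≤q = ℕₚ.≤-trans (s≤s z≤n) (n<m^n n 2≤q)

  -- `N` stands for `q` or `d`, whichever grows. The excess is at most `(q^d)^(h−1)` times `d + m`,
  -- so a single factor `q^d` of the main term has to absorb `d + m`.
  size-bound-by-columns : ∀ {q h d s} N c → 2 ≤ q → SizeBounds q h d s →
    (∀ m → m * 2 ^ d ≤ C₀ * 3 ^ d → (d + m) * suc N ≤ c * q ^ d) →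
    s * suc N ≤ (suc N + c) * q ^ (h * d)
  size-bound-by-columns {q} {zero} {d} {s} N c 2≤q bounds _ = begin
    s * suc N ≤⟨ ℕₚ.*-monoˡ-≤ (suc N) (SizeBounds.trivial bounds ≡.refl) ⟩
    1 * suc N ≡⟨ ℕₚ.*-comm 1 (suc N) ⟩
    suc N * 1 ≤⟨ ℕₚ.*-monoˡ-≤ 1 (ℕₚ.m≤m+n (suc N) c) ⟩
    (suc N + c) * 1 ∎
    where open ℕₚ.≤-Reasoning
  -- The goal is a decidable inequality, so the periods may be taken out of their double negation.
  size-bound-by-columns {q} {suc h′} {d} {s} N c 2≤q bounds small = decidable-stable (_ ℕₚ.≤? _) λ fails →
    SizeBounds.columns bounds h′ ≡.refl λ { (m₀ , m₁ , b₀ , b₁ , s≤) → fails (size-from-excess {q} {suc h′} {d} {s} s≤ (excess (m₀ * m₁) (product-bound₂ b₀ b₁))) }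
    where
    open ℕₚ.≤-Reasoning
    open +-*-Solver
    B T : ℕ
    B = q ^ d
    T = B ^ h′
    1≤T : 1 ≤ T
    1≤T = ≡.subst (1 ≤_) (≡.sym ([q^d]^h≡ q d h′)) (positive-power (h′ * d) 2≤q)
    excess : ∀ m → m * 2 ^ d ≤ C₀ * 3 ^ d → (d + m * T) * suc N ≤ c * (B * T)
    excess m m≤ = begin
      (d + m * T) * suc N ≤⟨ ℕₚ.*-monoˡ-≤ (suc N) (ℕₚ.+-monoˡ-≤ (m * T) (ℕₚ.m≤m*n d T {{ℕ.>-nonZero 1≤T}})) ⟩
      (d * T + m * T) * suc N ≡⟨ solve 4 (λ d m t n → (d :* t :+ m :* t) :* n := (d :+ m) :* n :* t) ≡.refl d m T (suc N) ⟩
      (d + m) * suc N * T ≤⟨ ℕₚ.*-monoˡ-≤ T (small m m≤) ⟩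
      c * B * T ≡⟨ ℕₚ.*-assoc c B T ⟩
      c * (B * T) ∎

  constant-q : ℕ → ℕ
  constant-q d = 2 * (d + C₀ * 3 ^ d)

  constant-d : ℕ
  constant-d = 2 + 2 * C₀

  -- The factor `q^d` arises because the row argument leaves `(q^(d−1))^(h+1)` interiors, and this
  -- number times `q^(h+1)` is `q^d` times the main term.
  constant-h : ℕ → ℕ → ℕ
  constant-h q d = (4 + 2 * C₀) * q ^ d

  size-bound-q : ∀ {q h d s} → 2 ≤ q → 0 < d → SizeBounds q h d s →
                 s * suc q ≤ (suc q + constant-q d) * q ^ (h * d)
  size-bound-q {q} {h} {d@(suc d′)} {s} 2≤q _ bounds = size-bound-by-columns {q} {h} {d} {s} q (constant-q d) 2≤q bounds λ m m≤ → begin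
    (d + m) * suc q ≤⟨ ℕₚ.*-mono-≤ (ℕₚ.+-monoʳ-≤ d (ℕₚ.≤-trans (ℕₚ.m≤m*n m (2 ^ d) {{ℕₚ.m^n≢0 2 d}}) m≤)) suc-q≤ ⟩
    (d + C₀ * 3 ^ d) * (2 * q ^ d) ≡⟨ solve 2 (λ x y → x :* (con 2 :* y) := con 2 :* x :* y) ≡.refl (d + C₀ * 3 ^ d) (q ^ d) ⟩
    constant-q d * q ^ d ∎
    where
    open ℕₚ.≤-Reasoning
    open +-*-Solver
    suc-q≤ : suc q ≤ 2 * q ^ d
    suc-q≤ = begin
      1 + q ≤⟨ ℕₚ.+-monoˡ-≤ q (ℕₚ.<⇒≤ 2≤q) ⟩
      q + q ≡⟨ ≡.cong (q +_) (ℕₚ.+-identityʳ q) ⟨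
      2 * q ≤⟨ ℕₚ.*-monoʳ-≤ 2 (ℕₚ.m≤m*n q (q ^ d′) {{ℕ.>-nonZero (positive-power d′ 2≤q)}}) ⟩
      2 * q ^ d ∎

  size-bound-d : ∀ {q h d s} → 2 ≤ q → SizeBounds q h d s →
                 s * suc d ≤ (suc d + constant-d) * q ^ (h * d)
  size-bound-d {q} {h} {d} {s} 2≤q bounds = size-bound-by-columns {q} {h} {d} {s} d constant-d 2≤q bounds λ m m≤ → begin
    (d + m) * suc d ≡⟨ ℕₚ.*-distribʳ-+ (suc d) d m ⟩
    d * suc d + m * suc d ≤⟨ ℕₚ.+-mono-≤ (n[1+n]≤2*2^n d) (linear-bound {d} {m} m≤) ⟩
    2 * 2 ^ d + 2 * C₀ * 2 ^ d ≡⟨ ℕₚ.*-distribʳ-+ (2 ^ d) 2 (2 * C₀) ⟨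
    constant-d * 2 ^ d ≤⟨ ℕₚ.*-monoʳ-≤ constant-d (ℕₚ.^-monoˡ-≤ d 2≤q) ⟩
    constant-d * q ^ d ∎
    where open ℕₚ.≤-Reasoning

  size-bound-h : ∀ {q h d s} → 2 ≤ q → 0 < d → SizeBounds q h d s →
                 s * suc h ≤ (suc h + constant-h q d) * q ^ (h * d)
  size-bound-h {q} {h} {d@(suc d′)} {s} 2≤q _ bounds = decidable-stable (_ ℕₚ.≤? _) λ fails →
    SizeBounds.row bounds d′ ≡.refl λ { (m , b , s≤) → fails (size-from-excess {q} {h} {d} {s} s≤ (excess m b)) }
    where
    open ℕₚ.≤-Reasoning
    open +-*-Solver
    B Bʰ T H : ℕ
    B = q ^ d
    Bʰ = B ^ h
    H = suc h
    T = (q ^ d′) ^ H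
    2^H≤ : 2 ^ H ≤ 2 * Bʰ
    2^H≤ = ℕₚ.*-monoʳ-≤ 2 (ℕₚ.^-monoˡ-≤ h (ℕₚ.≤-trans 2≤q (ℕₚ.m≤m*n q (q ^ d′) {{ℕ.>-nonZero (positive-power d′ 2≤q)}})))
    q^H*T : q ^ H * T ≡ B * Bʰ
    q^H*T = ≡.sym (^-distribʳ-* q (q ^ d′) H)
    m≤m² : ∀ m → 0 < m → m ≤ m * m
    m≤m² (suc m) _ = ℕₚ.m≤m*n (suc m) (suc m)
    excess : ∀ m → PeriodBound H m → (H + m * T) * H ≤ constant-h q d * Bʰ
    excess m b = begin
      (H + m * T) * H ≤⟨ ℕₚ.*-monoʳ-≤ (H + m * T) (ℕₚ.n≤1+n H) ⟩
      (H + m * T) * suc H ≡⟨ solve 4 (λ x m t n → (x :+ m :* t) :* n := x :* n :+ m :* n :* t) ≡.refl H m T (suc H) ⟩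
      H * suc H + m * suc H * T ≤⟨ ℕₚ.+-mono-≤ (n[1+n]≤2*2^n H) (ℕₚ.*-monoˡ-≤ T (linear-bound {H} {m} (square-bound b (m≤m² m (PeriodBound.0<m b))))) ⟩
      2 * 2 ^ H + 2 * C₀ * 2 ^ H * T ≤⟨ ℕₚ.+-mono-≤ (ℕₚ.*-monoʳ-≤ 2 2^H≤) (ℕₚ.*-monoˡ-≤ T (ℕₚ.*-monoʳ-≤ (2 * C₀) (ℕₚ.^-monoˡ-≤ H 2≤q))) ⟩
      2 * (2 * Bʰ) + 2 * C₀ * q ^ H * T ≡⟨ ≡.cong₂ ℕ._+_ (≡.sym (ℕₚ.*-assoc 2 2 Bʰ)) (≡.trans (ℕₚ.*-assoc (2 * C₀) (q ^ H) T) (≡.cong (2 * C₀ *_) q^H*T)) ⟩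
      4 * Bʰ + 2 * C₀ * (B * Bʰ) ≤⟨ ℕₚ.+-monoˡ-≤ _ (ℕₚ.*-monoʳ-≤ 4 (ℕₚ.m≤n*m Bʰ B {{ℕ.>-nonZero (positive-power d 2≤q)}})) ⟩
      4 * (B * Bʰ) + 2 * C₀ * (B * Bʰ) ≡⟨ solve 3 (λ c b t → con 4 :* (b :* t) :+ con 2 :* c :* (b :* t) := (con 4 :+ con 2 :* c) :* b :* t) ≡.refl C₀ B Bʰ ⟩
      constant-h q d * Bʰ ∎

open Arithmetic

-- The three limits

module _ {c ℓ : Level} where

  bounded-over : ∀ {q h d} N a → IsPrimePower q →
    (∀ {s} → 2 ≤ q → 0 < d → SizeBounds q h d s → s ℕ.* suc N ≤ (suc N ℕ.+ a) ℕ.* q ℕ.^ (h ℕ.* d)) →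
    MinimalSizesBounded c ℓ q h d (reciprocal a N)
  bounded-over {q} {h} {d} N a pp bound K P cond hx hy F isF = conclude (furstenberg-automaton K pp P cond hx hy F isF)
    where
    R = FiniteField.commutativeRing K
    conclude : ∃[ M ] (IsMinimalAutomaton (CommutativeRing.setoid R) {q} M F × 0 < d × SizeBounds q h d (Automaton.size M)) → _
    conclude (M , minimal , 0<d , bounds) = M , minimal , rational-bound (Automaton.size M) a N (q ℕ.^ (h ℕ.* d)) (bound (FiniteFieldProperties.2≤q K) 0<d bounds)

theorem2 : ∀ {c ℓ} →
    (∀ (h d : ℕ) →
    ∃[ ε ] (TendsToZero ε × (∀ q → IsPrimePower q → MinimalSizesBounded c ℓ q h d (ε q))))
    × (∀ (q d : ℕ) → IsPrimePower q →
    ∃[ ε ] (TendsToZero ε × (∀ h → MinimalSizesBounded c ℓ q h d (ε h))))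
    × (∀ (q h : ℕ) → IsPrimePower q →
    ∃[ ε ] (TendsToZero ε × (∀ d → MinimalSizesBounded c ℓ q h d (ε d))))
theorem2 =
    (λ h d → reciprocal (constant-q d) , reciprocal-tendsToZero (constant-q d) ,
      λ q pp → bounded-over {h = h} q (constant-q d) pp (size-bound-q {h = h}))
  , (λ q d pp → reciprocal (constant-h q d) , reciprocal-tendsToZero (constant-h q d) ,
      λ h → bounded-over h (constant-h q d) pp size-bound-h)
  , (λ q h pp → reciprocal constant-d , reciprocal-tendsToZero constant-d ,
      λ d → bounded-over {h = h} d constant-d pp (λ 2≤q _ → size-bound-d {h = h} 2≤q))
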